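{- Let $t$ be a positive integer. Then there exists a positive integer $K(t)$ such that if a graph $G$ satisfies the following conditions: (i) $d(x)>K(t)$ holds for all $x\in V(G)$; (ii) for all $x\in V(G)$, any $(t^2+1)$-plex of $G$ containing $x$ has order at most $\frac{d(x)-K(t)}{t}$; (iii) $\lambda_{\min}(G)\ge -t-1$; then $G$ is the intersection graph of some linear $(t+1)$-uniform hypergraph.
   Context: All graphs are finite, undirected and simple. $d(x)$ is the degree of $x$ in $G$, and $\lambda_{\min}(G)$ is the smallest eigenvalue of the adjacency matrix of $G$. For a positive integer $p$, a $p$-plex of $G$ is an induced subgraph in which each vertex is adjacent to all but at most $p-1$ of the other vertices of that subgraph; its order is its number of vertices. A hypergraph $H$ is a pair $(X,E)$ with $X$ a finite set (vertices) and $E$ a set of non-empty subsets of $X$ (edges). It is $h$-uniform ($h\ge 2$) if every edge has cardinality $h$; it is linear if every pair of distinct vertices is contained in at most one edge. The intersection graph of $H=(X,E)$ is the graph with vertex set $E$ in which two distinct edges $e,e'\in E$ are adjacent iff $e\cap e'\ne\emptyset$. Graphs are identified up to isomorphism. -}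

module Defs where

open import Data.Bool.Base using (if_then_else_)
import Data.Bool.Properties as Bool
open import Data.Fin.Base using (Fin)
open import Data.Fin.Subset using (Subset; Nonempty; _∈_; _∩_; _─_; _-_; ∣_∣)
open import Data.Fin.Subset.Properties using (nonempty?; ∩-comm)
open import Data.List.Base using (List; length; lookup)
open import Data.List.Relation.Unary.All using (All)
open import Data.List.Relation.Unary.Unique.Propositional using (Unique)
import Data.List.Membership.Propositional as List
open import Data.Nat.Base as ℕ using (ℕ; _∸_; _⊔_)
import Data.Nat.Properties as ℕ
open import Data.Product.Base using (Σ-syntax; ∃-syntax; _×_; _,_; proj₁; proj₂)
open import Data.Rational.Base as ℚ using (ℚ; 0ℚ; 1ℚ; ½)
import Data.Rational.Properties as ℚ
open import Data.Rational.Solver using (module +-*-Solver)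
open import Data.Vec.Base using (tabulate)
import Data.Vec.Functional as Vector
import Data.Vec.Properties as Vec
open import Function.Base using (_∘_)
open import Function.Bundles using (_↔_; _⇔_; Inverse)
open import Level using (0ℓ)
open import Relation.Binary.Core using (Rel)
open import Relation.Binary.Definitions using (Decidable; Symmetric; Irreflexive)
open import Relation.Binary.PropositionalEquality
open import Relation.Nullary.Decidable using (does; ¬?; _×-dec_)
open import Relation.Nullary.Negation using (¬_)

------------------------------------------------------------------------
-- Real numbers, as Cauchy sequences of rationals up to _≃_

dist : ℚ → ℚ → ℚ
dist p q = ℚ.∣ p ℚ.- q ∣

IsCauchy : (ℕ → ℚ) → Set
IsCauchy x = ∀ ε → 0ℚ ℚ.< ε →
  ∃[ N ] (∀ m n → N ℕ.≤ m → N ℕ.≤ n → dist (x m) (x n) ℚ.< ε)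

record ℝ : Set where
  constructor mkℝ
  field
    seq    : ℕ → ℚ
    cauchy : IsCauchy seq

open ℝ public

infix 4 _≃_ _≤ℝ_

_≃_ : Rel ℝ 0ℓ
x ≃ y = ∀ ε → 0ℚ ℚ.< ε →
  ∃[ N ] (∀ n → N ℕ.≤ n → dist (seq x n) (seq y n) ℚ.< ε)

_≤ℝ_ : Rel ℝ 0ℓ
x ≤ℝ y = ∀ ε → 0ℚ ℚ.< ε →
  ∃[ N ] (∀ n → N ℕ.≤ n → seq x n ℚ.≤ seq y n ℚ.+ ε)

private
  open +-*-Solver using (solve; _:=_; _:+_; _:*_; _:-_)

  +-rearrange : ∀ a b c d → (a ℚ.+ b) ℚ.- (c ℚ.+ d) ≡ (a ℚ.- c) ℚ.+ (b ℚ.- d)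
  +-rearrange = solve 4 (λ a b c d →
    (a :+ b) :- (c :+ d) := (a :- c) :+ (b :- d)) refl

  *-rearrange : ∀ a b c d →
    a ℚ.* b ℚ.- c ℚ.* d ≡ a ℚ.* (b ℚ.- d) ℚ.+ d ℚ.* (a ℚ.- c)
  *-rearrange = solve 4 (λ a b c d →
    a :* b :- c :* d := a :* (b :- d) :+ d :* (a :- c)) refl

  cancel : ∀ a b → a ≡ (a ℚ.- b) ℚ.+ b
  cancel = solve 2 (λ a b → a := (a :- b) :+ b) refl

  halves : ∀ ε → ½ ℚ.* ε ℚ.+ ½ ℚ.* ε ≡ ε
  halves ε = trans (sym (ℚ.*-distribʳ-+ ε ½ ½)) (ℚ.*-identityˡ ε)

  pos*pos : ∀ p q → 0ℚ ℚ.< p → 0ℚ ℚ.< q → 0ℚ ℚ.< p ℚ.* q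
  pos*pos p q 0<p 0<q = ℚ.positive⁻¹ (p ℚ.* q)
    {{ℚ.pos*pos⇒pos p {{ℚ.positive 0<p}} q {{ℚ.positive 0<q}}}}

  divide : ∀ p ε → 0ℚ ℚ.< p → 0ℚ ℚ.< ε → ∃[ δ ] (0ℚ ℚ.< δ × p ℚ.* δ ≡ ε)
  divide p ε 0<p 0<ε = 1/p ℚ.* ε , pos*pos 1/p ε 0<1/p 0<ε , (begin
    p ℚ.* (1/p ℚ.* ε)   ≡⟨ ℚ.*-assoc p 1/p ε ⟨
    (p ℚ.* 1/p) ℚ.* ε   ≡⟨ cong (ℚ._* ε) (ℚ.*-inverseʳ p {{p≢0}}) ⟩
    1ℚ ℚ.* ε            ≡⟨ ℚ.*-identityˡ ε ⟩
    ε                   ∎)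
    where
    open ≡-Reasoning
    p≢0 : ℚ.NonZero p
    p≢0 = ℚ.pos⇒nonZero p {{ℚ.positive 0<p}}
    1/p : ℚ
    1/p = (ℚ.1/ p) {{p≢0}}
    0<1/p : 0ℚ ℚ.< 1/p
    0<1/p = ℚ.positive⁻¹ 1/p {{ℚ.1/pos⇒pos p {{ℚ.positive 0<p}}}}

  *-bound : ∀ {p B q δ} → ℚ.∣ p ∣ ℚ.< B → ℚ.∣ q ∣ ℚ.< δ → ℚ.∣ p ℚ.* q ∣ ℚ.< B ℚ.* δ
  *-bound {p} {B} {q} {δ} p<B q<δ = begin-strict
    ℚ.∣ p ℚ.* q ∣           ≡⟨ ℚ.∣p*q∣≡∣p∣*∣q∣ p q ⟩
    ℚ.∣ p ∣ ℚ.* ℚ.∣ q ∣     ≤⟨ ℚ.*-monoʳ-≤-nonNeg ℚ.∣ q ∣ {{ℚ.∣-∣-nonNeg q}} (ℚ.<⇒≤ p<B) ⟩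
    B ℚ.* ℚ.∣ q ∣           <⟨ ℚ.*-monoʳ-<-pos B {{ℚ.positive 0<B}} q<δ ⟩
    B ℚ.* δ                 ∎
    where
    open ℚ.≤-Reasoning
    0<B : 0ℚ ℚ.< B
    0<B = ℚ.≤-<-trans (ℚ.0≤∣p∣ p) p<B

  EventuallyBoundedBy : (ℕ → ℚ) → ℚ → Set
  EventuallyBoundedBy x B = ∃[ N ] (∀ n → N ℕ.≤ n → ℚ.∣ x n ∣ ℚ.< B)

  bounded : ∀ x → IsCauchy x → ∃[ B ] (0ℚ ℚ.< B × EventuallyBoundedBy x B)
  bounded x cx with cx 1ℚ (ℚ.positive⁻¹ 1ℚ)
  ... | N , close = B , ℚ.≤-<-trans (ℚ.0≤∣p∣ (x N)) (bound N ℕ.≤-refl) , N , bound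
    where
    open ℚ.≤-Reasoning
    B : ℚ
    B = 1ℚ ℚ.+ ℚ.∣ x N ∣
    bound : ∀ n → N ℕ.≤ n → ℚ.∣ x n ∣ ℚ.< B
    bound n N≤n = begin-strict
      ℚ.∣ x n ∣                            ≡⟨ cong ℚ.∣_∣ (cancel (x n) (x N)) ⟩
      ℚ.∣ (x n ℚ.- x N) ℚ.+ x N ∣          ≤⟨ ℚ.∣p+q∣≤∣p∣+∣q∣ (x n ℚ.- x N) (x N) ⟩
      dist (x n) (x N) ℚ.+ ℚ.∣ x N ∣       <⟨ ℚ.+-mono-<-≤ (close n N N≤n ℕ.≤-refl) ℚ.≤-refl ⟩
      B                                    ∎

  +-cauchy : ∀ x y → IsCauchy x → IsCauchy y → IsCauchy (λ n → x n ℚ.+ y n)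
  +-cauchy x y cx cy ε 0<ε = N₁ ⊔ N₂ , close
    where
    open ℚ.≤-Reasoning
    δ : ℚ
    δ = ½ ℚ.* ε
    0<δ : 0ℚ ℚ.< δ
    0<δ = pos*pos ½ ε (ℚ.positive⁻¹ ½) 0<ε
    N₁ N₂ : ℕ
    N₁ = proj₁ (cx δ 0<δ)
    N₂ = proj₁ (cy δ 0<δ)
    close : ∀ m n → N₁ ⊔ N₂ ℕ.≤ m → N₁ ⊔ N₂ ℕ.≤ n →
            dist (x m ℚ.+ y m) (x n ℚ.+ y n) ℚ.< ε
    close m n N≤m N≤n = begin-strict
      dist (x m ℚ.+ y m) (x n ℚ.+ y n)
        ≡⟨ cong ℚ.∣_∣ (+-rearrange (x m) (y m) (x n) (y n)) ⟩
      ℚ.∣ (x m ℚ.- x n) ℚ.+ (y m ℚ.- y n) ∣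
        ≤⟨ ℚ.∣p+q∣≤∣p∣+∣q∣ (x m ℚ.- x n) (y m ℚ.- y n) ⟩
      dist (x m) (x n) ℚ.+ dist (y m) (y n)
        <⟨ ℚ.+-mono-<
             (proj₂ (cx δ 0<δ) m n (ℕ.m⊔n≤o⇒m≤o N₁ N₂ N≤m) (ℕ.m⊔n≤o⇒m≤o N₁ N₂ N≤n))
             (proj₂ (cy δ 0<δ) m n (ℕ.m⊔n≤o⇒n≤o N₁ N₂ N≤m) (ℕ.m⊔n≤o⇒n≤o N₁ N₂ N≤n)) ⟩
      δ ℚ.+ δ
        ≡⟨ halves ε ⟩
      ε ∎

  *-cauchy : ∀ x y → IsCauchy x → IsCauchy y → IsCauchy (λ n → x n ℚ.* y n)
  *-cauchy x y cx cy ε 0<ε = M ⊔ N , close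
    where
    open ℚ.≤-Reasoning
    B C : ℚ
    B = proj₁ (bounded x cx)
    C = proj₁ (bounded y cy)
    0<B : 0ℚ ℚ.< B
    0<B = proj₁ (proj₂ (bounded x cx))
    0<C : 0ℚ ℚ.< C
    0<C = proj₁ (proj₂ (bounded y cy))
    M₁ M₂ : ℕ
    M₁ = proj₁ (proj₂ (proj₂ (bounded x cx)))
    M₂ = proj₁ (proj₂ (proj₂ (bounded y cy)))
    x<B : ∀ n → M₁ ℕ.≤ n → ℚ.∣ x n ∣ ℚ.< B
    x<B = proj₂ (proj₂ (proj₂ (bounded x cx)))
    y<C : ∀ n → M₂ ℕ.≤ n → ℚ.∣ y n ∣ ℚ.< C
    y<C = proj₂ (proj₂ (proj₂ (bounded y cy)))
    split : ∃[ δ ] (0ℚ ℚ.< δ × (B ℚ.+ C) ℚ.* δ ≡ ε)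
    split = divide (B ℚ.+ C) ε (ℚ.+-mono-< 0<B 0<C) 0<ε
    δ : ℚ
    δ = proj₁ split
    0<δ : 0ℚ ℚ.< δ
    0<δ = proj₁ (proj₂ split)
    total : B ℚ.* δ ℚ.+ C ℚ.* δ ≡ ε
    total = trans (sym (ℚ.*-distribʳ-+ δ B C)) (proj₂ (proj₂ split))
    N₁ N₂ M N : ℕ
    N₁ = proj₁ (cx δ 0<δ)
    N₂ = proj₁ (cy δ 0<δ)
    M = M₁ ⊔ M₂
    N = N₁ ⊔ N₂
    close : ∀ m n → M ⊔ N ℕ.≤ m → M ⊔ N ℕ.≤ n → dist (x m ℚ.* y m) (x n ℚ.* y n) ℚ.< ε
    close m n h k = begin-strict
      dist (x m ℚ.* y m) (x n ℚ.* y n)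
        ≡⟨ cong ℚ.∣_∣ (*-rearrange (x m) (y m) (x n) (y n)) ⟩
      ℚ.∣ x m ℚ.* (y m ℚ.- y n) ℚ.+ y n ℚ.* (x m ℚ.- x n) ∣
        ≤⟨ ℚ.∣p+q∣≤∣p∣+∣q∣ (x m ℚ.* (y m ℚ.- y n)) (y n ℚ.* (x m ℚ.- x n)) ⟩
      ℚ.∣ x m ℚ.* (y m ℚ.- y n) ∣ ℚ.+ ℚ.∣ y n ℚ.* (x m ℚ.- x n) ∣
        <⟨ ℚ.+-mono-<
             (*-bound {x m} {B} {y m ℚ.- y n} {δ}
               (x<B m (ℕ.m⊔n≤o⇒m≤o M₁ M₂ M≤m))
               (proj₂ (cy δ 0<δ) m n (ℕ.m⊔n≤o⇒n≤o N₁ N₂ N≤m) (ℕ.m⊔n≤o⇒n≤o N₁ N₂ N≤n)))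
             (*-bound {y n} {C} {x m ℚ.- x n} {δ}
               (y<C n (ℕ.m⊔n≤o⇒n≤o M₁ M₂ M≤n))
               (proj₂ (cx δ 0<δ) m n (ℕ.m⊔n≤o⇒m≤o N₁ N₂ N≤m) (ℕ.m⊔n≤o⇒m≤o N₁ N₂ N≤n))) ⟩
      B ℚ.* δ ℚ.+ C ℚ.* δ
        ≡⟨ total ⟩
      ε ∎
      where
      M≤m = ℕ.m⊔n≤o⇒m≤o M N h
      M≤n = ℕ.m⊔n≤o⇒m≤o M N k
      N≤m = ℕ.m⊔n≤o⇒n≤o M N h
      N≤n = ℕ.m⊔n≤o⇒n≤o M N k

fromℚ : ℚ → ℝ
fromℚ q = mkℝ (λ _ → q) λ ε 0<ε →
  0 , λ _ _ _ _ → subst (ℚ._< ε) (sym (cong ℚ.∣_∣ (ℚ.+-inverseʳ q))) 0<ε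

0ℝ 1ℝ : ℝ
0ℝ = fromℚ 0ℚ
1ℝ = fromℚ 1ℚ

infixl 6 _+ℝ_
infixl 7 _*ℝ_

_+ℝ_ : ℝ → ℝ → ℝ
x +ℝ y = mkℝ (λ n → seq x n ℚ.+ seq y n) (+-cauchy (seq x) (seq y) (cauchy x) (cauchy y))

_*ℝ_ : ℝ → ℝ → ℝ
x *ℝ y = mkℝ (λ n → seq x n ℚ.* seq y n) (*-cauchy (seq x) (seq y) (cauchy x) (cauchy y))

------------------------------------------------------------------------
-- Eigenvalues of square real matrices

Vectorℝ : ℕ → Set
Vectorℝ n = Vector.Vector ℝ n

Matrix : ℕ → Set
Matrix n = Fin n → Fin n → ℝ

∑ : ∀ {n} → Vectorℝ n → ℝ
∑ = Vector.foldr _+ℝ_ 0ℝ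

IsEigenvalue : ∀ {n} → Matrix n → ℝ → Set
IsEigenvalue {n} A μ = Σ[ v ∈ Vectorℝ n ]
  (¬ (∀ i → v i ≃ 0ℝ)) × (∀ i → ∑ (λ j → A i j *ℝ v j) ≃ μ *ℝ v i)

IsSmallestEigenvalue : ∀ {n} → Matrix n → ℝ → Set
IsSmallestEigenvalue A μ =
  IsEigenvalue A μ × (∀ ν → IsEigenvalue A ν → μ ≤ℝ ν)

------------------------------------------------------------------------
-- Graphs

record Graph : Set₁ where
  field
    order    : ℕ
    _~_      : Rel (Fin order) 0ℓ
    _~?_     : Decidable _~_
    ~-sym    : Symmetric _~_
    ~-irrefl : Irreflexive _≡_ _~_

  Vertex : Set
  Vertex = Fin order

  neighbours : Vertex → Subset order
  neighbours x = tabulate (λ y → does (x ~? y))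

  degree : Vertex → ℕ
  degree x = ∣ neighbours x ∣

  adjacencyMatrix : Matrix order
  adjacencyMatrix x y = if does (x ~? y) then 1ℝ else 0ℝ

  -- Each vertex x of S has at most p - 1 non-neighbours among S ∖ {x}.
  IsPlex : ℕ → Subset order → Set
  IsPlex p S = ∀ x → x ∈ S → ∣ (S - x) ─ neighbours x ∣ ℕ.≤ p ∸ 1

-- The smallest eigenvalue is specified by a relation, not by a function; it is
-- unique up to _≃_, and exists (classically) unless the graph has no vertices,
-- in which case the bound holds vacuously.
λmin[_]≥_ : Graph → ℝ → Set
λmin[ G ]≥ c =
  ∀ μ → IsSmallestEigenvalue (Graph.adjacencyMatrix G) μ → c ≤ℝ μ

infix 4 _≅_

_≅_ : Graph → Graph → Set
G ≅ H = Σ[ φ ∈ (G.Vertex ↔ H.Vertex) ]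
  (∀ x y → (x G.~ y) ⇔ (Inverse.to φ x H.~ Inverse.to φ y))
  where
  module G = Graph G
  module H = Graph H

------------------------------------------------------------------------
-- Hypergraphs

-- The edge set is a duplicate-free list of subsets.
record Hypergraph : Set where
  field
    order    : ℕ
    edges    : List (Subset order)
    distinct : Unique edges
    nonempty : All Nonempty edges

  IsUniform : ℕ → Set
  IsUniform h = All (λ e → ∣ e ∣ ≡ h) edges

  IsLinear : Set
  IsLinear = ∀ x y → x ≢ y →
    ∀ e e′ → e List.∈ edges → e′ List.∈ edges →
    x ∈ e → y ∈ e → x ∈ e′ → y ∈ e′ → e ≡ e′

intersectionGraph : Hypergraph → Graph
intersectionGraph H = record
  { order    = length edges
  ; _~_      = λ i j → edge i ≢ edge j × Nonempty (edge i ∩ edge j)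
  ; _~?_     = λ i j → ¬? (Vec.≡-dec Bool._≟_ (edge i) (edge j))
                       ×-dec nonempty? (edge i ∩ edge j)
  ; ~-sym    = λ {i} {j} (i≢j , ne) →
      i≢j ∘ sym , subst Nonempty (∩-comm (edge i) (edge j)) ne
  ; ~-irrefl = λ i≡j (i≢j , _) → i≢j (cong edge i≡j)
  }
  where
  open Hypergraph H
  edge : Fin (length edges) → Subset order
  edge = lookup edges

{-# OPTIONS --safe #-}

-- Spectral part.  A symmetric matrix over an ordered field is classified by
-- symmetric Gaussian elimination: its form takes a negative value, or it is
-- semidefinite and either singular or coercive.  Over ℚ this is decidable, so
-- bisection on c with the matrices A - c I yields a real number λ for which
-- A - λ I is semidefinite and not coercive, hence (classically) singular: λ is
-- the smallest eigenvalue.  So if every smallest eigenvalue is at least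
-- -(t + 1), then A + (t + 1) I is positive semidefinite, in particular on
-- integer vectors.
--
-- Combinatorial part.  Testing semidefiniteness on combinations of a few
-- vertices and large cliques shows the following for cliques C of a fixed large
-- size L.  Each vertex is adjacent to almost all or to almost none of C; the
-- fat set of C consists of the former vertices, and it is a (t² + 1)-plex.
-- Distinct fat sets come from nearly disjoint cliques with few edges between
-- them, so for the form their characteristic vectors are, up to lower order
-- terms, orthogonal of length L.  Hence a vertex lies in at most t + 1 fat sets.
-- If it lay in at most t, then by the plex hypothesis many of its neighbours
-- would lie outside all of them, and Ramsey's theorem would give a new fat set
-- or a star whose smallest eigenvalue is too small.  So each vertex x lies in
-- exactly t + 1 fat sets with cliques C₁, …, C_{t+1}, and 1_{C₁} + … + 1_{C_{t+1}} - L 1_x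
-- is nearly isotropic; therefore it is nearly orthogonal to every other vertex y,
-- which says that x and y share exactly one fat set if they are adjacent and
-- none otherwise.  The fat sets are the vertices of the hypergraph, and each
-- vertex of G becomes the set of fat sets through it.
module Submission where

-- The sign of a real number is available only up to double negation, so the smallest eigenvalue,
-- too, is obtained only up to double negation. This suffices because semidefiniteness over `ℚ` is
-- stated as a negation; once it is transferred to integer vectors, the rest of the argument is
-- arithmetic in `ℕ`. Each spectral claim about cliques refutes one explicit vector
-- `a X + b Y - c Z`. The coefficients are chosen, usually as multiples of `L`, so that the leading
-- term of the form in `L` is negative or, for the nearly isotropic vectors, cancels up to order
-- `L`. The error terms involve only `t`, `m` and `κ`, which dictates the order of choice: `m` makes
-- the dichotomy near/far work, `κ` comes from the overlap of distinct cliques, and `L` exceeds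
-- every error term; the Ramsey number for `L` then determines `K`. The plex parameter arises in the
-- same way: a vertex of a fat set with s non-neighbours in it yields the leading coefficient t (t²
-- - s), which is negative from s = t² + 1 on.

-- Ordered fields whose signs are known under a modality.

module OrderedFields where

  open import Algebra.Bundles using (CommutativeRing)
  open import Algebra.Solver.Ring.AlmostCommutativeRing using (fromCommutativeRing; _-Raw-AlmostCommutative⟶_)
  import Algebra.Solver.Ring as RingSolver
  open import Data.Empty using (⊥)
  open import Data.Maybe.Base using (nothing; just; Maybe)
  open import Data.Product.Base using (∃-syntax)
  open import Data.Rational.Base as ℚ using (ℚ; 0ℚ; 1ℚ)
  import Data.Rational.Properties as ℚ
  open import Data.Sum.Base using (_⊎_; inj₁; inj₂)
  open import Level using (0ℓ)
  open import Relation.Binary.PropositionalEquality as ≡ using (_≡_)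
  open import Relation.Nullary.Decidable using (yes; no)
  open import Relation.Nullary.Negation using (¬_)

  -- The sign of an element is only known under the modality T: the identity
  -- for ℚ, double negation for ℝ.
  record OrderedField : Set₁ where
    field
      commutativeRing : CommutativeRing 0ℓ 0ℓ
    open CommutativeRing commutativeRing public
    field
      ι        : ℚ → Carrier
      ι-+      : ∀ p q → ι (p ℚ.+ q) ≈ ι p + ι q
      ι-*      : ∀ p q → ι (p ℚ.* q) ≈ ι p * ι q
      ι-neg    : ∀ p → ι (ℚ.- p) ≈ - ι p
      ι-0      : ι 0ℚ ≈ 0#
      ι-1      : ι 1ℚ ≈ 1#
      Pos      : Carrier → Set
      Pos-resp : ∀ {x y} → x ≈ y → Pos x → Pos y
      Pos-+    : ∀ {x y} → Pos x → Pos y → Pos (x + y)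
      Pos-*    : ∀ {x y} → Pos x → Pos y → Pos (x * y)
      Pos-ι    : ∀ {q} → 0ℚ ℚ.< q → Pos (ι q)
      ¬Pos-0   : ¬ Pos 0#
      inverse  : ∀ {x} → Pos x → ∃[ y ] x * y ≈ 1#
      T        : Set → Set
      pure     : ∀ {A} → A → T A
      _>>=_    : ∀ {A B} → T A → (A → T B) → T B
      run      : T ⊥ → ⊥
      sign     : ∀ x → T (Pos x ⊎ x ≈ 0# ⊎ Pos (- x))

  module OrderedFieldProperties (F : OrderedField) where
    open OrderedField F

    private
      rationalCoefficients : CommutativeRing.rawRing ℚ.+-*-commutativeRing -Raw-AlmostCommutative⟶ fromCommutativeRing commutativeRing
      rationalCoefficients = record
        { ⟦_⟧ = ι ; +-homo = ι-+ ; *-homo = ι-* ; -‿homo = ι-neg ; 0-homo = ι-0 ; 1-homo = ι-1 }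

      ι-≟ : ∀ p q → Maybe (ι p ≈ ι q)
      ι-≟ p q with p ℚ.≟ q
      ... | yes ≡.refl = just refl
      ... | no  _    = nothing

    module Solver = RingSolver _ (fromCommutativeRing commutativeRing) rationalCoefficients ι-≟
    open Solver

    -- Being a negation, this can be proved by cases on `sign` inside `T` and extracted with `run`,
    -- over `ℝ` as well as over `ℚ`.
    NonNeg : Carrier → Set
    NonNeg x = ¬ Pos (- x)

    NonNeg-resp : ∀ {x y} → x ≈ y → NonNeg x → NonNeg y
    NonNeg-resp x≈y x≥0 y<0 = x≥0 (Pos-resp (-‿cong (sym x≈y)) y<0)

    ¬Pos-neg : ∀ {x} → Pos x → NonNeg x
    ¬Pos-neg {x} x>0 x<0 = ¬Pos-0 (Pos-resp (-‿inverseʳ x) (Pos-+ x>0 x<0))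

    Pos-neg² : ∀ {x} → Pos (- x) → Pos (x * x)
    Pos-neg² {x} x<0 = Pos-resp (solve 1 (λ x → :- x :* :- x := x :* x) refl x) (Pos-* x<0 x<0)

    NonNeg-² : ∀ x → NonNeg (x * x)
    NonNeg-² x x²<0 = run (sign x >>= λ
      { (inj₁ x>0)        → pure (¬Pos-neg (Pos-* x>0 x>0) x²<0)
      ; (inj₂ (inj₁ x≈0)) → pure (¬Pos-0 (Pos-resp (trans (-‿cong (trans (*-congʳ x≈0) (zeroˡ x))) -0≈0) x²<0))
      ; (inj₂ (inj₂ x<0)) → pure (¬Pos-neg (Pos-neg² x<0) x²<0) })
      where
      -0≈0 : - 0# ≈ 0#
      -0≈0 = trans (sym (+-identityˡ (- 0#))) (-‿inverseʳ 0#)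

    NonNeg-0 : NonNeg 0#
    NonNeg-0 = NonNeg-resp (zeroˡ 0#) (NonNeg-² 0#)

    Pos+NonNeg : ∀ {x y} → Pos x → NonNeg y → NonNeg (x + y)
    Pos+NonNeg {x} {y} x>0 y≥0 s<0 =
      y≥0 (Pos-resp (solve 2 (λ x y → x :+ :- (x :+ y) := :- y) refl x y) (Pos-+ x>0 s<0))

    NonNeg-+ : ∀ {x y} → NonNeg x → NonNeg y → NonNeg (x + y)
    NonNeg-+ {x} {y} x≥0 y≥0 s<0 = run (sign x >>= λ
      { (inj₁ x>0)        → pure (Pos+NonNeg x>0 y≥0 s<0)
      ; (inj₂ (inj₁ x≈0)) → pure (y≥0 (Pos-resp (-‿cong (trans (+-congʳ x≈0) (+-identityˡ y))) s<0))
      ; (inj₂ (inj₂ x<0)) → pure (x≥0 x<0) })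

    Pos*NonNeg : ∀ {x y} → Pos x → NonNeg y → NonNeg (x * y)
    Pos*NonNeg {x} {y} x>0 y≥0 xy<0 = run (sign y >>= λ
      { (inj₁ y>0)        → pure (¬Pos-neg (Pos-* x>0 y>0) xy<0)
      ; (inj₂ (inj₁ y≈0)) → pure (NonNeg-² 0# (Pos-resp (-‿cong (trans (*-congˡ y≈0) (trans (zeroʳ x) (sym (zeroʳ 0#))))) xy<0))
      ; (inj₂ (inj₂ y<0)) → pure (y≥0 y<0) })

    inverse-NonNeg : ∀ {x y} → Pos x → x * y ≈ 1# → NonNeg y
    inverse-NonNeg {x} {y} x>0 xy≈1 y<0 = ¬Pos-0 (Pos-resp (-‿inverseʳ (ι 1ℚ)) (Pos-+ (Pos-ι (ℚ.positive⁻¹ 1ℚ))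
      (Pos-resp (trans (solve 2 (λ x y → x :* (:- y) := :- (x :* y)) refl x y) (-‿cong (trans xy≈1 (sym ι-1)))) (Pos-* x>0 y<0))))

    NonNeg-* : ∀ {x y} → NonNeg x → NonNeg y → NonNeg (x * y)
    NonNeg-* {x} {y} x≥0 y≥0 xy<0 = run (sign x >>= λ
      { (inj₁ x>0)        → pure (Pos*NonNeg x>0 y≥0 xy<0)
      ; (inj₂ (inj₁ x≈0)) → pure (NonNeg-² 0# (Pos-resp (-‿cong (trans (*-congʳ x≈0) (trans (zeroˡ y) (sym (zeroˡ 0#))))) xy<0))
      ; (inj₂ (inj₂ x<0)) → pure (x≥0 x<0) })

-- Classification of quadratic forms by symmetric elimination.

module GaussianElimination where

  open OrderedFields
  open import Data.Empty using (⊥-elim)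
  open import Data.Fin.Base using (Fin; zero; suc)
  open import Data.Nat.Base using (zero; suc)
  open import Data.Product.Base using (∃-syntax; _×_; _,_)
  open import Data.Rational.Base as ℚ using (1ℚ; ½)
  import Data.Rational.Properties as ℚ
  open import Data.Sum.Base using (_⊎_; inj₁; inj₂)
  open import Data.Vec.Functional using (Vector; _∷_; head; tail)
  open import Function.Base using (_∘_)

  module QuadraticForms (F : OrderedField) where
    open OrderedField F hiding (zero)
    open OrderedFieldProperties F
    open Solver using (solve; _:=_; _:+_; _:*_; _:-_; :-_; con)
    open import Algebra.Properties.Semiring.Sum semiring public
      using (sum; sum-cong-≋; ∑-distrib-+; *-distribˡ-sum; *-distribʳ-sum; sum-replicate-zero)

    infixr 7 _·_ _·ᴹ_

    _·_ : ∀ {n} → Vector Carrier n → Vector Carrier n → Carrier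
    u · v = sum λ i → u i * v i

    _·ᴹ_ : ∀ {m n} → (Fin m → Vector Carrier n) → Vector Carrier n → Vector Carrier m
    (M ·ᴹ v) i = M i · v

    form : ∀ {n} → (Fin n → Vector Carrier n) → Vector Carrier n → Carrier
    form M v = v · (M ·ᴹ v)

    ·-cong : ∀ {n} {u u′ v v′ : Vector Carrier n} → (∀ i → u i ≈ u′ i) → (∀ i → v i ≈ v′ i) → u · v ≈ u′ · v′
    ·-cong u≈ v≈ = sum-cong-≋ λ i → *-cong (u≈ i) (v≈ i)

    ·-comm : ∀ {n} (u v : Vector Carrier n) → u · v ≈ v · u
    ·-comm u v = sum-cong-≋ λ i → *-comm (u i) (v i)

    ·-distribˡ : ∀ {n} (u v w : Vector Carrier n) → u · (λ i → v i + w i) ≈ u · v + u · w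
    ·-distribˡ u v w = trans (sum-cong-≋ λ i → distribˡ (u i) (v i) (w i)) (∑-distrib-+ (λ i → u i * v i) (λ i → u i * w i))

    ·-scaleʳ : ∀ {n} c (u v : Vector Carrier n) → u · (λ i → c * v i) ≈ c * (u · v)
    ·-scaleʳ c u v = trans (sum-cong-≋ λ i → solve 3 (λ c x y → x :* (c :* y) := c :* (x :* y)) refl c (u i) (v i))
                           (sym (*-distribˡ-sum c (λ i → u i * v i)))

    ·-zeroˡ : ∀ {n} {u : Vector Carrier n} v → (∀ i → u i ≈ 0#) → u · v ≈ 0#
    ·-zeroˡ {n} v u≈0 = trans (sum-cong-≋ λ i → trans (*-congʳ (u≈0 i)) (zeroˡ (v i))) (sum-replicate-zero n)

    ·-zeroʳ : ∀ {n} (u : Vector Carrier n) {v} → (∀ i → v i ≈ 0#) → u · v ≈ 0#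
    ·-zeroʳ u {v} v≈0 = trans (·-comm u v) (·-zeroˡ u v≈0)

    zero-or-pos : ∀ {n} (v : Vector Carrier n) → T ((∀ i → v i ≈ 0#) ⊎ Pos (v · v))
    zero-or-pos {zero} v = pure (inj₁ λ ())
    zero-or-pos {suc n} v = zero-or-pos (tail v) >>= λ
      { (inj₁ z) → sign (head v) >>= λ
        { (inj₁ p)        → pure (inj₂ (alone z (Pos-* p p)))
        ; (inj₂ (inj₁ e)) → pure (inj₁ λ { zero → e ; (suc i) → z i })
        ; (inj₂ (inj₂ p)) → pure (inj₂ (alone z (Pos-neg² p))) }
      ; (inj₂ q) → sign (head v) >>= λ
        { (inj₁ p)        → pure (inj₂ (Pos-+ (Pos-* p p) q))
        ; (inj₂ (inj₁ e)) → pure (inj₂ (Pos-resp (sym (trans (+-congʳ (trans (*-congʳ e) (zeroˡ _))) (+-identityˡ _))) q))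
        ; (inj₂ (inj₂ p)) → pure (inj₂ (Pos-+ (Pos-neg² p) q)) } }
      where
      alone : (∀ i → tail v i ≈ 0#) → Pos (head v * head v) → Pos (v · v)
      alone z = Pos-resp (sym (trans (+-congˡ (·-zeroˡ (tail v) z)) (+-identityʳ _)))

    -- `Coercive` is positive definiteness with explicit constants, one for each linear functional
    -- `l`. Stated for functionals rather than for the norm, it passes through an elimination step,
    -- which turns a functional on the whole space into one on the tail plus a multiple of the
    -- pivot.
    Negative PSD Singular Coercive : ∀ {n} → (Fin n → Vector Carrier n) → Set
    Negative M = ∃[ v ] Pos (- form M v)
    PSD M      = ∀ v → NonNeg (form M v)
    Singular M = ∃[ v ] (Pos (v · v) × (∀ i → (M ·ᴹ v) i ≈ 0#))
    Coercive M = ∀ l → ∃[ K ] (NonNeg K × (∀ v → NonNeg (K * form M v - (l · v) * (l · v))))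

    Classification : ∀ {n} → (Fin n → Vector Carrier n) → Set
    Classification M = Negative M ⊎ PSD M × (Singular M ⊎ Coercive M)

    Symmetric : ∀ {n} → (Fin n → Vector Carrier n) → Set
    Symmetric M = ∀ i j → M i j ≈ M j i

    module Block {n} (M : Fin (suc n) → Vector Carrier (suc n)) (M-sym : Symmetric M) where
      a : Carrier
      a = M zero zero

      b : Vector Carrier n
      b i = M zero (suc i)

      D : Fin n → Vector Carrier n
      D i j = M (suc i) (suc j)

      lower : ∀ x y i → (M ·ᴹ (x ∷ y)) (suc i) ≈ x * b i + (D ·ᴹ y) i
      lower x y i = +-congʳ (trans (*-congʳ (M-sym (suc i) zero)) (*-comm (b i) x))

      expand : ∀ x y → form M (x ∷ y) ≈ x * (a * x + b · y) + (x * (b · y) + form D y)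
      expand x y = +-congˡ (begin
        y · (λ i → (M ·ᴹ (x ∷ y)) (suc i))      ≈⟨ ·-cong (λ _ → refl) (lower x y) ⟩
        y · (λ i → x * b i + (D ·ᴹ y) i)         ≈⟨ ·-distribˡ y (λ i → x * b i) (D ·ᴹ y) ⟩
        y · (λ i → x * b i) + form D y           ≈⟨ +-congʳ (·-scaleʳ x y b) ⟩
        x * (y · b) + form D y                   ≈⟨ +-congʳ (*-congˡ (·-comm y b)) ⟩
        x * (b · y) + form D y                   ∎)
        where open import Relation.Binary.Reasoning.Setoid setoid

      module Schur {w} (aw≈1 : a * w ≈ 1#) where
        open import Relation.Binary.Reasoning.Setoid setoid

        S : Fin n → Vector Carrier n
        S i j = D i j + (- (w * b i)) * b j

        S-sym : Symmetric S
        S-sym i j = +-cong (M-sym (suc i) (suc j))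
          (solve 3 (λ w x y → :- (w :* x) :* y := :- (w :* y) :* x) refl w (b i) (b j))

        S-mul : ∀ y i → (S ·ᴹ y) i ≈ (- (w * (b · y))) * b i + (D ·ᴹ y) i
        S-mul y i = begin
          (S ·ᴹ y) i                                          ≈⟨ ·-comm (S i) y ⟩
          y · S i                                             ≈⟨ ·-distribˡ y (D i) (λ j → (- (w * b i)) * b j) ⟩
          y · D i + y · (λ j → (- (w * b i)) * b j)           ≈⟨ +-cong (·-comm y (D i)) (·-scaleʳ (- (w * b i)) y b) ⟩
          D i · y + (- (w * b i)) * (y · b)                   ≈⟨ +-congˡ (*-congˡ (·-comm y b)) ⟩
          D i · y + (- (w * b i)) * (b · y)                   ≈⟨ solve 4 (λ d w x s → d :+ (:- (w :* x)) :* s := (:- (w :* s)) :* x :+ d) refl (D i · y) w (b i) (b · y) ⟩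
          (- (w * (b · y))) * b i + (D ·ᴹ y) i                ∎

        S-form : ∀ y → form S y ≈ (- (w * (b · y))) * (b · y) + form D y
        S-form y = begin
          form S y                                            ≈⟨ ·-cong (λ _ → refl) (S-mul y) ⟩
          y · (λ i → (- (w * (b · y))) * b i + (D ·ᴹ y) i)    ≈⟨ ·-distribˡ y _ (D ·ᴹ y) ⟩
          y · (λ i → (- (w * (b · y))) * b i) + form D y      ≈⟨ +-congʳ (trans (·-scaleʳ _ y b) (*-congˡ (·-comm y b))) ⟩
          (- (w * (b · y))) * (b · y) + form D y              ∎

        pivot : Carrier → Vector Carrier n → Carrier
        pivot x y = x + w * (b · y)

        complete-square : ∀ x y → form M (x ∷ y) ≈ a * (pivot x y * pivot x y) + form S y
        complete-square x y = begin
          form M (x ∷ y)                                        ≈⟨ expand x y ⟩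
          -- The ring solver cannot use `a * w ≈ 1#`; it proves the identity up to a multiple of 1 -
          -- a w, which vanishes afterwards. The same device recurs in the other solver calls that
          -- involve an inverse.
          x * (a * x + s) + (x * s + d)                         ≈⟨ solve 5 (λ a w x s d →
               x :* (a :* x :+ s) :+ (x :* s :+ d)
            := a :* ((x :+ w :* s) :* (x :+ w :* s)) :+ ((:- (w :* s)) :* s :+ d)
               :+ (con 1ℚ :- a :* w) :* (x :* s :+ x :* s :+ w :* s :* s)) refl a w x s d ⟩
          a * (pivot x y * pivot x y) + ((- (w * s)) * s + d)
            + (ι 1ℚ - a * w) * (x * s + x * s + w * s * s)      ≈⟨ +-cong (+-congˡ (sym (S-form y))) (trans (*-congʳ vanish) (zeroˡ _)) ⟩
          a * (pivot x y * pivot x y) + form S y + 0#           ≈⟨ +-identityʳ _ ⟩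
          a * (pivot x y * pivot x y) + form S y                ∎
          where
          s = b · y
          d = form D y
          vanish : ι 1ℚ - a * w ≈ 0#
          vanish = trans (+-cong ι-1 (-‿cong aw≈1)) (-‿inverseʳ 1#)

        -- The vector whose pivot vanishes.
        lift : Vector Carrier n → Vector Carrier (suc n)
        lift y = (- (w * (b · y))) ∷ y

        lift-form : ∀ y → form M (lift y) ≈ form S y
        lift-form y = begin
          form M (lift y)                                       ≈⟨ complete-square _ y ⟩
          a * (p * p) + form S y                                ≈⟨ +-congʳ (*-congˡ (trans (*-congʳ (-‿inverseˡ _)) (zeroˡ p))) ⟩
          a * 0# + form S y                                     ≈⟨ trans (+-congʳ (zeroʳ a)) (+-identityˡ _) ⟩
          form S y                                              ∎
          where p = pivot (- (w * (b · y))) y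

        lift-kernel : ∀ y → (∀ i → (S ·ᴹ y) i ≈ 0#) → ∀ i → (M ·ᴹ lift y) i ≈ 0#
        lift-kernel y Sy≈0 zero = begin
          a * (- (w * s)) + s       ≈⟨ solve 3 (λ a w s → a :* (:- (w :* s)) :+ s := (:- (a :* w)) :* s :+ s) refl a w s ⟩
          (- (a * w)) * s + s       ≈⟨ +-congʳ (*-congʳ (-‿cong aw≈1)) ⟩
          (- 1#) * s + s            ≈⟨ +-congˡ (sym (*-identityˡ s)) ⟩
          (- 1#) * s + 1# * s       ≈⟨ sym (distribʳ s (- 1#) 1#) ⟩
          (- 1# + 1#) * s           ≈⟨ *-congʳ (-‿inverseˡ 1#) ⟩
          0# * s                    ≈⟨ zeroˡ s ⟩
          0#                        ∎
          where s = b · y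
        lift-kernel y Sy≈0 (suc i) = trans (lower _ y i) (trans (sym (S-mul y i)) (Sy≈0 i))

        lift-psd : Pos a → PSD S → PSD M
        lift-psd a>0 S≥0 v = NonNeg-resp (sym (complete-square (head v) (tail v)))
          (NonNeg-+ (Pos*NonNeg a>0 (NonNeg-² _)) (S≥0 (tail v)))

        -- In the variables `z` (the pivot) and `y`, the functional `l` becomes l₀ z + r, where r is
        -- a functional of y bounded by K. The estimate (l₀ z + r)² ≤ 2 l₀² z² + 2 r², with z² = w
        -- (a z²), gives the constant 2 l₀² w + 2 K.
        lift-coercive : Pos a → PSD S → Coercive S → Coercive M
        lift-coercive a>0 S≥0 coercive l with coercive (λ i → tail l i + (- (head l * w)) * b i)
        ... | K , K≥0 , bound = K′ , K′≥0 , λ v →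
          let x = head v ; y = tail v ; z = pivot x y ; s = b · y ; f = form S y
              r = (λ i → tail l i + (- (l₀ * w)) * b i) · y
              l·v : l · v ≈ l₀ * z + r
              l·v = begin
                l₀ * x + tail l · y
                  ≈⟨ solve 5 (λ l x t w s → l :* x :+ t := l :* (x :+ w :* s) :+ (t :+ (:- (l :* w)) :* s)) refl l₀ x (tail l · y) w s ⟩
                l₀ * z + (tail l · y + (- (l₀ * w)) * s)
                  ≈⟨ +-congˡ (+-cong (·-comm (tail l) y) (trans (*-congˡ (·-comm b y)) (sym (·-scaleʳ _ y b)))) ⟩
                l₀ * z + (y · tail l + y · (λ i → (- (l₀ * w)) * b i))
                  ≈⟨ +-congˡ (trans (sym (·-distribˡ y (tail l) _)) (·-comm y _)) ⟩
                l₀ * z + r ∎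
          in NonNeg-resp (sym (begin
            K′ * form M v - (l · v) * (l · v)
              ≈⟨ +-cong (*-congˡ (complete-square x y)) (-‿cong (*-cong l·v l·v)) ⟩
            K′ * (a * (z * z) + f) - (l₀ * z + r) * (l₀ * z + r)
              ≈⟨ solve 7 (λ K a w l z r f →
                   let K′ = l :* l :* w :+ l :* l :* w :+ (K :+ K) in
                      K′ :* (a :* (z :* z) :+ f) :- (l :* z :+ r) :* (l :* z :+ r)
                   := ((K :+ K) :* (a :* (z :* z)) :+ ((l :* l :* w :+ l :* l :* w) :* f :+ ((K :* f :- r :* r) :+ (K :* f :- r :* r) :+ (l :* z :- r) :* (l :* z :- r))))
                      :+ (a :* w :- con 1ℚ) :* (l :* l :* (z :* z) :+ l :* l :* (z :* z))) refl K a w l₀ z r f ⟩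
            ((K + K) * (a * (z * z)) + ((l₀ * l₀ * w + l₀ * l₀ * w) * f + ((K * f - r * r) + (K * f - r * r) + (l₀ * z - r) * (l₀ * z - r))))
              + (a * w - ι 1ℚ) * (l₀ * l₀ * (z * z) + l₀ * l₀ * (z * z))
              ≈⟨ trans (+-congˡ (trans (*-congʳ (trans (+-cong aw≈1 (-‿cong ι-1)) (-‿inverseʳ 1#))) (zeroˡ _))) (+-identityʳ _) ⟩
            (K + K) * (a * (z * z)) + ((l₀ * l₀ * w + l₀ * l₀ * w) * f + ((K * f - r * r) + (K * f - r * r) + (l₀ * z - r) * (l₀ * z - r))) ∎))
            (NonNeg-+ (NonNeg-* (NonNeg-+ K≥0 K≥0) (Pos*NonNeg a>0 (NonNeg-² z)))
            (NonNeg-+ (NonNeg-* llw≥0 (S≥0 y))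
            (NonNeg-+ (NonNeg-+ (bound y) (bound y)) (NonNeg-² (l₀ * z - r)))))
          where
          l₀ K′ : Carrier
          l₀ = head l
          K′ = l₀ * l₀ * w + l₀ * l₀ * w + (K + K)
          llw≥0 : NonNeg (l₀ * l₀ * w + l₀ * l₀ * w)
          llw≥0 = NonNeg-+ l²w≥0 l²w≥0
            where
            l²w≥0 : NonNeg (l₀ * l₀ * w)
            l²w≥0 = NonNeg-* (NonNeg-² l₀) (inverse-NonNeg a>0 aw≈1)
          K′≥0 : NonNeg K′
          K′≥0 = NonNeg-+ llw≥0 (NonNeg-+ K≥0 K≥0)

      unit : Vector Carrier (suc n)
      unit = 1# ∷ λ _ → 0#

      unit-form : form M unit ≈ a
      unit-form = begin
        form M unit                                         ≈⟨ expand 1# (λ _ → 0#) ⟩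
        1# * (a * 1# + b · 0⃗) + (1# * (b · 0⃗) + form D 0⃗)   ≈⟨ +-cong (trans (*-identityˡ _) (+-cong (*-identityʳ a) b·0)) (+-cong (trans (*-identityˡ _) b·0) (·-zeroˡ {u = 0⃗} (D ·ᴹ 0⃗) λ _ → refl)) ⟩
        a + 0# + (0# + 0#)                                  ≈⟨ +-cong (+-identityʳ a) (+-identityʳ 0#) ⟩
        a + 0#                                              ≈⟨ +-identityʳ a ⟩
        a                                                   ∎
        where
        open import Relation.Binary.Reasoning.Setoid setoid
        0⃗ : Vector Carrier n
        0⃗ _ = 0#
        b·0 : b · 0⃗ ≈ 0#
        b·0 = ·-zeroʳ b λ _ → refl

      module ZeroPivot (a≈0 : a ≈ 0#) where
        open import Relation.Binary.Reasoning.Setoid setoid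

        expand₀ : ∀ x y → form M (x ∷ y) ≈ x * (b · y) + x * (b · y) + form D y
        expand₀ x y = begin
          form M (x ∷ y)                                        ≈⟨ expand x y ⟩
          x * (a * x + b · y) + (x * (b · y) + form D y)        ≈⟨ +-congʳ (*-congˡ (trans (+-congʳ (trans (*-congʳ a≈0) (zeroˡ x))) (+-identityˡ _))) ⟩
          x * (b · y) + (x * (b · y) + form D y)                ≈⟨ sym (+-assoc _ _ _) ⟩
          x * (b · y) + x * (b · y) + form D y                  ∎

        -- Without the square of `x`, the form at `x ∷ b` is 2 x (b · b) + d, which is affine in
        -- `x`; the chosen `x` makes it equal to -1.
        negative : Pos (b · b) → Negative M
        negative b²>0 with inverse b²>0
        ... | u , b²u≈1 = (x ∷ b) , Pos-resp (-‿cong (sym value)) (Pos-resp (solve 0 (con 1ℚ := :- (:- con 1ℚ)) refl) (Pos-ι (ℚ.positive⁻¹ 1ℚ)))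
          where
          d x : Carrier
          d = form D b
          x = (- (ι ½ * (d + ι 1ℚ))) * u
          value : form M (x ∷ b) ≈ - ι 1ℚ
          value = begin
            form M (x ∷ b)                          ≈⟨ expand₀ x b ⟩
            x * (b · b) + x * (b · b) + d           ≈⟨ solve 3 (λ s u d → let x = (:- (con ½ :* (d :+ con 1ℚ))) :* u in
                                                          x :* s :+ x :* s :+ d := (con 1ℚ :- s :* u) :* (d :+ con 1ℚ) :- con 1ℚ) refl (b · b) u d ⟩
            (ι 1ℚ - (b · b) * u) * (d + ι 1ℚ) - ι 1ℚ  ≈⟨ +-congʳ (trans (*-congʳ (trans (+-cong ι-1 (-‿cong b²u≈1)) (-‿inverseʳ 1#))) (zeroˡ _)) ⟩
            0# - ι 1ℚ                               ≈⟨ +-identityˡ _ ⟩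
            - ι 1ℚ                                  ∎

        module _ (b≈0 : ∀ i → b i ≈ 0#) where
          form≈ : ∀ x y → form M (x ∷ y) ≈ form D y
          form≈ x y = begin
            form M (x ∷ y)                          ≈⟨ expand₀ x y ⟩
            x * (b · y) + x * (b · y) + form D y    ≈⟨ +-congʳ (+-cong xb·y xb·y) ⟩
            0# + 0# + form D y                      ≈⟨ trans (+-congʳ (+-identityˡ 0#)) (+-identityˡ _) ⟩
            form D y                                ∎
            where
            xb·y : x * (b · y) ≈ 0#
            xb·y = trans (*-congˡ (·-zeroˡ y b≈0)) (zeroʳ x)

          singular : Singular M
          singular = unit , Pos-resp (sym unit²) (Pos-ι (ℚ.positive⁻¹ 1ℚ)) , kernel
            where
            unit² : unit · unit ≈ ι 1ℚ
            unit² = trans (+-cong (*-identityˡ 1#) (·-zeroˡ {n} (λ _ → 0#) (λ _ → refl))) (trans (+-identityʳ 1#) (sym ι-1))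
            column : ∀ i → M i zero ≈ 0#
            column zero    = a≈0
            column (suc i) = trans (M-sym (suc i) zero) (b≈0 i)
            kernel : ∀ i → (M ·ᴹ unit) i ≈ 0#
            kernel i = trans (+-cong (trans (*-identityʳ _) (column i)) (·-zeroʳ (tail (M i)) λ _ → refl)) (+-identityʳ 0#)

    classify : ∀ {n} (M : Fin n → Vector Carrier n) → Symmetric M → T (Classification M)
    classify {zero}  M M-sym = pure (inj₂ ((λ _ → NonNeg-0) , inj₂ λ l → 0# , NonNeg-0 ,
      λ v → NonNeg-resp (sym (-‿inverseʳ (0# * 0#))) NonNeg-0))
    classify {suc n} M M-sym = sign a >>= λ
      { (inj₁ a>0)        → positive a>0 (inverse a>0)
      ; (inj₂ (inj₁ a≈0)) → zero-or-pos b >>= λ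
          { (inj₁ b≈0) → classify D (λ i j → M-sym (suc i) (suc j)) >>= λ
              { (inj₁ (y , neg))  → pure (inj₁ ((0# ∷ y) , Pos-resp (-‿cong (sym (ZeroPivot.form≈ a≈0 b≈0 0# y))) neg))
              -- A zero first row puts `unit` in the kernel, so both alternatives for `D` lead to
              -- the singular case.
              ; (inj₂ (psd , _)) → pure (inj₂ ((λ v → NonNeg-resp (sym (ZeroPivot.form≈ a≈0 b≈0 (head v) (tail v))) (psd (tail v))) , inj₁ (ZeroPivot.singular a≈0 b≈0))) }
          ; (inj₂ b²>0) → pure (inj₁ (ZeroPivot.negative a≈0 b²>0)) }
      ; (inj₂ (inj₂ a<0)) → pure (inj₁ (unit , Pos-resp (-‿cong (sym unit-form)) a<0)) }
      where
      open Block M M-sym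
      positive : Pos a → ∃[ w ] a * w ≈ 1# → T (Classification M)
      positive a>0 (w , aw≈1) = classify S S-sym >>= λ
        { (inj₁ (y , neg)) → pure (inj₁ (lift y , Pos-resp (-‿cong (sym (lift-form y))) neg))
        ; (inj₂ (psd , inj₁ (y , y²>0 , Sy≈0))) → zero-or-pos (lift y) >>= λ
            { (inj₁ z) → pure (inj₂ (lift-psd a>0 psd , inj₁ (lift y , absurd z y²>0 , lift-kernel y Sy≈0)))
            ; (inj₂ p) → pure (inj₂ (lift-psd a>0 psd , inj₁ (lift y , p , lift-kernel y Sy≈0))) }
        ; (inj₂ (psd , inj₂ coercive)) → pure (inj₂ (lift-psd a>0 psd , inj₂ (lift-coercive a>0 psd coercive))) }
        where
        open Schur aw≈1
        absurd : ∀ {y} → (∀ i → lift y i ≈ 0#) → Pos (y · y) → Pos (lift y · lift y)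
        absurd {y} z p = ⊥-elim (¬Pos-0 (Pos-resp (·-zeroˡ y (z ∘ suc)) p))

-- The Cauchy reals as an ordered field.

module RealField where

  open OrderedFields
  open import Defs
  open import Algebra.Structures using (IsCommutativeRing)
  open import Data.Empty using (⊥-elim)
  open import Data.Nat.Base as ℕ using (ℕ; _⊔_)
  import Data.Nat.Properties as ℕ
  open import Data.Product.Base using (∃-syntax; _×_; _,_; proj₁; proj₂)
  open import Data.Rational.Base as ℚ using (ℚ; 0ℚ; 1ℚ; ½)
  import Data.Rational.Properties as ℚ
  open import Data.Rational.Solver using (module +-*-Solver)
  open import Data.Sum.Base using (_⊎_; inj₁; inj₂)
  open import Function.Base using (id)
  open import Relation.Binary.Definitions using (tri<; tri≈; tri>)
  open import Relation.Binary.PropositionalEquality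
  open import Relation.Nullary.Decidable using (yes; no)
  open import Relation.Nullary.Negation using (¬_)

  open +-*-Solver using (solve; _:=_; _:+_; _:*_; _:-_; :-_; con)

  0<½ : 0ℚ ℚ.< ½
  0<½ = ℚ.positive⁻¹ ½

  0<1 : 0ℚ ℚ.< 1ℚ
  0<1 = ℚ.positive⁻¹ 1ℚ

  pos+pos : ∀ {p q} → 0ℚ ℚ.< p → 0ℚ ℚ.< q → 0ℚ ℚ.< p ℚ.+ q
  pos+pos = ℚ.+-mono-<

  pos*pos : ∀ {p q} → 0ℚ ℚ.< p → 0ℚ ℚ.< q → 0ℚ ℚ.< p ℚ.* q
  pos*pos {p} {q} 0<p 0<q = ℚ.positive⁻¹ (p ℚ.* q) {{ℚ.pos*pos⇒pos p {{ℚ.positive 0<p}} q {{ℚ.positive 0<q}}}}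

  half-pos : ∀ {p} → 0ℚ ℚ.< p → 0ℚ ℚ.< ½ ℚ.* p
  half-pos = pos*pos 0<½

  <⇒0< : ∀ {p q} → p ℚ.< q → 0ℚ ℚ.< q ℚ.- p
  <⇒0< {p} {q} p<q = subst (ℚ._< q ℚ.- p) (ℚ.+-inverseʳ p) (ℚ.+-monoˡ-< (ℚ.- p) p<q)

  0<⇒< : ∀ {p q d} → 0ℚ ℚ.< d → d ≡ q ℚ.- p → p ℚ.< q
  0<⇒< {p} {q} 0<d refl = subst₂ ℚ._<_ (ℚ.+-identityʳ p) (solve 2 (λ p q → p :+ (q :- p) := q) refl p q) (ℚ.+-monoʳ-< p 0<d)

  <-combine : ∀ {a b c d p q} → a ℚ.< b → c ℚ.< d → (b ℚ.- a) ℚ.+ (d ℚ.- c) ≡ q ℚ.- p → p ℚ.< q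
  <-combine a<b c<d = 0<⇒< (pos+pos (<⇒0< a<b) (<⇒0< c<d))

  pos-inverse : ∀ {p} → 0ℚ ℚ.< p → ∃[ q ] (0ℚ ℚ.< q × p ℚ.* q ≡ 1ℚ)
  pos-inverse {p} 0<p = q , ℚ.positive⁻¹ q {{ℚ.1/pos⇒pos p {{ℚ.positive 0<p}}}} , ℚ.*-inverseʳ p {{p≢0}}
    where
    p≢0 : ℚ.NonZero p
    p≢0 = ℚ.pos⇒nonZero p {{ℚ.positive 0<p}}
    q : ℚ
    q = (ℚ.1/ p) {{p≢0}}

  <⇒≱ : ∀ {p q} → p ℚ.< q → ¬ q ℚ.≤ p
  <⇒≱ p<q q≤p = ℚ.<-irrefl refl (ℚ.<-≤-trans p<q q≤p)

  neg-pos : ∀ {p} → p ℚ.< 0ℚ → 0ℚ ℚ.< ℚ.- p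
  neg-pos = ℚ.neg-antimono-<

  p≤∣p∣ : ∀ p → p ℚ.≤ ℚ.∣ p ∣
  p≤∣p∣ p with ℚ.≤-total 0ℚ p
  ... | inj₁ 0≤p = ℚ.≤-reflexive (sym (ℚ.0≤p⇒∣p∣≡p 0≤p))
  ... | inj₂ p≤0 = ℚ.≤-trans p≤0 (ℚ.0≤∣p∣ p)

  ∣∣<-intro : ∀ {p q} → p ℚ.< q → ℚ.- p ℚ.< q → ℚ.∣ p ∣ ℚ.< q
  ∣∣<-intro {p} {q} p<q -p<q with ℚ.∣p∣≡p∨∣p∣≡-p p
  ... | inj₁ e = subst (ℚ._< q) (sym e) p<q
  ... | inj₂ e = subst (ℚ._< q) (sym e) -p<q

  dist< : ∀ p q {ε} → dist p q ℚ.< ε → p ℚ.< q ℚ.+ ε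
  dist< p q {ε} d = 0<⇒< (<⇒0< (ℚ.≤-<-trans (p≤∣p∣ (p ℚ.- q)) d))
    (solve 3 (λ p q e → e :- (p :- q) := (q :+ e) :- p) refl p q ε)

  dist<-intro : ∀ p q {ε} → p ℚ.- q ℚ.< ε → q ℚ.- p ℚ.< ε → dist p q ℚ.< ε
  dist<-intro p q {ε} p-q<ε q-p<ε = ∣∣<-intro p-q<ε (subst (ℚ._< ε) (solve 2 (λ p q → q :- p := :- (p :- q)) refl p q) q-p<ε)

  dist-sym : ∀ p q → dist p q ≡ dist q p
  dist-sym p q = trans (sym (ℚ.∣-p∣≡∣p∣ (p ℚ.- q))) (cong ℚ.∣_∣ (solve 2 (λ p q → :- (p :- q) := q :- p) refl p q))

  dist-self : ∀ p {ε} → 0ℚ ℚ.< ε → dist p p ℚ.< ε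
  dist-self p {ε} 0<ε = subst (ℚ._< ε) (sym (cong ℚ.∣_∣ (ℚ.+-inverseʳ p))) 0<ε

  ℚ-orderedField : OrderedField
  ℚ-orderedField = record
    { commutativeRing = ℚ.+-*-commutativeRing
    ; ι = id
    ; ι-+ = λ _ _ → refl ; ι-* = λ _ _ → refl ; ι-neg = λ _ → refl ; ι-0 = refl ; ι-1 = refl
    ; Pos = 0ℚ ℚ.<_
    ; Pos-resp = λ e → subst (0ℚ ℚ.<_) e
    ; Pos-+ = pos+pos
    ; Pos-* = pos*pos
    ; Pos-ι = id
    ; ¬Pos-0 = ℚ.<-irrefl refl
    ; inverse = λ 0<p → let q , _ , e = pos-inverse 0<p in q , e
    ; T = id ; pure = id ; _>>=_ = λ x f → f x ; run = id
    ; sign = λ x → sign x (ℚ.<-cmp 0ℚ x)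
    }
    where
    sign : ∀ x → _ → 0ℚ ℚ.< x ⊎ x ≡ 0ℚ ⊎ 0ℚ ℚ.< ℚ.- x
    sign x (tri< 0<x _ _) = inj₁ 0<x
    sign x (tri≈ _ 0≡x _) = inj₂ (inj₁ (sym 0≡x))
    sign x (tri> _ _ x<0) = inj₂ (inj₂ (neg-pos x<0))

  Eventually : (ℕ → Set) → Set
  Eventually P = ∃[ N ] (∀ n → N ℕ.≤ n → P n)

  eventually₂ : ∀ {P Q R : ℕ → Set} → (∀ n → P n → Q n → R n) → Eventually P → Eventually Q → Eventually R
  eventually₂ f (M , p) (N , q) = M ⊔ N , λ n M⊔N≤n →
    f n (p n (ℕ.m⊔n≤o⇒m≤o M N M⊔N≤n)) (q n (ℕ.m⊔n≤o⇒n≤o M N M⊔N≤n))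

  eventually : ∀ {P Q : ℕ → Set} → (∀ n → P n → Q n) → Eventually P → Eventually Q
  eventually f (N , p) = N , λ n N≤n → f n (p n N≤n)

  Null : (ℕ → ℚ) → Set
  Null s = ∀ ε → 0ℚ ℚ.< ε → Eventually λ n → ℚ.∣ s n ∣ ℚ.< ε

  null-ext : ∀ {s s′} → (∀ n → s n ≡ s′ n) → Null s → Null s′
  null-ext e null ε 0<ε = eventually (λ n → subst (λ z → ℚ.∣ z ∣ ℚ.< ε) (e n)) (null ε 0<ε)

  null-+ : ∀ {s s′} → Null s → Null s′ → Null (λ n → s n ℚ.+ s′ n)
  null-+ {s} {s′} null null′ ε 0<ε = eventually₂
    (λ n p q → ℚ.≤-<-trans (ℚ.∣p+q∣≤∣p∣+∣q∣ (s n) (s′ n))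
      (<-combine p q (solve 3 (λ a b e → (con ½ :* e :- a) :+ (con ½ :* e :- b) := e :- (a :+ b)) refl ℚ.∣ s n ∣ ℚ.∣ s′ n ∣ ε)))
    (null (½ ℚ.* ε) (half-pos 0<ε)) (null′ (½ ℚ.* ε) (half-pos 0<ε))

  null-neg : ∀ {s} → Null s → Null (λ n → ℚ.- s n)
  null-neg {s} null ε 0<ε = eventually (λ n → subst (ℚ._< ε) (sym (ℚ.∣-p∣≡∣p∣ (s n)))) (null ε 0<ε)

  Bounded : (ℕ → ℚ) → Set
  Bounded s = ∃[ B ] (0ℚ ℚ.< B × Eventually λ n → ℚ.∣ s n ∣ ℚ.< B)

  bounded : ∀ x → Bounded (seq x)
  bounded x with cauchy x 1ℚ 0<1
  ... | N , close = 1ℚ ℚ.+ ℚ.∣ seq x N ∣ , ℚ.≤-<-trans (ℚ.0≤∣p∣ (seq x N)) (bound N ℕ.≤-refl) , N , bound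
    where
    bound : ∀ n → N ℕ.≤ n → ℚ.∣ seq x n ∣ ℚ.< 1ℚ ℚ.+ ℚ.∣ seq x N ∣
    bound n N≤n = begin-strict
      ℚ.∣ seq x n ∣                               ≡⟨ cong ℚ.∣_∣ (solve 2 (λ a b → a := (a :- b) :+ b) refl (seq x n) (seq x N)) ⟩
      ℚ.∣ (seq x n ℚ.- seq x N) ℚ.+ seq x N ∣     ≤⟨ ℚ.∣p+q∣≤∣p∣+∣q∣ (seq x n ℚ.- seq x N) (seq x N) ⟩
      dist (seq x n) (seq x N) ℚ.+ ℚ.∣ seq x N ∣  <⟨ ℚ.+-monoˡ-< ℚ.∣ seq x N ∣ (close n N N≤n ℕ.≤-refl) ⟩
      1ℚ ℚ.+ ℚ.∣ seq x N ∣                        ∎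
      where open ℚ.≤-Reasoning

  *-bound : ∀ {p B q δ} → 0ℚ ℚ.< B → ℚ.∣ p ∣ ℚ.≤ B → ℚ.∣ q ∣ ℚ.< δ → ℚ.∣ p ℚ.* q ∣ ℚ.< B ℚ.* δ
  *-bound {p} {B} {q} {δ} 0<B p≤B q<δ = begin-strict
    ℚ.∣ p ℚ.* q ∣           ≡⟨ ℚ.∣p*q∣≡∣p∣*∣q∣ p q ⟩
    ℚ.∣ p ∣ ℚ.* ℚ.∣ q ∣     ≤⟨ ℚ.*-monoʳ-≤-nonNeg ℚ.∣ q ∣ {{ℚ.∣-∣-nonNeg q}} p≤B ⟩
    B ℚ.* ℚ.∣ q ∣           <⟨ ℚ.*-monoʳ-<-pos B {{ℚ.positive 0<B}} q<δ ⟩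
    B ℚ.* δ                 ∎
    where open ℚ.≤-Reasoning

  null-* : ∀ {b s} → Bounded b → Null s → Null (λ n → b n ℚ.* s n)
  null-* {b} {s} (B , 0<B , b<B) null ε 0<ε with pos-inverse 0<B
  ... | B⁻¹ , 0<B⁻¹ , BB⁻¹≡1 = eventually₂
    (λ n p q → subst (ℚ.∣ b n ℚ.* s n ∣ ℚ.<_) value (*-bound 0<B (ℚ.<⇒≤ p) q))
    b<B (null (B⁻¹ ℚ.* ε) (pos*pos 0<B⁻¹ 0<ε))
    where
    value : B ℚ.* (B⁻¹ ℚ.* ε) ≡ ε
    value = trans (sym (ℚ.*-assoc B B⁻¹ ε)) (trans (cong (ℚ._* ε) BB⁻¹≡1) (ℚ.*-identityˡ ε))

  ≡⇒≃ : ∀ x y → (∀ n → seq x n ≡ seq y n) → x ≃ y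
  ≡⇒≃ x y e ε 0<ε = 0 , λ n _ → subst (λ z → dist (seq x n) z ℚ.< ε) (e n) (dist-self (seq x n) 0<ε)

  ≃-sym : ∀ x y → x ≃ y → y ≃ x
  ≃-sym x y x≃y = null-ext (λ n → solve 2 (λ a b → :- (a :- b) := b :- a) refl (seq x n) (seq y n)) (null-neg x≃y)

  ≃-trans : ∀ x y z → x ≃ y → y ≃ z → x ≃ z
  ≃-trans x y z x≃y y≃z = null-ext
    (λ n → solve 3 (λ a b c → (a :- b) :+ (b :- c) := a :- c) refl (seq x n) (seq y n) (seq z n)) (null-+ x≃y y≃z)

  -ℝ_ : ℝ → ℝ
  -ℝ x = mkℝ (λ n → ℚ.- seq x n) λ ε 0<ε → let N , close = cauchy x ε 0<ε in
    N , λ m n N≤m N≤n → subst (ℚ._< ε)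
      (trans (dist-sym (seq x m) (seq x n)) (cong ℚ.∣_∣ (solve 2 (λ a b → b :- a := :- a :- :- b) refl (seq x m) (seq x n))))
      (close m n N≤m N≤n)

  +ℝ-cong : ∀ x y u v → x ≃ y → u ≃ v → (x +ℝ u) ≃ (y +ℝ v)
  +ℝ-cong x y u v x≃y u≃v = null-ext
    (λ n → solve 4 (λ a b c d → (a :- b) :+ (c :- d) := (a :+ c) :- (b :+ d)) refl (seq x n) (seq y n) (seq u n) (seq v n))
    (null-+ x≃y u≃v)

  *ℝ-cong : ∀ x y u v → x ≃ y → u ≃ v → (x *ℝ u) ≃ (y *ℝ v)
  *ℝ-cong x y u v x≃y u≃v = null-ext
    (λ n → solve 4 (λ a b c d → a :* (c :- d) :+ d :* (a :- b) := a :* c :- b :* d) refl (seq x n) (seq y n) (seq u n) (seq v n))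
    (null-+ (null-* (bounded x) u≃v) (null-* (bounded v) x≃y))

  ℝ-isCommutativeRing : IsCommutativeRing _≃_ _+ℝ_ _*ℝ_ -ℝ_ 0ℝ 1ℝ
  ℝ-isCommutativeRing = record
    { isRing = record
      { +-isAbelianGroup = record
        { isGroup = record
          { isMonoid = record
            { isSemigroup = record
              { isMagma = record
                { isEquivalence = record
                  { refl  = λ {x} → ≡⇒≃ x x λ _ → refl
                  ; sym   = λ {x} {y} → ≃-sym x y
                  ; trans = λ {x} {y} {z} → ≃-trans x y z }
                ; ∙-cong = λ {x} {y} {u} {v} → +ℝ-cong x y u v }
              ; assoc = λ x y z → ≡⇒≃ (x +ℝ y +ℝ z) (x +ℝ (y +ℝ z)) λ n → ℚ.+-assoc (seq x n) (seq y n) (seq z n) }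
            ; identity = (λ x → ≡⇒≃ (0ℝ +ℝ x) x λ n → ℚ.+-identityˡ (seq x n))
                       , (λ x → ≡⇒≃ (x +ℝ 0ℝ) x λ n → ℚ.+-identityʳ (seq x n)) }
          ; inverse = (λ x → ≡⇒≃ ((-ℝ x) +ℝ x) 0ℝ λ n → ℚ.+-inverseˡ (seq x n))
                    , (λ x → ≡⇒≃ (x +ℝ (-ℝ x)) 0ℝ λ n → ℚ.+-inverseʳ (seq x n))
          ; ⁻¹-cong = λ {x} {y} x≃y → null-ext (λ n → solve 2 (λ a b → :- (a :- b) := :- a :- :- b) refl (seq x n) (seq y n)) (null-neg x≃y) }
        ; comm = λ x y → ≡⇒≃ (x +ℝ y) (y +ℝ x) λ n → ℚ.+-comm (seq x n) (seq y n) }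
      ; *-cong = λ {x} {y} {u} {v} → *ℝ-cong x y u v
      ; *-assoc = λ x y z → ≡⇒≃ (x *ℝ y *ℝ z) (x *ℝ (y *ℝ z)) λ n → ℚ.*-assoc (seq x n) (seq y n) (seq z n)
      ; *-identity = (λ x → ≡⇒≃ (1ℝ *ℝ x) x λ n → ℚ.*-identityˡ (seq x n))
                   , (λ x → ≡⇒≃ (x *ℝ 1ℝ) x λ n → ℚ.*-identityʳ (seq x n))
      ; distrib = (λ x y z → ≡⇒≃ (x *ℝ (y +ℝ z)) (x *ℝ y +ℝ x *ℝ z) λ n → ℚ.*-distribˡ-+ (seq x n) (seq y n) (seq z n))
                , (λ x y z → ≡⇒≃ ((y +ℝ z) *ℝ x) (y *ℝ x +ℝ z *ℝ x) λ n → ℚ.*-distribʳ-+ (seq x n) (seq y n) (seq z n)) }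
    ; *-comm = λ x y → ≡⇒≃ (x *ℝ y) (y *ℝ x) λ n → ℚ.*-comm (seq x n) (seq y n) }

  Positiveℝ : ℝ → Set
  Positiveℝ x = ∃[ ε ] (0ℚ ℚ.< ε × Eventually λ n → ε ℚ.< seq x n)

  Positive-resp : ∀ x y → x ≃ y → Positiveℝ x → Positiveℝ y
  Positive-resp x y x≃y (ε , 0<ε , ε<x) = ½ ℚ.* ε , half-pos 0<ε , eventually₂
    (λ n p q → <-combine p (dist< (seq x n) (seq y n) q) (solve 3 (λ a b e → (a :- e) :+ (b :+ con ½ :* e :- a) := b :- con ½ :* e) refl (seq x n) (seq y n) ε))
    ε<x (x≃y (½ ℚ.* ε) (half-pos 0<ε))

  Positive-* : ∀ x y → Positiveℝ x → Positiveℝ y → Positiveℝ (x *ℝ y)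
  Positive-* x y (ε , 0<ε , ε<x) (δ , 0<δ , δ<y) = ε ℚ.* δ , pos*pos 0<ε 0<δ , eventually₂
    (λ n p q → ℚ.<-trans
      (ℚ.*-monoʳ-<-pos ε {{ℚ.positive 0<ε}} q)
      (ℚ.*-monoˡ-<-pos (seq y n) {{ℚ.positive (ℚ.<-trans 0<δ q)}} p))
    ε<x δ<y

  -- A Cauchy sequence that is not eventually bounded away from 0 is null.
  sign-ℝ : ∀ x → ¬ ¬ (Positiveℝ x ⊎ x ≃ 0ℝ ⊎ Positiveℝ (-ℝ x))
  sign-ℝ x k = k (inj₂ (inj₁ null))
    where
    null : x ≃ 0ℝ
    null ε 0<ε with cauchy x (½ ℚ.* (½ ℚ.* ε)) (half-pos (half-pos 0<ε))
    ... | N , close with ℚ.∣ seq x N ∣ ℚ.<? ½ ℚ.* ε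
    ...   | yes small = N , λ n N≤n → begin-strict
      dist (seq x n) 0ℚ                              ≡⟨ cong ℚ.∣_∣ (solve 2 (λ a b → a :- con 0ℚ := (a :- b) :+ b) refl (seq x n) (seq x N)) ⟩
      ℚ.∣ (seq x n ℚ.- seq x N) ℚ.+ seq x N ∣        ≤⟨ ℚ.∣p+q∣≤∣p∣+∣q∣ (seq x n ℚ.- seq x N) (seq x N) ⟩
      dist (seq x n) (seq x N) ℚ.+ ℚ.∣ seq x N ∣     <⟨ ℚ.+-mono-< (close n N N≤n ℕ.≤-refl) small ⟩
      ½ ℚ.* (½ ℚ.* ε) ℚ.+ ½ ℚ.* ε                    <⟨ 0<⇒< (half-pos (half-pos 0<ε)) (solve 1 (λ e → con ½ :* (con ½ :* e) := e :- (con ½ :* (con ½ :* e) :+ con ½ :* e)) refl ε) ⟩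
      ε                                              ∎
      where open ℚ.≤-Reasoning
    ...   | no large with ℚ.∣p∣≡p∨∣p∣≡-p (seq x N)
    ...     | inj₁ e = ⊥-elim (k (inj₁ (½ ℚ.* (½ ℚ.* ½ ℚ.* ε) , half-pos (pos*pos (half-pos 0<½) 0<ε) , N , λ n N≤n → <-combine
                (ℚ.≤-<-trans (subst (½ ℚ.* ε ℚ.≤_) e (ℚ.≮⇒≥ large)) (dist< (seq x N) (seq x n) (close N n ℕ.≤-refl N≤n)))
                (half-pos (pos*pos (half-pos 0<½) 0<ε))
                (solve 2 (λ a e → (a :+ con ½ :* (con ½ :* e) :- con ½ :* e) :+ (con ½ :* (con ½ :* con ½ :* e) :- con 0ℚ) := a :- con ½ :* (con ½ :* con ½ :* e)) refl (seq x n) ε))))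
    ...     | inj₂ e = ⊥-elim (k (inj₂ (inj₂ (½ ℚ.* (½ ℚ.* ½ ℚ.* ε) , half-pos (pos*pos (half-pos 0<½) 0<ε) , N , λ n N≤n → <-combine
                (ℚ.≤-<-trans (subst (½ ℚ.* ε ℚ.≤_) e (ℚ.≮⇒≥ large)) (negated n N≤n))
                (half-pos (pos*pos (half-pos 0<½) 0<ε))
                (solve 2 (λ a e → (:- a :+ con ½ :* (con ½ :* e) :- con ½ :* e) :+ (con ½ :* (con ½ :* con ½ :* e) :- con 0ℚ) := :- a :- con ½ :* (con ½ :* con ½ :* e)) refl (seq x n) ε)))))
      where
      negated : ∀ n → N ℕ.≤ n → ℚ.- seq x N ℚ.< ℚ.- seq x n ℚ.+ ½ ℚ.* (½ ℚ.* ε)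
      negated n N≤n = 0<⇒< (<⇒0< (dist< (seq x n) (seq x N) (close n N N≤n ℕ.≤-refl)))
        (solve 3 (λ a b e → (a :+ e) :- b := (:- b :+ e) :- :- a) refl (seq x N) (seq x n) (½ ℚ.* (½ ℚ.* ε)))

  -- Each term is replaced by its maximum with `ε` before inversion. Then all terms are invertible
  -- with inverses at most 1/ε, and nothing changes from index `N` on. The Cauchy property follows
  -- from w m - w n = w m w n (a n - a m), whence the modulus of `x` is taken at ε² δ.
  inverse-ℝ : ∀ x → Positiveℝ x → ∃[ y ] (x *ℝ y) ≃ 1ℝ
  inverse-ℝ x (ε , 0<ε , N , ε<x) = y , product
    where
    a w : ℕ → ℚ
    a n = seq x n ℚ.⊔ ε
    a>0 : ∀ n → 0ℚ ℚ.< a n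
    a>0 n = ℚ.<-≤-trans 0<ε (ℚ.p≤q⊔p (seq x n) ε)
    a≡x : ∀ n → N ℕ.≤ n → a n ≡ seq x n
    a≡x n N≤n = ℚ.p≥q⇒p⊔q≡p (ℚ.<⇒≤ (ε<x n N≤n))
    w n = proj₁ (pos-inverse (a>0 n))
    w>0 : ∀ n → 0ℚ ℚ.< w n
    w>0 n = proj₁ (proj₂ (pos-inverse (a>0 n)))
    aw≡1 : ∀ n → a n ℚ.* w n ≡ 1ℚ
    aw≡1 n = proj₂ (proj₂ (pos-inverse (a>0 n)))
    e : ℚ
    e = proj₁ (pos-inverse 0<ε)
    0<e : 0ℚ ℚ.< e
    0<e = proj₁ (proj₂ (pos-inverse 0<ε))
    εe≡1 : ε ℚ.* e ≡ 1ℚ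
    εe≡1 = proj₂ (proj₂ (pos-inverse 0<ε))
    w≤e : ∀ n → w n ℚ.≤ e
    w≤e n = begin
      w n                        ≡⟨ ℚ.*-identityʳ (w n) ⟨
      w n ℚ.* 1ℚ                 ≡⟨ cong (w n ℚ.*_) εe≡1 ⟨
      w n ℚ.* (ε ℚ.* e)          ≡⟨ solve 3 (λ w ε e → w :* (ε :* e) := ε :* (w :* e)) refl (w n) ε e ⟩
      ε ℚ.* (w n ℚ.* e)          ≤⟨ ℚ.*-monoʳ-≤-nonNeg (w n ℚ.* e) {{ℚ.nonNegative (ℚ.<⇒≤ (pos*pos (w>0 n) 0<e))}} (ℚ.p≤q⊔p (seq x n) ε) ⟩
      a n ℚ.* (w n ℚ.* e)        ≡⟨ ℚ.*-assoc (a n) (w n) e ⟨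
      a n ℚ.* w n ℚ.* e          ≡⟨ trans (cong (ℚ._* e) (aw≡1 n)) (ℚ.*-identityˡ e) ⟩
      e                          ∎
      where open ℚ.≤-Reasoning
    ∣w∣≤e : ∀ n → ℚ.∣ w n ∣ ℚ.≤ e
    ∣w∣≤e n = subst (ℚ._≤ e) (sym (ℚ.0≤p⇒∣p∣≡p (ℚ.<⇒≤ (w>0 n)))) (w≤e n)
    difference : ∀ m n → w m ℚ.* (w n ℚ.* (a n ℚ.- a m)) ≡ w m ℚ.- w n
    difference m n = begin
      w m ℚ.* (w n ℚ.* (a n ℚ.- a m))                   ≡⟨ solve 4 (λ w v a b → w :* (v :* (a :- b)) := w :* (a :* v) :- v :* (b :* w)) refl (w m) (w n) (a n) (a m) ⟩
      w m ℚ.* (a n ℚ.* w n) ℚ.- w n ℚ.* (a m ℚ.* w m)   ≡⟨ cong₂ (λ p q → w m ℚ.* p ℚ.- w n ℚ.* q) (aw≡1 n) (aw≡1 m) ⟩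
      w m ℚ.* 1ℚ ℚ.- w n ℚ.* 1ℚ                         ≡⟨ cong₂ ℚ._-_ (ℚ.*-identityʳ (w m)) (ℚ.*-identityʳ (w n)) ⟩
      w m ℚ.- w n                                       ∎
      where open ≡-Reasoning
    w-cauchy : IsCauchy w
    w-cauchy δ 0<δ with cauchy x (ε ℚ.* (ε ℚ.* δ)) (pos*pos 0<ε (pos*pos 0<ε 0<δ))
    ... | M , close = M ⊔ N , λ m n M⊔N≤m M⊔N≤n → subst₂ ℚ._<_ (cong ℚ.∣_∣ (difference m n)) value
      (*-bound 0<e (∣w∣≤e m) (*-bound 0<e (∣w∣≤e n)
        (subst (ℚ._< ε ℚ.* (ε ℚ.* δ)) (cong₂ dist (sym (a≡x n (ℚN M⊔N≤n))) (sym (a≡x m (ℚN M⊔N≤m))))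
          (close n m (ℕ.m⊔n≤o⇒m≤o M N M⊔N≤n) (ℕ.m⊔n≤o⇒m≤o M N M⊔N≤m)))))
      where
      ℚN : ∀ {n} → M ⊔ N ℕ.≤ n → N ℕ.≤ n
      ℚN = ℕ.m⊔n≤o⇒n≤o M N
      value : e ℚ.* (e ℚ.* (ε ℚ.* (ε ℚ.* δ))) ≡ δ
      value = trans (solve 3 (λ e ε δ → e :* (e :* (ε :* (ε :* δ))) := (ε :* e) :* ((ε :* e) :* δ)) refl e ε δ)
        (trans (cong₂ (λ p q → p ℚ.* (q ℚ.* δ)) εe≡1 εe≡1) (trans (ℚ.*-identityˡ (1ℚ ℚ.* δ)) (ℚ.*-identityˡ δ)))
    y : ℝ
    y = mkℝ w w-cauchy
    product : (x *ℝ y) ≃ 1ℝ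
    product δ 0<δ = N , λ n N≤n → subst (λ z → dist z 1ℚ ℚ.< δ)
      (trans (sym (aw≡1 n)) (cong (ℚ._* w n) (a≡x n N≤n))) (dist-self 1ℚ 0<δ)

  -- The operations are abstract because unification would otherwise unfold
  -- the Cauchy moduli.
  infixl 6 _⊕_
  infixl 7 _⊗_
  infix  8 ⊖_

  abstract
    _⊕_ _⊗_ : ℝ → ℝ → ℝ
    _⊕_ = _+ℝ_
    _⊗_ = _*ℝ_

    ⊖_ : ℝ → ℝ
    ⊖_ = -ℝ_

    seq-⊕ : ∀ x y m → seq (x ⊕ y) m ≡ seq x m ℚ.+ seq y m
    seq-⊕ x y m = refl

    seq-⊗ : ∀ x y m → seq (x ⊗ y) m ≡ seq x m ℚ.* seq y m
    seq-⊗ x y m = refl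

    seq-⊖ : ∀ x m → seq (⊖ x) m ≡ ℚ.- seq x m
    seq-⊖ x m = refl

    ⊕⊗-isCommutativeRing : IsCommutativeRing _≃_ _⊕_ _⊗_ ⊖_ 0ℝ 1ℝ
    ⊕⊗-isCommutativeRing = ℝ-isCommutativeRing

    ι-⊕ : ∀ p q → fromℚ (p ℚ.+ q) ≃ fromℚ p ⊕ fromℚ q
    ι-⊕ p q = ≡⇒≃ (fromℚ (p ℚ.+ q)) (fromℚ p +ℝ fromℚ q) λ _ → refl

    ι-⊗ : ∀ p q → fromℚ (p ℚ.* q) ≃ fromℚ p ⊗ fromℚ q
    ι-⊗ p q = ≡⇒≃ (fromℚ (p ℚ.* q)) (fromℚ p *ℝ fromℚ q) λ _ → refl

    ι-⊖ : ∀ p → fromℚ (ℚ.- p) ≃ ⊖ fromℚ p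
    ι-⊖ p = ≡⇒≃ (fromℚ (ℚ.- p)) (-ℝ fromℚ p) λ _ → refl

    Positive-⊕ : ∀ x y → Positiveℝ x → Positiveℝ y → Positiveℝ (x ⊕ y)
    Positive-⊕ x y (ε , 0<ε , p) (δ , 0<δ , q) = ε ℚ.+ δ , pos+pos 0<ε 0<δ , eventually₂ (λ _ → ℚ.+-mono-<) p q

    Positive-⊗ : ∀ x y → Positiveℝ x → Positiveℝ y → Positiveℝ (x ⊗ y)
    Positive-⊗ = Positive-*

    inverse-⊗ : ∀ x → Positiveℝ x → ∃[ y ] x ⊗ y ≃ 1ℝ
    inverse-⊗ = inverse-ℝ

    sign-⊖ : ∀ x → ¬ ¬ (Positiveℝ x ⊎ x ≃ 0ℝ ⊎ Positiveℝ (⊖ x))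
    sign-⊖ = sign-ℝ

  ¬Positive-0 : ¬ Positiveℝ 0ℝ
  ¬Positive-0 (ε , 0<ε , N , p) = ℚ.<-asym 0<ε (p N ℕ.≤-refl)

  Positive-fromℚ : ∀ {q} → 0ℚ ℚ.< q → Positiveℝ (fromℚ q)
  Positive-fromℚ {q} 0<q = ½ ℚ.* q , half-pos 0<q , 0 , λ _ _ → 0<⇒< (half-pos 0<q) (solve 1 (λ q → con ½ :* q := q :- con ½ :* q) refl q)

  ℝ-orderedField : OrderedField
  ℝ-orderedField = record
    { commutativeRing = record { isCommutativeRing = ⊕⊗-isCommutativeRing }
    ; ι = fromℚ
    ; ι-+ = ι-⊕ ; ι-* = ι-⊗ ; ι-neg = ι-⊖
    ; ι-0 = ≡⇒≃ 0ℝ 0ℝ λ _ → refl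
    ; ι-1 = ≡⇒≃ 1ℝ 1ℝ λ _ → refl
    ; Pos = Positiveℝ
    ; Pos-resp = λ {x} {y} → Positive-resp x y
    ; Pos-+ = λ {x} {y} → Positive-⊕ x y
    ; Pos-* = λ {x} {y} → Positive-⊗ x y
    ; Pos-ι = Positive-fromℚ
    ; ¬Pos-0 = ¬Positive-0
    ; inverse = λ {x} → inverse-⊗ x
    ; T = λ A → ¬ ¬ A ; pure = λ a k → k a ; _>>=_ = λ x f k → x λ a → f a k ; run = λ k → k id
    ; sign = sign-⊖
    }

-- The natural numbers inside the rationals.

module NaturalEmbedding where

  open import Data.Integer.Base as ℤ using (ℤ; +_; -[1+_])
  import Data.Integer.Properties as ℤ
  open import Data.Nat.Base as ℕ using (ℕ; suc)
  import Data.Nat.Properties as ℕ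
  open import Data.Product.Base using (∃-syntax; _,_)
  open import Data.Rational.Base as ℚ using (ℚ; 0ℚ; 1ℚ; mkℚ; _/_)
  import Data.Rational.Properties as ℚ
  open import Data.Rational.Unnormalised.Base as ℚᵘ using (mkℚᵘ; *<*; *≤*)
  import Data.Rational.Unnormalised.Properties as ℚᵘ
  open import Data.Sum.Base using (inj₁; inj₂)
  open import Relation.Binary.PropositionalEquality

  /1-+ : ∀ i j → (i ℤ.+ j) / 1 ≡ i / 1 ℚ.+ j / 1
  /1-+ i j = sym (trans (sym (ℚ.fromℚᵘ-toℚᵘ (i / 1 ℚ.+ j / 1))) (ℚ.fromℚᵘ-cong (ℚᵘ.≃-trans (ℚ.toℚᵘ-homo-+ (i / 1) (j / 1))
    (ℚᵘ.≃-trans (ℚᵘ.+-cong (ℚ.toℚᵘ-fromℚᵘ (mkℚᵘ i 0)) (ℚ.toℚᵘ-fromℚᵘ (mkℚᵘ j 0)))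
      (ℚᵘ.≃-reflexive (cong (λ z → mkℚᵘ z 0) (cong₂ ℤ._+_ (ℤ.*-identityʳ i) (ℤ.*-identityʳ j))))))))

  /1-* : ∀ i j → (i ℤ.* j) / 1 ≡ (i / 1) ℚ.* (j / 1)
  /1-* i j = sym (trans (sym (ℚ.fromℚᵘ-toℚᵘ ((i / 1) ℚ.* (j / 1)))) (ℚ.fromℚᵘ-cong (ℚᵘ.≃-trans (ℚ.toℚᵘ-homo-* (i / 1) (j / 1))
    (ℚᵘ.*-cong (ℚ.toℚᵘ-fromℚᵘ (mkℚᵘ i 0)) (ℚ.toℚᵘ-fromℚᵘ (mkℚᵘ j 0))))))

  /1-mono-< : ∀ {i j} → i ℤ.< j → i / 1 ℚ.< j / 1
  /1-mono-< {i} {j} i<j = ℚ.toℚᵘ-cancel-< (ℚᵘ.<-respˡ-≃ (ℚᵘ.≃-sym (ℚ.toℚᵘ-fromℚᵘ (mkℚᵘ i 0)))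
    (ℚᵘ.<-respʳ-≃ (ℚᵘ.≃-sym (ℚ.toℚᵘ-fromℚᵘ (mkℚᵘ j 0)))
      (*<* (subst₂ ℤ._<_ (sym (ℤ.*-identityʳ i)) (sym (ℤ.*-identityʳ j)) i<j))))

  archimedean/1 : ∀ p → ∃[ N ] p ℚ.≤ (+ N) / 1
  archimedean/1 p@(mkℚ n d _) = ℤ.∣ n ∣ , ℚ.toℚᵘ-cancel-≤ (ℚᵘ.≤-respʳ-≃ (ℚᵘ.≃-sym (ℚ.toℚᵘ-fromℚᵘ (mkℚᵘ (+ ℤ.∣ n ∣) 0))) (*≤* (bound n)))
    where
    bound : ∀ n → n ℤ.* (+ 1) ℤ.≤ (+ ℤ.∣ n ∣) ℤ.* (+ suc d)
    bound (+ m)    = subst₂ ℤ._≤_ (ℤ.pos-* m 1) (ℤ.pos-* m (suc d)) (ℤ.+≤+ (ℕ.*-monoʳ-≤ m (ℕ.s≤s ℕ.z≤n)))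
    bound -[1+ m ] = ℤ.≤-trans ℤ.-≤+ (ℤ.≤-reflexive (ℤ.pos-* (suc m) (suc d)))

  -- Abstract, because unfolding _/_ during unification runs gcd on open terms.
  abstract
    φ : ℕ → ℚ
    φ n = (+ n) / 1

    φ≡/1 : ∀ n → φ n ≡ (+ n) / 1
    φ≡/1 n = refl

    φ-0 : φ 0 ≡ 0ℚ
    φ-0 = refl

    φ-1 : φ 1 ≡ 1ℚ
    φ-1 = refl

    φ-+ : ∀ m n → φ (m ℕ.+ n) ≡ φ m ℚ.+ φ n
    φ-+ m n = /1-+ (+ m) (+ n)

    φ-* : ∀ m n → φ (m ℕ.* n) ≡ φ m ℚ.* φ n
    φ-* m n = trans (cong (_/ 1) (ℤ.pos-* m n)) (/1-* (+ m) (+ n))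

    φ-< : ∀ m n → m ℕ.< n → φ m ℚ.< φ n
    φ-< m n m<n = /1-mono-< (ℤ.+<+ m<n)

    archimedean : ∀ p → ∃[ N ] p ℚ.≤ φ N
    archimedean = archimedean/1

  φ-suc : ∀ n → φ (suc n) ≡ 1ℚ ℚ.+ φ n
  φ-suc n = trans (φ-+ 1 n) (cong (ℚ._+ φ n) φ-1)

  φ-≤ : ∀ m n → m ℕ.≤ n → φ m ℚ.≤ φ n
  φ-≤ m n m≤n with ℕ.m≤n⇒m<n∨m≡n m≤n
  ... | inj₁ m<n  = ℚ.<⇒≤ (φ-< m n m<n)
  ... | inj₂ refl = ℚ.≤-refl

  φ-cancel-≤ : ∀ m n → φ m ℚ.≤ φ n → m ℕ.≤ n
  φ-cancel-≤ m n φm≤φn = ℕ.≮⇒≥ λ n<m → ℚ.<-irrefl refl (ℚ.<-≤-trans (φ-< n m n<m) φm≤φn)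

  0<φ-suc : ∀ n → 0ℚ ℚ.< φ (suc n)
  0<φ-suc n = subst (ℚ._< φ (suc n)) φ-0 (φ-< 0 (suc n) (ℕ.s≤s ℕ.z≤n))

-- The forms of M - c I.

module Shifts where

  open OrderedFields
  open GaussianElimination
  open import Data.Bool.Base using (if_then_else_)
  open import Data.Fin.Base using (Fin; zero; suc)
  open import Data.Fin.Properties using (_≟_)
  open import Data.Nat.Base using (zero; suc)
  open import Data.Product.Base using (∃-syntax; _×_; _,_; proj₁; proj₂)
  open import Data.Rational.Base as ℚ using (1ℚ; ½)
  import Data.Rational.Properties as ℚ
  open import Data.Vec.Functional using (Vector; head; tail)
  open import Relation.Binary.PropositionalEquality as ≡ using (_≡_)
  open import Relation.Nullary.Decidable using (does; yes; no)
  open import Data.Empty using (⊥-elim)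

  module ShiftedForms (F : OrderedField) where
    open OrderedField F hiding (zero)
    open OrderedFieldProperties F
    open Solver using (solve; _:=_; _:+_; _:*_; _:-_; :-_; con)
    open QuadraticForms F
    open import Relation.Binary.Reasoning.Setoid setoid

    identity : ∀ {n} → Fin n → Vector Carrier n
    identity i j = if does (i ≟ j) then 1# else 0#

    identity-sym : ∀ {n} → Symmetric (identity {n})
    identity-sym i j with i ≟ j | j ≟ i
    ... | yes _   | yes _   = refl
    ... | no _    | no _    = refl
    ... | yes i≡j | no j≢i  = ⊥-elim (j≢i (≡.sym i≡j))
    ... | no i≢j  | yes j≡i = ⊥-elim (i≢j (≡.sym j≡i))

    identity-· : ∀ {n} (v : Vector Carrier n) i → identity i · v ≈ v i
    identity-· v zero    = trans (+-cong (*-identityˡ _) (·-zeroˡ (tail v) λ _ → refl)) (+-identityʳ _)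
    identity-· v (suc i) = trans (+-cong (zeroˡ _) (identity-· (tail v) i)) (+-identityˡ _)

    shift : ∀ {n} → (Fin n → Vector Carrier n) → Carrier → Fin n → Vector Carrier n
    shift M c i j = M i j + (- c) * identity i j

    shift-sym : ∀ {n} {M : Fin n → Vector Carrier n} c → Symmetric M → Symmetric (shift M c)
    shift-sym c M-sym i j = +-cong (M-sym i j) (*-congˡ (identity-sym i j))

    shift-mul : ∀ {n} (M : Fin n → Vector Carrier n) c v i → (shift M c ·ᴹ v) i ≈ (M ·ᴹ v) i + (- c) * v i
    shift-mul M c v i = begin
      shift M c i · v                                 ≈⟨ ·-comm (shift M c i) v ⟩
      v · shift M c i                                 ≈⟨ ·-distribˡ v (M i) (λ j → (- c) * identity i j) ⟩
      v · M i + v · (λ j → (- c) * identity i j)      ≈⟨ +-cong (·-comm v (M i)) (·-scaleʳ (- c) v (identity i)) ⟩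
      M i · v + (- c) * (v · identity i)              ≈⟨ +-congˡ (*-congˡ (trans (·-comm v (identity i)) (identity-· v i))) ⟩
      M i · v + (- c) * v i                           ∎

    shift-form : ∀ {n} (M : Fin n → Vector Carrier n) c v → form (shift M c) v ≈ form M v - c * (v · v)
    shift-form M c v = begin
      form (shift M c) v                              ≈⟨ ·-cong (λ _ → refl) (shift-mul M c v) ⟩
      v · (λ i → (M ·ᴹ v) i + (- c) * v i)            ≈⟨ ·-distribˡ v (M ·ᴹ v) (λ i → (- c) * v i) ⟩
      form M v + v · (λ i → (- c) * v i)              ≈⟨ +-congˡ (·-scaleʳ (- c) v v) ⟩
      form M v + (- c) * (v · v)                      ≈⟨ +-congˡ (solve 2 (λ c s → :- c :* s := :- (c :* s)) refl c (v · v)) ⟩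
      form M v - c * (v · v)                          ∎

    NonNeg-sum : ∀ {n} (f : Vector Carrier n) → (∀ i → NonNeg (f i)) → NonNeg (sum f)
    NonNeg-sum {zero}  f f≥0 = NonNeg-0
    NonNeg-sum {suc n} f f≥0 = NonNeg-+ (f≥0 zero) (NonNeg-sum (tail f) (λ i → f≥0 (suc i)))

    NonNeg-·-self : ∀ {n} (v : Vector Carrier n) → NonNeg (v · v)
    NonNeg-·-self v = NonNeg-sum _ λ i → NonNeg-² (v i)

    -- A Cauchy-Schwarz inequality with a crude constant, by induction from (a x + r)² ≤ 2 a² x² + 2
    -- r²; it suffices that some constant exists.
    ·-bound : ∀ {n} (u : Vector Carrier n) → ∃[ K ] (NonNeg K × (∀ v → NonNeg (K * (v · v) - (u · v) * (u · v))))
    ·-bound {zero}  u = 0# , NonNeg-0 , λ v → NonNeg-resp (sym (-‿inverseʳ (0# * 0#))) NonNeg-0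
    ·-bound {suc n} u with ·-bound (tail u)
    ... | K , K≥0 , bound = h + h + (K + K) , NonNeg-+ hh≥0 KK≥0 , λ v →
      let x = head v ; y = tail v ; r = tail u · y in
      NonNeg-resp (solve 5 (λ a x K r s →
        ((a :* a :+ a :* a) :* s :+ (K :+ K) :* (x :* x)) :+ ((K :* s :- r :* r) :+ (K :* s :- r :* r) :+ (a :* x :- r) :* (a :* x :- r))
        := ((a :* a) :+ (a :* a) :+ (K :+ K)) :* (x :* x :+ s) :- (a :* x :+ r) :* (a :* x :+ r)) refl (head u) x K r (y · y))
      (NonNeg-+ (NonNeg-+ (NonNeg-* hh≥0 (NonNeg-·-self y)) (NonNeg-* KK≥0 (NonNeg-² x)))
        (NonNeg-+ (NonNeg-+ (bound y) (bound y)) (NonNeg-² (head u * x - r))))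
      where
      h : Carrier
      h = head u * head u
      hh≥0 : NonNeg (h + h)
      hh≥0 = NonNeg-+ (NonNeg-² _) (NonNeg-² _)
      KK≥0 : NonNeg (K + K)
      KK≥0 = NonNeg-+ K≥0 K≥0

    sum-scaleʳ : ∀ {n} (f : Vector Carrier n) c → sum (λ i → f i * c) ≈ sum f * c
    sum-scaleʳ f c = sym (*-distribʳ-sum c f)

    -- Expanding the square of the norm of v + M v gives 0 ≤ v · v + 2 `form M v` + (M v · M v), and
    -- the last term is at most K (v · v) by `·-bound` on the rows. Hence the form is at least -(1 +
    -- K)/2 times v · v.
    lower-bound : ∀ {n} (M : Fin n → Vector Carrier n) → ∃[ c ] PSD (shift M c)
    lower-bound {n} M = - (ι ½ * (ι 1ℚ + K)) , λ v → NonNeg-resp (value v) (Pos*NonNeg (Pos-ι (ℚ.positive⁻¹ ½)) (NonNeg-sum _ (terms v)))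
      where
      K : Carrier
      K = sum λ i → proj₁ (·-bound (M i))
      term : Vector Carrier n → Fin n → Carrier
      term v i = v i * v i + (proj₁ (·-bound (M i)) * (v · v) + (v i * (M ·ᴹ v) i + v i * (M ·ᴹ v) i))
      terms : ∀ v i → NonNeg (term v i)
      terms v i = NonNeg-resp
        (solve 4 (λ x r K s → (x :+ r) :* (x :+ r) :+ (K :* s :- r :* r) := x :* x :+ (K :* s :+ (x :* r :+ x :* r))) refl
          (v i) ((M ·ᴹ v) i) (proj₁ (·-bound (M i))) (v · v))
        (NonNeg-+ (NonNeg-² (v i + (M ·ᴹ v) i)) (proj₂ (proj₂ (·-bound (M i))) v))
      value : ∀ v → ι ½ * sum (term v) ≈ form (shift M (- (ι ½ * (ι 1ℚ + K)))) v
      value v = begin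
        ι ½ * sum (term v)
          ≈⟨ *-congˡ (trans (∑-distrib-+ (λ i → v i * v i) _) (+-congˡ (trans (∑-distrib-+ (λ i → proj₁ (·-bound (M i)) * (v · v)) _)
               (+-cong (sum-scaleʳ (λ i → proj₁ (·-bound (M i))) (v · v)) (∑-distrib-+ (λ i → v i * (M ·ᴹ v) i) (λ i → v i * (M ·ᴹ v) i)))))) ⟩
        ι ½ * (v · v + (K * (v · v) + (form M v + form M v)))
          ≈⟨ solve 3 (λ s K f → con ½ :* (s :+ (K :* s :+ (f :+ f))) := f :- (:- (con ½ :* (con 1ℚ :+ K))) :* s) refl (v · v) K (form M v) ⟩
        form M v - (- (ι ½ * (ι 1ℚ + K))) * (v · v)
          ≈⟨ sym (shift-form M _ v) ⟩
        form (shift M (- (ι ½ * (ι 1ℚ + K)))) v ∎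

    -- Summing the bounds for the coordinate functionals.
    coercive-norm : ∀ {n} (M : Fin n → Vector Carrier n) → Coercive M → ∃[ K ] (∀ v → NonNeg (K * form M v - v · v))
    coercive-norm M coercive = sum K , λ v → NonNeg-resp (value v) (NonNeg-sum _ λ i → proj₂ (proj₂ (coercive (identity i))) v)
      where
      K : Fin _ → Carrier
      K i = proj₁ (coercive (identity i))
      value : ∀ v → sum (λ i → K i * form M v - (identity i · v) * (identity i · v)) ≈ sum K * form M v - v · v
      value v = begin
        sum (λ i → K i * form M v - (identity i · v) * (identity i · v))
          ≈⟨ sum-cong-≋ (λ i → +-congˡ (trans (-‿cong (*-cong (identity-· v i) (identity-· v i)))
               (solve 1 (λ x → :- (x :* x) := (:- con 1ℚ) :* (x :* x)) refl (v i)))) ⟩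
        sum (λ i → K i * form M v + (- ι 1ℚ) * (v i * v i))
          ≈⟨ ∑-distrib-+ (λ i → K i * form M v) (λ i → (- ι 1ℚ) * (v i * v i)) ⟩
        sum (λ i → K i * form M v) + sum (λ i → (- ι 1ℚ) * (v i * v i))
          ≈⟨ +-cong (sum-scaleʳ K (form M v)) (sym (*-distribˡ-sum (- ι 1ℚ) (λ i → v i * v i))) ⟩
        sum K * form M v + (- ι 1ℚ) * (v · v)
          ≈⟨ solve 2 (λ x s → x :+ (:- con 1ℚ) :* s := x :- s) refl (sum K * form M v) (v · v) ⟩
        sum K * form M v - v · v ∎

-- Existence of the smallest eigenvalue, and semidefiniteness from a bound on it.

module SmallestEigenvalue where

  open OrderedFields
  open GaussianElimination
  open RealField
  open Shifts
  open NaturalEmbedding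
  open import Defs
  open import Data.Bool.Base using (true; false)
  open import Data.Fin.Base using (Fin; zero; suc)
  open import Data.Fin.Properties using (_≟_)
  open import Data.Empty using (⊥; ⊥-elim)
  open import Data.Nat.Base as ℕ using (ℕ; zero; suc; _⊔_)
  import Data.Nat.Properties as ℕ
  open import Data.Product.Base using (∃-syntax; _×_; _,_; proj₁; proj₂)
  open import Data.Rational.Base as ℚ using (ℚ; 0ℚ; 1ℚ; ½)
  import Data.Rational.Properties as ℚ
  open import Data.Rational.Solver using (module +-*-Solver)
  open import Data.Sum.Base using (inj₁; inj₂)
  open import Data.Vec.Functional using (Vector; tail)
  open import Relation.Binary.PropositionalEquality
  open import Relation.Nullary.Decidable using (yes; no; does)
  open import Relation.Nullary.Negation using (¬_)

  open import Algebra.Properties.Group ℚ.+-0-group using () renaming (⁻¹-involutive to -‿involutive)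
  open +-*-Solver using (solve; _:=_; _:+_; _:*_; _:-_; :-_; con)

  module Qf = QuadraticForms ℚ-orderedField
  module Qs = ShiftedForms ℚ-orderedField
  module Qp = OrderedFieldProperties ℚ-orderedField
  module Rf = QuadraticForms ℝ-orderedField
  module Rs = ShiftedForms ℝ-orderedField
  module Rp = OrderedFieldProperties ℝ-orderedField

  nonNeg⇒0≤ : ∀ {p} → Qp.NonNeg p → 0ℚ ℚ.≤ p
  nonNeg⇒0≤ {p} p≥0 = ℚ.≮⇒≥ λ p<0 → p≥0 (neg-pos p<0)

  -- Since k + 2 ≤ 2 (k + 1), halving preserves w k (k + 1) ≤ w 0; the Archimedean property then
  -- replaces any estimate of powers of two.
  halving-vanishes : ∀ (w : ℕ → ℚ) → 0ℚ ℚ.≤ w 0 → (∀ k → 0ℚ ℚ.< w k) → (∀ k → w (suc k) ≡ ½ ℚ.* w k) →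
                     ∀ {ε} → 0ℚ ℚ.< ε → ∃[ k ] w k ℚ.< ε
  halving-vanishes w 0≤w₀ w>0 halving {ε} 0<ε with pos-inverse 0<ε
  ... | ε⁻¹ , 0<ε⁻¹ , εε⁻¹≡1 with archimedean (w 0 ℚ.* ε⁻¹)
  ...   | N , w₀/ε≤N = N , ℚ.≰⇒> λ ε≤w → ℚ.<-irrefl refl (contradiction-chain ε≤w)
    where
    open ℚ.≤-Reasoning
    decay : ∀ k → w k ℚ.* φ (suc k) ℚ.≤ w 0
    decay zero    = ℚ.≤-reflexive (trans (cong (w 0 ℚ.*_) φ-1) (ℚ.*-identityʳ (w 0)))
    decay (suc k) = begin
      w (suc k) ℚ.* φ (suc (suc k))            ≡⟨ cong₂ ℚ._*_ (halving k) (φ-suc (suc k)) ⟩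
      ½ ℚ.* w k ℚ.* (1ℚ ℚ.+ φ (suc k))         ≤⟨ ℚ.*-monoˡ-≤-nonNeg (½ ℚ.* w k) {{ℚ.nonNegative (ℚ.<⇒≤ (half-pos (w>0 k)))}} (ℚ.+-monoˡ-≤ (φ (suc k)) (subst (ℚ._≤ φ (suc k)) φ-1 (φ-≤ 1 (suc k) (ℕ.s≤s ℕ.z≤n)))) ⟩
      ½ ℚ.* w k ℚ.* (φ (suc k) ℚ.+ φ (suc k))  ≡⟨ solve 2 (λ w f → con ½ :* w :* (f :+ f) := w :* f) refl (w k) (φ (suc k)) ⟩
      w k ℚ.* φ (suc k)                        ≤⟨ decay k ⟩
      w 0                                      ∎
    contradiction-chain : ε ℚ.≤ w N → ε ℚ.* φ N ℚ.< ε ℚ.* φ N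
    contradiction-chain ε≤w = begin-strict
      ε ℚ.* φ N                  <⟨ ℚ.*-monoʳ-<-pos ε {{ℚ.positive 0<ε}} (φ-< N (suc N) (ℕ.n<1+n N)) ⟩
      ε ℚ.* φ (suc N)            ≤⟨ ℚ.*-monoʳ-≤-nonNeg (φ (suc N)) {{ℚ.nonNegative (ℚ.<⇒≤ (0<φ-suc N))}} ε≤w ⟩
      w N ℚ.* φ (suc N)          ≤⟨ decay N ⟩
      w 0                        ≡⟨ ℚ.*-identityʳ (w 0) ⟨
      w 0 ℚ.* 1ℚ                 ≡⟨ cong (w 0 ℚ.*_) εε⁻¹≡1 ⟨
      w 0 ℚ.* (ε ℚ.* ε⁻¹)        ≡⟨ solve 3 (λ w e f → w :* (e :* f) := e :* (w :* f)) refl (w 0) ε ε⁻¹ ⟩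
      ε ℚ.* (w 0 ℚ.* ε⁻¹)        ≤⟨ ℚ.*-monoˡ-≤-nonNeg ε {{ℚ.nonNegative (ℚ.<⇒≤ 0<ε)}} w₀/ε≤N ⟩
      ε ℚ.* φ N                  ∎

  -- Positive information from a negation: one rational comparison at an index where the sequence
  -- has settled either gives the bound for all later terms or makes -x positive, which is excluded.
  nonNegℝ⇒eventually : ∀ x → Rp.NonNeg x → ∀ ε → 0ℚ ℚ.< ε → Eventually λ n → ℚ.- ε ℚ.≤ seq x n
  nonNegℝ⇒eventually x x≥0 ε 0<ε with cauchy x (½ ℚ.* (½ ℚ.* ε)) (half-pos (half-pos 0<ε))
  ... | N , close with ℚ.- (½ ℚ.* ε) ℚ.≤? seq x N
  ...   | yes large = N , λ n N≤n → ℚ.<⇒≤ (<-combine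
            (ℚ.≤-<-trans large (dist< (seq x N) (seq x n) (close N n ℕ.≤-refl N≤n))) (half-pos (half-pos 0<ε))
            (solve 2 (λ a e → (a :+ con ½ :* (con ½ :* e) :- :- (con ½ :* e)) :+ (con ½ :* (con ½ :* e) :- con 0ℚ) := a :- :- e) refl (seq x n) ε))
  ...   | no small = ⊥-elim (x≥0 (½ ℚ.* (½ ℚ.* ε) , half-pos (half-pos 0<ε) , N , λ n N≤n → subst (½ ℚ.* (½ ℚ.* ε) ℚ.<_) (sym (seq-⊖ x n)) (<-combine
            (ℚ.≰⇒> small) (dist< (seq x n) (seq x N) (close n N N≤n ℕ.≤-refl))
            (solve 3 (λ a b e → (:- (con ½ :* e) :- b) :+ (b :+ con ½ :* (con ½ :* e) :- a) := :- a :- con ½ :* (con ½ :* e)) refl (seq x n) (seq x N) ε))))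

  monotone : ∀ (f : ℕ → ℚ) → (∀ k → f k ℚ.≤ f (suc k)) → ∀ {k m} → k ℕ.≤ m → f k ℚ.≤ f m
  monotone f step {k} k≤m = go (ℕ.≤⇒≤′ k≤m)
    where
    go : ∀ {m} → k ℕ.≤′ m → f k ℚ.≤ f m
    go (ℕ.≤′-reflexive refl) = ℚ.≤-refl
    go (ℕ.≤′-step k≤′m) = ℚ.≤-trans (go k≤′m) (step _)

  seq-sum : ∀ m {n} (f : Vector ℝ n) (f′ : Vector ℚ n) → (∀ i → seq (f i) m ≡ f′ i) → seq (Rf.sum f) m ≡ Qf.sum f′
  seq-sum m {zero}  f f′ e = refl
  seq-sum m {suc n} f f′ e = trans (seq-⊕ (f zero) (Rf.sum (tail f)) m) (trans (cong (ℚ._+ seq (Rf.sum (tail f)) m) (e zero))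
    (cong (λ z → f′ zero ℚ.+ z) (seq-sum m (tail f) (tail f′) (λ i → e (suc i)))))

  seq-· : ∀ m {n} (u v : Vector ℝ n) (u′ v′ : Vector ℚ n) → (∀ i → seq (u i) m ≡ u′ i) → (∀ i → seq (v i) m ≡ v′ i) →
          seq (u Rf.· v) m ≡ u′ Qf.· v′
  seq-· m u v u′ v′ e f = seq-sum m (λ i → u i ⊗ v i) (λ i → u′ i ℚ.* v′ i)
    λ i → trans (seq-⊗ (u i) (v i) m) (cong₂ (λ y z → y ℚ.* z) (e i) (f i))

  seq-* : ∀ x y m → seq (x *ℝ y) m ≡ seq x m ℚ.* seq y m
  seq-* x y m = refl

  ∑-suc : ∀ {n} (f : Vector ℝ (suc n)) m → seq (∑ f) m ≡ seq (f zero) m ℚ.+ seq (∑ (tail f)) m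
  ∑-suc f m = refl

  ∑-sum : ∀ {n} (f g : Vector ℝ n) m → (∀ i → seq (f i) m ≡ seq (g i) m) → seq (∑ f) m ≡ seq (Rf.sum g) m
  ∑-sum {zero}  f g m e = refl
  ∑-sum {suc n} f g m e = trans (∑-suc f m) (trans (cong₂ (λ y z → y ℚ.+ z) (e zero) (∑-sum (tail f) (tail g) m (λ i → e (suc i))))
    (sym (seq-⊕ (g zero) (Rf.sum (tail g)) m)))

  ∑-· : ∀ {n} (u v : Vector ℝ n) m → seq (∑ (λ i → u i *ℝ v i)) m ≡ seq (u Rf.· v) m
  ∑-· u v m = ∑-sum (λ i → u i *ℝ v i) (λ i → u i ⊗ v i) m
    λ i → trans (seq-* (u i) (v i) m) (sym (seq-⊗ (u i) (v i) m))

  seq-identity : ∀ m {n} (i j : Fin n) → seq (Rs.identity i j) m ≡ Qs.identity i j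
  seq-identity m i j with does (i ≟ j)
  ... | true  = refl
  ... | false = refl

  psd<negative : ∀ {n} (M : Fin n → Vector ℚ n) lo hi → Qf.PSD (Qs.shift M lo) → Qf.Negative (Qs.shift M hi) → lo ℚ.< hi
  psd<negative M lo hi psd (v , neg) = ℚ.≰⇒> λ hi≤lo → ℚ.<-irrefl refl (begin-strict
    0ℚ                                                      <⟨ neg′ ⟩
    ℚ.- (f ℚ.- hi ℚ.* s)                                    ≡⟨ solve 4 (λ f h l s → :- (f :- h :* s) := con 0ℚ :- (f :- l :* s) :- (l :- h) :* s) refl f hi lo s ⟩
    0ℚ ℚ.- (f ℚ.- lo ℚ.* s) ℚ.- (lo ℚ.- hi) ℚ.* s           ≤⟨ ℚ.+-mono-≤ (ℚ.+-monoʳ-≤ 0ℚ (ℚ.neg-antimono-≤ psd′)) (ℚ.neg-antimono-≤ (product hi≤lo)) ⟩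
    0ℚ                                                      ∎)
    where
    open ℚ.≤-Reasoning
    f s : ℚ
    f = Qf.form M v
    s = v Qf.· v
    neg′ : 0ℚ ℚ.< ℚ.- (f ℚ.- hi ℚ.* s)
    neg′ = subst (λ z → 0ℚ ℚ.< ℚ.- z) (Qs.shift-form M hi v) neg
    psd′ : 0ℚ ℚ.≤ f ℚ.- lo ℚ.* s
    psd′ = subst (0ℚ ℚ.≤_) (Qs.shift-form M lo v) (nonNeg⇒0≤ (psd v))
    product : hi ℚ.≤ lo → 0ℚ ℚ.≤ (lo ℚ.- hi) ℚ.* s
    product hi≤lo = nonNeg⇒0≤ (Qp.NonNeg-* {lo ℚ.- hi} {s}
      (λ p → <⇒≱ (0<⇒< p (solve 2 (λ l h → :- (l :- h) := h :- l) refl lo hi)) hi≤lo) (Qs.NonNeg-·-self v))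

  -- The upper bounds carry vectors on which the shifted form is negative; these vectors witness
  -- later that the form at the limit is not coercive. The limit is represented by the lower bounds,
  -- so that each of its terms gives a semidefinite rational form.
  record Bracketing {n} (M : Fin n → Vector ℚ n) : Set where
    field
      lo hi   : ℕ → ℚ
      lo-psd  : ∀ k → Qf.PSD (Qs.shift M (lo k))
      hi-neg  : ∀ k → Qf.Negative (Qs.shift M (hi k))
      lo-step : ∀ k → lo k ℚ.≤ lo (suc k)
      hi-step : ∀ k → hi (suc k) ℚ.≤ hi k
      halving : ∀ k → hi (suc k) ℚ.- lo (suc k) ≡ ½ ℚ.* (hi k ℚ.- lo k)

    width : ℕ → ℚ
    width k = hi k ℚ.- lo k

    width>0 : ∀ k → 0ℚ ℚ.< width k
    width>0 k = <⇒0< (psd<negative M (lo k) (hi k) (lo-psd k) (hi-neg k))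

    width-small : ∀ {ε} → 0ℚ ℚ.< ε → ∃[ k ] width k ℚ.< ε
    width-small = halving-vanishes width (ℚ.<⇒≤ (width>0 0)) width>0 halving

    lo-mono : ∀ {k m} → k ℕ.≤ m → lo k ℚ.≤ lo m
    lo-mono = monotone lo lo-step

    hi-anti : ∀ k m → k ℕ.≤ m → hi m ℚ.≤ hi k
    hi-anti k m k≤m = subst₂ ℚ._≤_ (-‿involutive (hi m)) (-‿involutive (hi k))
      (ℚ.neg-antimono-≤ (monotone (λ k → ℚ.- hi k) (λ k → ℚ.neg-antimono-≤ (hi-step k)) k≤m))

    lo<hi : ∀ k m → k ℕ.≤ m → lo m ℚ.< hi k
    lo<hi k m k≤m = ℚ.<-≤-trans (psd<negative M (lo m) (hi m) (lo-psd m) (hi-neg m)) (hi-anti k m k≤m)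

    lo-close : ∀ {ε} N → width N ℚ.< ε → ∀ m n → N ℕ.≤ m → N ℕ.≤ n → lo m ℚ.- lo n ℚ.< ε
    lo-close N w<ε m n N≤m N≤n = ℚ.<-trans (ℚ.+-mono-<-≤ (lo<hi N m N≤m) (ℚ.neg-antimono-≤ (lo-mono N≤n))) w<ε

    lo-cauchy : IsCauchy lo
    lo-cauchy ε 0<ε = let N , w<ε = width-small 0<ε in
      N , λ m n N≤m N≤n → dist<-intro (lo m) (lo n) (lo-close N w<ε m n N≤m N≤n) (lo-close N w<ε n m N≤n N≤m)

    limit : ℝ
    limit = mkℝ lo lo-cauchy

  between : ∀ f s l h l₀ → l₀ ℚ.≤ l → 0ℚ ℚ.≤ s → 0ℚ ℚ.< ℚ.- (f ℚ.- h ℚ.* s) → f ℚ.- l ℚ.* s ℚ.< (h ℚ.- l₀) ℚ.* s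
  between f s l h l₀ l₀≤l 0≤s neg = ℚ.<-≤-trans
    (0<⇒< {q = (h ℚ.- l) ℚ.* s} neg (solve 4 (λ f h l s → :- (f :- h :* s) := (h :- l) :* s :- (f :- l :* s)) refl f h l s))
    (ℚ.*-monoʳ-≤-nonNeg s {{ℚ.nonNegative 0≤s}} (ℚ.+-monoʳ-≤ h (ℚ.neg-antimono-≤ l₀≤l)))

  coercion-excess : ∀ {B B⁻¹ w s κ g} → 0ℚ ℚ.< B → B ℚ.* B⁻¹ ≡ 1ℚ → w ℚ.< ½ ℚ.* B⁻¹ → 0ℚ ℚ.< s →
                    0ℚ ℚ.≤ g → g ℚ.< w ℚ.* s → ℚ.∣ κ ∣ ℚ.< B → ½ ℚ.* s ℚ.< ℚ.- (κ ℚ.* g ℚ.- s)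
  coercion-excess {B} {B⁻¹} {w} {s} {κ} {g} 0<B BB⁻¹≡1 w<½B⁻¹ 0<s 0≤g g<ws κ<B =
    0<⇒< (<⇒0< small) (solve 2 (λ x s → con ½ :* s :- x := :- (x :- s) :- con ½ :* s) refl (κ ℚ.* g) s)
    where
    open ℚ.≤-Reasoning
    small : κ ℚ.* g ℚ.< ½ ℚ.* s
    small = begin-strict
      κ ℚ.* g                      ≤⟨ ℚ.*-monoʳ-≤-nonNeg g {{ℚ.nonNegative 0≤g}} (ℚ.≤-trans (p≤∣p∣ κ) (ℚ.<⇒≤ κ<B)) ⟩
      B ℚ.* g                      <⟨ ℚ.*-monoʳ-<-pos B {{ℚ.positive 0<B}} g<ws ⟩
      B ℚ.* (w ℚ.* s)              ≤⟨ ℚ.*-monoˡ-≤-nonNeg B {{ℚ.nonNegative (ℚ.<⇒≤ 0<B)}}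
                                        (ℚ.*-monoʳ-≤-nonNeg s {{ℚ.nonNegative (ℚ.<⇒≤ 0<s)}} (ℚ.<⇒≤ w<½B⁻¹)) ⟩
      B ℚ.* (½ ℚ.* B⁻¹ ℚ.* s)      ≡⟨ solve 3 (λ b c s → b :* (con ½ :* c :* s) := b :* c :* (con ½ :* s)) refl B B⁻¹ s ⟩
      B ℚ.* B⁻¹ ℚ.* (½ ℚ.* s)      ≡⟨ trans (cong (ℚ._* (½ ℚ.* s)) BB⁻¹≡1) (ℚ.*-identityˡ (½ ℚ.* s)) ⟩
      ½ ℚ.* s                      ∎

  seq-excess : ∀ x y z m {g s r} → seq y m ≡ g → seq z m ≡ s → r ℚ.< ℚ.- (seq x m ℚ.* g ℚ.- s) →
               r ℚ.< seq (⊖ (x ⊗ y ⊕ ⊖ z)) m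
  seq-excess x y z m {r = r} refl refl = subst (r ℚ.<_) (sym (trans (seq-⊖ (x ⊗ y ⊕ ⊖ z) m)
    (cong ℚ.-_ (trans (seq-⊕ (x ⊗ y) (⊖ z) m) (cong₂ ℚ._+_ (seq-⊗ x y m) (seq-⊖ z m))))))

  private module R = OrderedField ℝ-orderedField

  eigen-difference : ∀ x a l ν v → x ≃ a ⊕ (⊖ l) ⊗ v → a ≃ ν ⊗ v → x ≃ (ν ⊕ ⊖ l) ⊗ v
  eigen-difference x a l ν v x≃ a≃ = ≃-trans x (a ⊕ (⊖ l) ⊗ v) ((ν ⊕ ⊖ l) ⊗ v) x≃
    (≃-trans (a ⊕ (⊖ l) ⊗ v) (ν ⊗ v ⊕ (⊖ l) ⊗ v) ((ν ⊕ ⊖ l) ⊗ v)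
      (R.+-congʳ {(⊖ l) ⊗ v} {a} {ν ⊗ v} a≃) (≃-sym ((ν ⊕ ⊖ l) ⊗ v) (ν ⊗ v ⊕ (⊖ l) ⊗ v) (R.distribʳ v ν (⊖ l))))

  eigen-kernel : ∀ x a l v → x ≃ 0ℝ → x ≃ a ⊕ (⊖ l) ⊗ v → ∀ a′ → (∀ m → seq a′ m ≡ seq a m) → a′ ≃ l *ℝ v
  eigen-kernel x a l v x≃0 x≃ a′ a′≡a = null-ext
    {λ m → (seq x m ℚ.- 0ℚ) ℚ.+ ℚ.- (seq x m ℚ.- seq (a ⊕ (⊖ l) ⊗ v) m)}
    (λ m → trans (cong (λ z → (seq x m ℚ.- 0ℚ) ℚ.+ ℚ.- (seq x m ℚ.- z)) (unfold m))
      (solve 4 (λ x a l v → (x :- con 0ℚ) :+ :- (x :- (a :+ (:- l) :* v)) := a :- l :* v) refl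
        (seq x m) (seq a′ m) (seq l m) (seq v m)))
    (null-+ x≃0 (null-neg x≃))
    where
    unfold : ∀ m → seq (a ⊕ (⊖ l) ⊗ v) m ≡ seq a′ m ℚ.+ (ℚ.- seq l m) ℚ.* seq v m
    unfold m = trans (seq-⊕ a ((⊖ l) ⊗ v) m) (cong₂ ℚ._+_ (sym (a′≡a m))
      (trans (seq-⊗ (⊖ l) v m) (cong (ℚ._* seq v m) (seq-⊖ l m))))

  neg-product : ∀ f d s → f ≃ d ⊗ s → (⊖ d) ⊗ s ≃ ⊖ f
  neg-product f d s f≃ds = ≃-trans ((⊖ d) ⊗ s) (⊖ (d ⊗ s)) (⊖ f)
    (≃-sym (⊖ (d ⊗ s)) ((⊖ d) ⊗ s) (-‿distribˡ-* d s)) (R.-‿cong {d ⊗ s} {f} (≃-sym f (d ⊗ s) f≃ds))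
    where open import Algebra.Properties.Ring R.ring using (-‿distribˡ-*)

  eventually-≤ : ∀ l ν → Rp.NonNeg (ν ⊕ ⊖ l) → l ≤ℝ ν
  eventually-≤ l ν d≥0 ε 0<ε = eventually
    (λ m p → ℚ.≮⇒≥ λ q → <⇒≱ (0<⇒< (<⇒0< q) (solve 3 (λ l e v → l :- (v :+ e) := :- e :- (v :- l)) refl (seq l m) ε (seq ν m)))
      (subst (ℚ.- ε ℚ.≤_) (trans (seq-⊕ ν (⊖ l) m) (cong (seq ν m ℚ.+_) (seq-⊖ l m))) p))
    (nonNegℝ⇒eventually (ν ⊕ ⊖ l) d≥0 ε 0<ε)

  module Spectrum {n} (M : Fin n → Vector ℚ n) (M-sym : Qf.Symmetric M) (bracketing : Bracketing M)
                  (A : Matrix n) (A≡M : ∀ i j → A i j ≡ fromℚ (M i j)) where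
    open Bracketing bracketing

    S : Fin n → Vector ℝ n
    S = Rs.shift A limit

    S-sym : Rf.Symmetric S
    S-sym = Rs.shift-sym {M = A} limit λ i j → ≡⇒≃ (A i j) (A j i) λ m →
      trans (cong (λ z → seq z m) (A≡M i j)) (trans (M-sym i j) (sym (cong (λ z → seq z m) (A≡M j i))))

    seq-S : ∀ m i j → seq (S i j) m ≡ Qs.shift M (lo m) i j
    seq-S m i j = trans (seq-⊕ (A i j) (⊖ limit ⊗ Rs.identity i j) m) (cong₂ (λ y z → y ℚ.+ z) (cong (λ z → seq z m) (A≡M i j))
      (trans (seq-⊗ (⊖ limit) (Rs.identity i j) m) (cong₂ (λ y z → y ℚ.* z) (seq-⊖ limit m) (seq-identity m i j))))

    seq-form : ∀ m v → seq (Rf.form S v) m ≡ Qf.form (Qs.shift M (lo m)) (λ i → seq (v i) m)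
    seq-form m v = seq-· m v (S Rf.·ᴹ v) (λ i → seq (v i) m) (Qs.shift M (lo m) Qf.·ᴹ (λ i → seq (v i) m)) (λ _ → refl)
      λ i → seq-· m (S i) v (Qs.shift M (lo m) i) (λ i → seq (v i) m) (seq-S m i) λ _ → refl

    -- The real form is computed termwise: its m-th term is the rational form of M - lo m I at the
    -- m-th terms of the vector, hence non-negative at every single index.
    limit-psd : Rf.PSD S
    limit-psd v (ε , 0<ε , N , p) = lo-psd N (λ i → seq (v i) N)
      (subst (0ℚ ℚ.<_) (trans (seq-⊖ (Rf.form S v) N) (cong ℚ.-_ (seq-form N v))) (ℚ.<-trans 0<ε (p N ℕ.≤-refl)))

    form-between : ∀ l h l₀ u → l₀ ℚ.≤ l → 0ℚ ℚ.< ℚ.- Qf.form (Qs.shift M h) u →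
                   Qf.form (Qs.shift M l) u ℚ.< (h ℚ.- l₀) ℚ.* (u Qf.· u)
    form-between l h l₀ u l₀≤l neg = subst (ℚ._< (h ℚ.- l₀) ℚ.* (u Qf.· u)) (sym (Qs.shift-form M l u))
      (between (Qf.form M u) (u Qf.· u) l h l₀ l₀≤l (nonNeg⇒0≤ (Qs.NonNeg-·-self u))
        (subst (λ z → 0ℚ ℚ.< ℚ.- z) (Qs.shift-form M h u) neg))

    product-pos : ∀ h u → 0ℚ ℚ.< ℚ.- Qf.form (Qs.shift M h) u → 0ℚ ℚ.< u Qf.· u
    product-pos h u neg with Qf.zero-or-pos u
    ... | inj₂ uu>0 = uu>0
    ... | inj₁ u≡0  = ⊥-elim (ℚ.<-irrefl refl (subst (λ z → 0ℚ ℚ.< ℚ.- z) (Qf.·-zeroˡ {u = u} (Qs.shift M h Qf.·ᴹ u) u≡0) neg))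

    -- Let `u` be negative for M - hi k I. For m ≥ k, the form of M - lo m I at `u` is below
    -- `width k` times u · u. If `B` bounds the coercivity constant and `width k` < 1/(2 B), then
    -- the constant times the form stays below half of u · u, against coercivity.
    limit-not-coercive : ¬ Rf.Coercive S
    limit-not-coercive coercive =
      let K , bound = normed
          B , 0<B , N , K<B = bounded K
          B⁻¹ , 0<B⁻¹ , BB⁻¹≡1 = pos-inverse 0<B
          k , w<½B⁻¹ = width-small (half-pos 0<B⁻¹)
          u , neg = hi-neg k
      in refute K bound N 0<B K<B BB⁻¹≡1 k w<½B⁻¹ u neg
      where
      normed : ∃[ K ] (∀ v → Rp.NonNeg (K ⊗ Rf.form S v ⊕ ⊖ (v Rf.· v)))
      normed = Rs.coercive-norm S coercive

      refute : ∀ K → (∀ v → Rp.NonNeg (K ⊗ Rf.form S v ⊕ ⊖ (v Rf.· v))) →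
               ∀ {B B⁻¹} N → 0ℚ ℚ.< B → (∀ m → N ℕ.≤ m → ℚ.∣ seq K m ∣ ℚ.< B) → B ℚ.* B⁻¹ ≡ 1ℚ →
               ∀ k → width k ℚ.< ½ ℚ.* B⁻¹ → ∀ u → 0ℚ ℚ.< ℚ.- Qf.form (Qs.shift M (hi k)) u → ⊥
      refute K bound {B} {B⁻¹} N 0<B K<B BB⁻¹≡1 k w<½B⁻¹ u neg = bound v (½ ℚ.* s , half-pos 0<s , N ⊔ k , excess)
        where
        v : Vector ℝ n
        v i = fromℚ (u i)
        s : ℚ
        s = u Qf.· u
        0<s : 0ℚ ℚ.< s
        0<s = product-pos (hi k) u neg
        g : ℕ → ℚ
        g m = Qf.form (Qs.shift M (lo m)) u
        excess : ∀ m → N ⊔ k ℕ.≤ m → ½ ℚ.* s ℚ.< seq (⊖ (K ⊗ Rf.form S v ⊕ ⊖ (v Rf.· v))) m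
        excess m N⊔k≤m = seq-excess K (Rf.form S v) (v Rf.· v) m {g m} {s} {½ ℚ.* s} (seq-form m v) (seq-· m v v u u (λ _ → refl) (λ _ → refl))
          (coercion-excess {B} {B⁻¹} {width k} {s} {seq K m} {g m} 0<B BB⁻¹≡1 w<½B⁻¹ 0<s (nonNeg⇒0≤ (lo-psd m u))
            (form-between (lo m) (hi k) (lo k) u (lo-mono (ℕ.m⊔n≤o⇒n≤o N k N⊔k≤m)) neg)
            (K<B m (ℕ.m⊔n≤o⇒m≤o N k N⊔k≤m)))

    -- At an eigenvector `u` for `ν` the form of `S` is (ν - limit)(u · u). Only the negation of ν <
    -- limit is derived from `limit-psd`; `eventually-≤` upgrades it to `_≤ℝ_`.
    limit-minimal : ∀ ν → IsEigenvalue A ν → limit ≤ℝ ν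
    limit-minimal ν (u , u≄0 , Au≃νu) = eventually-≤ limit ν λ d<0 → Rf.zero-or-pos u λ
      { (inj₁ u≃0)  → u≄0 u≃0
      ; (inj₂ uu>0) → limit-psd u (Positive-resp ((⊖ d) ⊗ uu) (⊖ Rf.form S u)
          (neg-product (Rf.form S u) d uu form≃) (Positive-⊗ (⊖ d) uu d<0 uu>0)) }
      where
      d uu : ℝ
      d = ν ⊕ ⊖ limit
      uu = u Rf.· u
      Au≃ : ∀ i → (A Rf.·ᴹ u) i ≃ ν ⊗ u i
      Au≃ i = null-ext (λ m → cong₂ (λ y z → y ℚ.- z) (∑-· (A i) u m) (sym (seq-⊗ ν (u i) m))) (Au≃νu i)
      mul : ∀ i → (S Rf.·ᴹ u) i ≃ d ⊗ u i
      mul i = eigen-difference ((S Rf.·ᴹ u) i) ((A Rf.·ᴹ u) i) limit ν (u i) (Rs.shift-mul A limit u i) (Au≃ i)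
      form≃ : Rf.form S u ≃ d ⊗ uu
      form≃ = ≃-trans (Rf.form S u) (u Rf.· (λ i → d ⊗ u i)) (d ⊗ uu)
        (Rf.·-cong {u = u} {u′ = u} {v = S Rf.·ᴹ u} {v′ = λ i → d ⊗ u i} (λ i → ≡⇒≃ (u i) (u i) λ _ → refl) mul) (Rf.·-scaleʳ d u u)

    limit-eigenvalue : Rf.Singular S → IsEigenvalue A limit
    limit-eigenvalue (v , vv>0 , Sv≃0) = v , nonzero ,
      λ i → eigen-kernel ((S Rf.·ᴹ v) i) ((A Rf.·ᴹ v) i) limit (v i) (Sv≃0 i) (Rs.shift-mul A limit v i)
              (∑ (λ j → A i j *ℝ v j)) (∑-· (A i) v)
      where
      nonzero : ¬ (∀ i → v i ≃ 0ℝ)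
      nonzero v≃0 = ¬Positive-0 (Positive-resp (v Rf.· v) 0ℝ (Rf.·-zeroˡ {u = v} v v≃0) vv>0)

    limit-smallest : ¬ ¬ IsSmallestEigenvalue A limit
    limit-smallest k = Rf.classify S S-sym λ
      { (inj₁ (v , neg))            → limit-psd v neg
      ; (inj₂ (_ , inj₁ singular)) → k (limit-eigenvalue singular , limit-minimal)
      ; (inj₂ (_ , inj₂ coercive)) → limit-not-coercive coercive }

  module Bisection {n} (M : Fin n → Vector ℚ n) (M-sym : Qf.Symmetric M)
                   (top : ℚ) (top-negative : Qf.Negative (Qs.shift M top)) where

    State : Set
    State = ∃[ lo ] ∃[ hi ] (Qf.PSD (Qs.shift M lo) × Qf.Negative (Qs.shift M hi))

    lower upper : State → ℚ
    lower (lo , _) = lo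
    upper (_ , hi , _) = hi

    middle : State → ℚ
    middle s = ½ ℚ.* (lower s ℚ.+ upper s)

    lower<upper : ∀ s → lower s ℚ.< upper s
    lower<upper (lo , hi , psd , neg) = psd<negative M lo hi psd neg

    select : (s : State) → Qf.Classification (Qs.shift M (middle s)) → State
    select s@(lo , hi , psd , neg) (inj₁ neg′)       = lo , middle s , psd , neg′
    select s@(lo , hi , psd , neg) (inj₂ (psd′ , _)) = middle s , hi , psd′ , neg

    classified : (s : State) → Qf.Classification (Qs.shift M (middle s))
    classified s = Qf.classify (Qs.shift M (middle s)) (Qs.shift-sym (middle s) M-sym)

    state : ℕ → State
    state zero    = let lo , psd = Qs.lower-bound M in lo , top , psd , top-negative
    state (suc k) = select (state k) (classified (state k))

    middle-halves : ∀ s → lower s ℚ.≤ middle s × middle s ℚ.≤ upper s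
    middle-halves s = ℚ.<⇒≤ (0<⇒< (half-pos gap) (solve 2 (λ l h → con ½ :* (h :- l) := con ½ :* (l :+ h) :- l) refl (lower s) (upper s)))
                    , ℚ.<⇒≤ (0<⇒< (half-pos gap) (solve 2 (λ l h → con ½ :* (h :- l) := h :- con ½ :* (l :+ h)) refl (lower s) (upper s)))
      where
      gap : 0ℚ ℚ.< upper s ℚ.- lower s
      gap = <⇒0< (lower<upper s)

    select-lower : ∀ s c → lower s ℚ.≤ lower (select s c)
    select-lower s (inj₁ _) = ℚ.≤-refl
    select-lower s (inj₂ _) = proj₁ (middle-halves s)

    select-upper : ∀ s c → upper (select s c) ℚ.≤ upper s
    select-upper s (inj₁ _) = proj₂ (middle-halves s)
    select-upper s (inj₂ _) = ℚ.≤-refl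

    select-width : ∀ s c → upper (select s c) ℚ.- lower (select s c) ≡ ½ ℚ.* (upper s ℚ.- lower s)
    select-width s (inj₁ _) = solve 2 (λ l h → con ½ :* (l :+ h) :- l := con ½ :* (h :- l)) refl (lower s) (upper s)
    select-width s (inj₂ _) = solve 2 (λ l h → h :- con ½ :* (l :+ h) := con ½ :* (h :- l)) refl (lower s) (upper s)

    bracketing : Bracketing M
    bracketing = record
      { lo       = λ k → lower (state k)
      ; hi       = λ k → upper (state k)
      ; lo-psd   = λ k → proj₁ (proj₂ (proj₂ (state k)))
      ; hi-neg   = λ k → proj₂ (proj₂ (proj₂ (state k)))
      ; lo-step  = λ k → select-lower (state k) (classified (state k))
      ; hi-step  = λ k → select-upper (state k) (classified (state k))
      ; halving  = λ k → select-width (state k) (classified (state k)) }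

  shift-excess : ∀ f c s w → (1ℚ ℚ.+ s) ℚ.* w ≡ 1ℚ →
                 (ℚ.- (f ℚ.- c ℚ.* s)) ℚ.* w ≡ ℚ.- (f ℚ.- (c ℚ.- (ℚ.- (f ℚ.- c ℚ.* s)) ℚ.* w) ℚ.* s)
  shift-excess f c s w sw≡1 = begin
    P ℚ.* w                                             ≡⟨ solve 3 (λ p w s → p :* w := p :* ((con 1ℚ :+ s) :* w) :- p :* w :* s) refl P w s ⟩
    P ℚ.* ((1ℚ ℚ.+ s) ℚ.* w) ℚ.- P ℚ.* w ℚ.* s          ≡⟨ cong (λ z → P ℚ.* z ℚ.- P ℚ.* w ℚ.* s) sw≡1 ⟩
    P ℚ.* 1ℚ ℚ.- P ℚ.* w ℚ.* s                          ≡⟨ solve 4 (λ f c s e → :- (f :- c :* s) :* con 1ℚ :- e :* s := :- (f :- (c :- e) :* s)) refl f c s (P ℚ.* w) ⟩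
    ℚ.- (f ℚ.- (c ℚ.- P ℚ.* w) ℚ.* s)                   ∎
    where
    open ≡-Reasoning
    P : ℚ
    P = ℚ.- (f ℚ.- c ℚ.* s)

  -- The witness is ε = - form / (1 + v · v).
  negative-below : ∀ {n} (M : Fin n → Vector ℚ n) c v → 0ℚ ℚ.< ℚ.- Qf.form (Qs.shift M c) v →
                   ∃[ ε ] (0ℚ ℚ.< ε × 0ℚ ℚ.< ℚ.- Qf.form (Qs.shift M (c ℚ.- ε)) v)
  negative-below M c v neg = P ℚ.* w , pos*pos 0<P 0<w ,
    subst (0ℚ ℚ.<_) (trans (shift-excess f c s w sw≡1) (cong ℚ.-_ (sym (Qs.shift-form M (c ℚ.- P ℚ.* w) v)))) (pos*pos 0<P 0<w)
    where
    f s P w : ℚ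
    f = Qf.form M v
    s = v Qf.· v
    P = ℚ.- (f ℚ.- c ℚ.* s)
    0<P : 0ℚ ℚ.< P
    0<P = subst (λ z → 0ℚ ℚ.< ℚ.- z) (Qs.shift-form M c v) neg
    inv : ∃[ w ] (0ℚ ℚ.< w × (1ℚ ℚ.+ s) ℚ.* w ≡ 1ℚ)
    inv = pos-inverse (ℚ.+-mono-<-≤ 0<1 (nonNeg⇒0≤ (Qs.NonNeg-·-self v)))
    w = proj₁ inv
    0<w : 0ℚ ℚ.< w
    0<w = proj₁ (proj₂ inv)
    sw≡1 : (1ℚ ℚ.+ s) ℚ.* w ≡ 1ℚ
    sw≡1 = proj₂ (proj₂ inv)

  -- A vector negative at `c` is still negative at c - ε, so bisection can start from the top c - ε.
  -- All its lower bounds lie below c - ε, which contradicts the assumed bound on the smallest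
  -- eigenvalue. The eigenvalue exists only up to double negation, which is harmless as the goal is
  -- `⊥`.
  smallestEigenvalue-psd : ∀ {n} (M : Fin n → Vector ℚ n) → Qf.Symmetric M →
    (A : Matrix n) → (∀ i j → A i j ≡ fromℚ (M i j)) →
    ∀ c → (∀ μ → IsSmallestEigenvalue A μ → fromℚ c ≤ℝ μ) → Qf.PSD (Qs.shift M c)
  smallestEigenvalue-psd {n} M M-sym A A≡M c bound v neg =
    let ε , 0<ε , neg′ = negative-below M c v neg in
    Spectrum.limit-smallest M M-sym (Bisection.bracketing M M-sym (c ℚ.- ε) (v , neg′)) A A≡M λ smallest →
      impossible (Bisection.bracketing M M-sym (c ℚ.- ε) (v , neg′)) ε 0<ε ℚ.≤-refl (bound (Bracketing.limit (Bisection.bracketing M M-sym (c ℚ.- ε) (v , neg′))) smallest)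
    where
    impossible : ∀ (b : Bracketing M) ε → 0ℚ ℚ.< ε → Bracketing.hi b 0 ℚ.≤ c ℚ.- ε → ¬ fromℚ c ≤ℝ Bracketing.limit b
    impossible b ε 0<ε hi≤ c≤limit = let N , p = c≤limit ε 0<ε in
      <⇒≱ (below c ε (lo N) (ℚ.<-≤-trans (lo<hi 0 N ℕ.z≤n) hi≤)) (p N ℕ.≤-refl)
      where
      open Bracketing b using (lo; lo<hi)
      below : ∀ c ε l → l ℚ.< c ℚ.- ε → l ℚ.+ ε ℚ.< c
      below c ε l l<c-ε = 0<⇒< (<⇒0< l<c-ε) (solve 3 (λ c e l → c :- e :- l := c :- (l :+ e)) refl c ε l)

-- Sums over lists and bilinear forms with natural values.

module ListSums where

  open import Data.List.Base using (List; []; _∷_; _++_; length; concat; replicate)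
  open import Data.List.Membership.Propositional using (_∈_)
  open import Data.List.Relation.Unary.Any using (here; there)
  open import Data.Nat.Base using (ℕ; zero; suc; _+_; _*_; _≤_; z≤n)
  open import Data.Nat.Properties
  open import Data.Nat.Tactic.RingSolver using (solve-∀)
  open import Function.Base using (_∘_)
  open import Relation.Binary.PropositionalEquality

  private
    variable
      A B : Set

  ∑ₗ : (A → ℕ) → List A → ℕ
  ∑ₗ f []       = 0
  ∑ₗ f (x ∷ xs) = f x + ∑ₗ f xs

  ∑ₗ-++ : ∀ (f : A → ℕ) xs ys → ∑ₗ f (xs ++ ys) ≡ ∑ₗ f xs + ∑ₗ f ys
  ∑ₗ-++ f []       ys = refl
  ∑ₗ-++ f (x ∷ xs) ys = trans (cong (f x +_) (∑ₗ-++ f xs ys)) (sym (+-assoc (f x) (∑ₗ f xs) (∑ₗ f ys)))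

  ∑ₗ-mono : ∀ {f g : A → ℕ} xs → (∀ {x} → x ∈ xs → f x ≤ g x) → ∑ₗ f xs ≤ ∑ₗ g xs
  ∑ₗ-mono []       f≤g = z≤n
  ∑ₗ-mono (x ∷ xs) f≤g = +-mono-≤ (f≤g (here refl)) (∑ₗ-mono xs (f≤g ∘ there))

  ∑ₗ-cong : ∀ {f g : A → ℕ} xs → (∀ {x} → x ∈ xs → f x ≡ g x) → ∑ₗ f xs ≡ ∑ₗ g xs
  ∑ₗ-cong xs f≡g = ≤-antisym (∑ₗ-mono xs (≤-reflexive ∘ f≡g)) (∑ₗ-mono xs (≤-reflexive ∘ sym ∘ f≡g))

  ∑ₗ-const : ∀ k (xs : List A) → ∑ₗ (λ _ → k) xs ≡ length xs * k
  ∑ₗ-const k []       = refl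
  ∑ₗ-const k (x ∷ xs) = cong (k +_) (∑ₗ-const k xs)

  ∑ₗ-upper : ∀ {f : A → ℕ} {k} xs → (∀ {x} → x ∈ xs → f x ≤ k) → ∑ₗ f xs ≤ length xs * k
  ∑ₗ-upper {f = f} {k} xs f≤k = subst (∑ₗ f xs ≤_) (∑ₗ-const k xs) (∑ₗ-mono xs f≤k)

  ∑ₗ-lower : ∀ {f : A → ℕ} {k} xs → (∀ {x} → x ∈ xs → k ≤ f x) → length xs * k ≤ ∑ₗ f xs
  ∑ₗ-lower {f = f} {k} xs k≤f = subst (_≤ ∑ₗ f xs) (∑ₗ-const k xs) (∑ₗ-mono xs k≤f)

  ∑ₗ-+ : ∀ (f g : A → ℕ) xs → ∑ₗ (λ x → f x + g x) xs ≡ ∑ₗ f xs + ∑ₗ g xs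
  ∑ₗ-+ f g []       = refl
  ∑ₗ-+ f g (x ∷ xs) = trans (cong (f x + g x +_) (∑ₗ-+ f g xs)) (interchange (f x) (g x) (∑ₗ f xs) (∑ₗ g xs))
    where
    interchange : ∀ a b c d → a + b + (c + d) ≡ a + c + (b + d)
    interchange = solve-∀

  ∑ₗ-* : ∀ k (f : A → ℕ) xs → ∑ₗ (λ x → k * f x) xs ≡ k * ∑ₗ f xs
  ∑ₗ-* k f []       = sym (*-zeroʳ k)
  ∑ₗ-* k f (x ∷ xs) = trans (cong (k * f x +_) (∑ₗ-* k f xs)) (sym (*-distribˡ-+ k (f x) (∑ₗ f xs)))

  ∑ₗ-swap : ∀ (f : A → B → ℕ) xs ys → ∑ₗ (λ x → ∑ₗ (f x) ys) xs ≡ ∑ₗ (λ y → ∑ₗ (λ x → f x y) xs) ys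
  ∑ₗ-swap f []       ys = sym (trans (∑ₗ-const 0 ys) (*-zeroʳ (length ys)))
  ∑ₗ-swap f (x ∷ xs) ys = trans (cong (∑ₗ (f x) ys +_) (∑ₗ-swap f xs ys)) (sym (∑ₗ-+ (f x) (λ y → ∑ₗ (λ x → f x y) xs) ys))

  infixr 7 _⋆_

  -- Lists stand for vectors of natural numbers, each entry counted with its multiplicity: `_++_` is
  -- addition and `_⋆_` is scalar multiplication.
  _⋆_ : ℕ → List A → List A
  k ⋆ xs = concat (replicate k xs)

  ∑ₗ-⋆ : ∀ k (f : A → ℕ) xs → ∑ₗ f (k ⋆ xs) ≡ k * ∑ₗ f xs
  ∑ₗ-⋆ zero    f xs = refl
  ∑ₗ-⋆ (suc k) f xs = trans (∑ₗ-++ f xs (k ⋆ xs)) (cong (∑ₗ f xs +_) (∑ₗ-⋆ k f xs))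

  module Bilinear (f : A → A → ℕ) where

    ⟪_,_⟫ : List A → List A → ℕ
    ⟪ xs , ys ⟫ = ∑ₗ (λ x → ∑ₗ (f x) ys) xs

    ++-left : ∀ xs ys zs → ⟪ xs ++ ys , zs ⟫ ≡ ⟪ xs , zs ⟫ + ⟪ ys , zs ⟫
    ++-left xs ys zs = ∑ₗ-++ (λ x → ∑ₗ (f x) zs) xs ys

    ⋆-left : ∀ k xs ys → ⟪ k ⋆ xs , ys ⟫ ≡ k * ⟪ xs , ys ⟫
    ⋆-left k xs ys = ∑ₗ-⋆ k (λ x → ∑ₗ (f x) ys) xs

    single : ∀ x ys → ⟪ x ∷ [] , ys ⟫ ≡ ∑ₗ (f x) ys
    single x ys = +-identityʳ _

    module _ (f-sym : ∀ x y → f x y ≡ f y x) where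

      symmetric : ∀ xs ys → ⟪ xs , ys ⟫ ≡ ⟪ ys , xs ⟫
      symmetric xs ys = trans (∑ₗ-swap f xs ys) (∑ₗ-cong ys λ {y} _ → ∑ₗ-cong xs λ {x} _ → f-sym x y)

      ++-right : ∀ xs ys zs → ⟪ xs , ys ++ zs ⟫ ≡ ⟪ xs , ys ⟫ + ⟪ xs , zs ⟫
      ++-right xs ys zs = trans (symmetric xs (ys ++ zs)) (trans (++-left ys zs xs) (cong₂ _+_ (symmetric ys xs) (symmetric zs xs)))

      ⋆-right : ∀ k xs ys → ⟪ xs , k ⋆ ys ⟫ ≡ k * ⟪ xs , ys ⟫
      ⋆-right k xs ys = trans (symmetric xs (k ⋆ ys)) (trans (⋆-left k ys xs) (cong (k *_) (symmetric ys xs)))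

      -- Semidefiniteness at P - Q, with the mixed terms moved across so that everything stays in
      -- `ℕ`. Every integer vector is such a difference.
      Positive : Set
      Positive = ∀ P Q → 2 * ⟪ P , Q ⟫ ≤ ⟪ P , P ⟫ + ⟪ Q , Q ⟫

      -- Positivity at a X + b Y - c Z, with the negative part moved to the left.
      positive₃ : Positive → ∀ a b c X Y Z →
        2 * (a * c * ⟪ X , Z ⟫ + b * c * ⟪ Y , Z ⟫) ≤
        a * a * ⟪ X , X ⟫ + 2 * (a * b * ⟪ X , Y ⟫) + b * b * ⟪ Y , Y ⟫ + c * c * ⟪ Z , Z ⟫
      positive₃ pos a b c X Y Z = subst₂ _≤_ left right (pos P Q)
        where
        P Q : List A
        P = a ⋆ X ++ b ⋆ Y
        Q = c ⋆ Z
        scale : ∀ a b X Y → ⟪ a ⋆ X , b ⋆ Y ⟫ ≡ a * (b * ⟪ X , Y ⟫)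
        scale a b X Y = trans (⋆-left a X (b ⋆ Y)) (cong (a *_) (⋆-right b X Y))
        left : 2 * ⟪ P , Q ⟫ ≡ 2 * (a * c * ⟪ X , Z ⟫ + b * c * ⟪ Y , Z ⟫)
        left = cong (2 *_) (trans (++-left (a ⋆ X) (b ⋆ Y) Q) (cong₂ _+_
          (trans (scale a c X Z) (sym (*-assoc a c _))) (trans (scale b c Y Z) (sym (*-assoc b c _)))))
        expand : ∀ U V W → ⟪ U ++ V , W ⟫ ≡ ⟪ W , U ⟫ + ⟪ W , V ⟫
        expand U V W = trans (symmetric (U ++ V) W) (++-right W U V)
        right : ⟪ P , P ⟫ + ⟪ Q , Q ⟫ ≡ a * a * ⟪ X , X ⟫ + 2 * (a * b * ⟪ X , Y ⟫) + b * b * ⟪ Y , Y ⟫ + c * c * ⟪ Z , Z ⟫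
        right = trans (cong₂ _+_ (trans (++-left (a ⋆ X) (b ⋆ Y) P) (cong₂ _+_ (++-right (a ⋆ X) (a ⋆ X) (b ⋆ Y)) (++-right (b ⋆ Y) (a ⋆ X) (b ⋆ Y)))) (scale c c Z Z))
          (trans (cong₂ (λ p q → p + q + c * (c * ⟪ Z , Z ⟫))
            (cong₂ _+_ (scale a a X X) (scale a b X Y))
            (cong₂ _+_ (trans (scale b a Y X) (cong (λ z → b * (a * z)) (symmetric Y X))) (scale b b Y Y)))
            (collect a b c ⟪ X , X ⟫ ⟪ X , Y ⟫ ⟪ Y , Y ⟫ ⟪ Z , Z ⟫))
          where
          collect : ∀ a b c p q r s → a * (a * p) + a * (b * q) + (b * (a * q) + b * (b * r)) + c * (c * s) ≡
                    a * a * p + 2 * (a * b * q) + b * b * r + c * c * s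
          collect = solve-∀

-- The form A + (t + 1) I on integer vectors.

module AdjacencyForm where

  open NaturalEmbedding
  open SmallestEigenvalue
  open ListSums
  open import Defs
  open import Data.Bool.Base using (Bool; true; false; if_then_else_)
  open import Data.Empty using (⊥-elim)
  open import Data.Fin.Base using (Fin)
  open import Data.Fin.Properties using (_≟_)
  import Data.Integer.Base as ℤ
  import Data.Integer.Properties as ℤ
  open import Data.List.Base using (List; []; _∷_)
  open import Data.Nat.Base using (ℕ; suc; _+_; _*_)
  import Data.Nat.Properties as ℕ
  open import Data.Rational.Base as ℚ using (ℚ; 0ℚ; 1ℚ; _/_)
  import Data.Rational.Properties as ℚ
  open import Data.Rational.Solver using (module +-*-Solver)
  open import Data.Vec.Functional using (Vector)
  open import Relation.Binary.PropositionalEquality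
  open import Relation.Nullary.Decidable using (does; yes; no)

  open +-*-Solver using (solve; _:=_; _:+_; _:*_; _:-_; :-_; con)

  module _ {n} (S : Fin n → Vector ℚ n) (b : Fin n → Fin n → ℕ) (S≡b : ∀ i j → S i j ≡ φ (b i j)) where
    open Bilinear b

    multiplicity : List (Fin n) → Vector ℚ n
    multiplicity []       _ = 0ℚ
    multiplicity (x ∷ xs) i = Qs.identity x i ℚ.+ multiplicity xs i

    ·-distribʳ : ∀ (u v w : Vector ℚ n) → (λ i → u i ℚ.+ v i) Qf.· w ≡ u Qf.· w ℚ.+ v Qf.· w
    ·-distribʳ u v w = trans (Qf.·-comm (λ i → u i ℚ.+ v i) w) (trans (Qf.·-distribˡ w u v) (cong₂ (λ x y → x ℚ.+ y) (Qf.·-comm w u) (Qf.·-comm w v)))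

    multiplicity-· : ∀ xs w g → (∀ i → w i ≡ φ (g i)) → multiplicity xs Qf.· w ≡ φ (∑ₗ g xs)
    multiplicity-· []       w g w≡g = trans (Qf.·-zeroˡ {u = λ _ → 0ℚ} w (λ _ → refl)) (sym φ-0)
    multiplicity-· (x ∷ xs) w g w≡g = trans (·-distribʳ (Qs.identity x) (multiplicity xs) w)
      (trans (cong₂ (λ y z → y ℚ.+ z) (trans (Qs.identity-· w x) (w≡g x)) (multiplicity-· xs w g w≡g)) (sym (φ-+ (g x) (∑ₗ g xs))))

    bilinear : ∀ xs ys → multiplicity xs Qf.· (S Qf.·ᴹ multiplicity ys) ≡ φ ⟪ xs , ys ⟫
    bilinear xs ys = multiplicity-· xs (S Qf.·ᴹ multiplicity ys) (λ x → ∑ₗ (b x) ys) λ x →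
      trans (Qf.·-comm (S x) (multiplicity ys)) (multiplicity-· ys (S x) (b x) (S≡b x))

    difference-form : ∀ u v → Qf.form S (λ i → u i ℚ.+ (ℚ.- 1ℚ) ℚ.* v i) ≡
      (u Qf.· (S Qf.·ᴹ u) ℚ.+ v Qf.· (S Qf.·ᴹ v)) ℚ.- (u Qf.· (S Qf.·ᴹ v) ℚ.+ v Qf.· (S Qf.·ᴹ u))
    difference-form u v = begin
      w Qf.· (S Qf.·ᴹ w)
        ≡⟨ Qf.·-cong {u = w} {u′ = w} (λ _ → refl) (λ i → half (S i) u v) ⟩
      w Qf.· (λ i → (S Qf.·ᴹ u) i ℚ.+ (ℚ.- 1ℚ) ℚ.* (S Qf.·ᴹ v) i)
        ≡⟨ half w (S Qf.·ᴹ u) (S Qf.·ᴹ v) ⟩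
      w Qf.· (S Qf.·ᴹ u) ℚ.+ (ℚ.- 1ℚ) ℚ.* (w Qf.· (S Qf.·ᴹ v))
        ≡⟨ cong₂ (λ x y → x ℚ.+ (ℚ.- 1ℚ) ℚ.* y) (half′ (S Qf.·ᴹ u)) (half′ (S Qf.·ᴹ v)) ⟩
      (uu ℚ.+ (ℚ.- 1ℚ) ℚ.* vu) ℚ.+ (ℚ.- 1ℚ) ℚ.* (uv ℚ.+ (ℚ.- 1ℚ) ℚ.* vv)
        ≡⟨ solve 4 (λ uu uv vu vv → (uu :+ con (ℚ.- 1ℚ) :* vu) :+ con (ℚ.- 1ℚ) :* (uv :+ con (ℚ.- 1ℚ) :* vv) := (uu :+ vv) :- (uv :+ vu)) refl uu uv vu vv ⟩
      (uu ℚ.+ vv) ℚ.- (uv ℚ.+ vu) ∎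
      where
      open ≡-Reasoning
      w : Vector ℚ n
      w i = u i ℚ.+ (ℚ.- 1ℚ) ℚ.* v i
      uu uv vu vv : ℚ
      uu = u Qf.· (S Qf.·ᴹ u)
      uv = u Qf.· (S Qf.·ᴹ v)
      vu = v Qf.· (S Qf.·ᴹ u)
      vv = v Qf.· (S Qf.·ᴹ v)
      half : ∀ z x y → z Qf.· (λ i → x i ℚ.+ (ℚ.- 1ℚ) ℚ.* y i) ≡ z Qf.· x ℚ.+ (ℚ.- 1ℚ) ℚ.* (z Qf.· y)
      half z x y = trans (Qf.·-distribˡ z x (λ i → (ℚ.- 1ℚ) ℚ.* y i)) (cong (λ a → z Qf.· x ℚ.+ a) (Qf.·-scaleʳ (ℚ.- 1ℚ) z y))
      half′ : ∀ z → w Qf.· z ≡ u Qf.· z ℚ.+ (ℚ.- 1ℚ) ℚ.* (v Qf.· z)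
      half′ z = trans (Qf.·-comm w z) (trans (half z u v) (cong₂ (λ x y → x ℚ.+ (ℚ.- 1ℚ) ℚ.* y) (Qf.·-comm z u) (Qf.·-comm z v)))

    -- The rational form is evaluated at the difference of the multiplicity vectors of `P` and `Q`;
    -- all terms are images of natural numbers, so the inequality descends along `φ`.
    psd⇒positive : Qf.PSD S → (b-sym : ∀ x y → b x y ≡ b y x) → Positive b-sym
    psd⇒positive psd b-sym P Q = φ-cancel-≤ (2 * ⟪ P , Q ⟫) (⟪ P , P ⟫ + ⟪ Q , Q ⟫)
      (rearrange (φ ⟪ P , P ⟫) (φ ⟪ Q , Q ⟫) (φ ⟪ P , Q ⟫) (φ-+ ⟪ P , P ⟫ ⟪ Q , Q ⟫) doubled
        (subst (0ℚ ℚ.≤_) value (nonNeg⇒0≤ (psd (λ i → multiplicity P i ℚ.+ (ℚ.- 1ℚ) ℚ.* multiplicity Q i)))))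
      where
      value : Qf.form S (λ i → multiplicity P i ℚ.+ (ℚ.- 1ℚ) ℚ.* multiplicity Q i) ≡
              (φ ⟪ P , P ⟫ ℚ.+ φ ⟪ Q , Q ⟫) ℚ.- (φ ⟪ P , Q ⟫ ℚ.+ φ ⟪ P , Q ⟫)
      value = trans (difference-form (multiplicity P) (multiplicity Q)) (cong₂ (λ x y → x ℚ.- y)
        (cong₂ (λ x y → x ℚ.+ y) (bilinear P P) (bilinear Q Q))
        (cong₂ (λ x y → x ℚ.+ y) (bilinear P Q) (trans (bilinear Q P) (cong φ (symmetric b-sym Q P)))))
      doubled : φ (2 * ⟪ P , Q ⟫) ≡ φ ⟪ P , Q ⟫ ℚ.+ φ ⟪ P , Q ⟫
      doubled = trans (cong φ (cong (⟪ P , Q ⟫ +_) (ℕ.+-identityʳ ⟪ P , Q ⟫))) (φ-+ ⟪ P , Q ⟫ ⟪ P , Q ⟫)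
      rearrange : ∀ p q r {s d} → s ≡ p ℚ.+ q → d ≡ r ℚ.+ r → 0ℚ ℚ.≤ (p ℚ.+ q) ℚ.- (r ℚ.+ r) → d ℚ.≤ s
      rearrange p q r refl refl 0≤ = subst₂ ℚ._≤_ (ℚ.+-identityˡ (r ℚ.+ r))
        (solve 2 (λ s d → (s :- d) :+ d := s) refl (p ℚ.+ q) (r ℚ.+ r)) (ℚ.+-monoˡ-≤ (r ℚ.+ r) 0≤)

  indicator : Bool → ℕ
  indicator b = if b then 1 else 0

  module _ (G : Graph) (t : ℕ) where
    open Graph G

    adjacent equal weight : Vertex → Vertex → ℕ
    adjacent x y = indicator (does (x ~? y))
    equal x y = indicator (does (x ≟ y))
    -- The entries of A + (t + 1) I.
    weight x y = adjacent x y + suc t * equal x y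

    adjacent-sym : ∀ x y → adjacent x y ≡ adjacent y x
    adjacent-sym x y with x ~? y | y ~? x
    ... | yes _   | yes _   = refl
    ... | no _    | no _    = refl
    ... | yes x~y | no y≁x  = ⊥-elim (y≁x (~-sym x~y))
    ... | no x≁y  | yes y~x = ⊥-elim (x≁y (~-sym y~x))

    equal-sym : ∀ x y → equal x y ≡ equal y x
    equal-sym x y with x ≟ y | y ≟ x
    ... | yes _   | yes _   = refl
    ... | no _    | no _    = refl
    ... | yes x≡y | no y≢x  = ⊥-elim (y≢x (sym x≡y))
    ... | no x≢y  | yes y≡x = ⊥-elim (x≢y (sym y≡x))

    weight-sym : ∀ x y → weight x y ≡ weight y x
    weight-sym x y = cong₂ (λ a e → a + suc t * e) (adjacent-sym x y) (equal-sym x y)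

    private
      M : Fin order → Vector ℚ order
      M x y = if does (x ~? y) then 1ℚ else 0ℚ

      M≡φ : ∀ x y → M x y ≡ φ (adjacent x y)
      M≡φ x y with does (x ~? y)
      ... | true  = sym φ-1
      ... | false = sym φ-0

      identity≡φ : ∀ x y → Qs.identity x y ≡ φ (equal x y)
      identity≡φ x y with does (x ≟ y)
      ... | true  = sym φ-1
      ... | false = sym φ-0

      matrix≡M : ∀ x y → adjacencyMatrix x y ≡ fromℚ (M x y)
      matrix≡M x y with does (x ~? y)
      ... | true  = refl
      ... | false = refl

      M-sym : Qf.Symmetric M
      M-sym x y = trans (M≡φ x y) (trans (cong φ (adjacent-sym x y)) (sym (M≡φ y x)))

      c : ℚ
      c = (ℤ.- (ℤ.+ t) ℤ.- ℤ.+ 1) / 1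

      -c≡φ : ℚ.- c ≡ φ (suc t)
      -c≡φ = negate c (φ (suc t)) (trans (cong (λ y → c ℚ.+ y) (φ≡/1 (suc t)))
        (trans (sym (/1-+ (ℤ.- (ℤ.+ t) ℤ.- ℤ.+ 1) (ℤ.+ suc t))) (cong (_/ 1) zero-sum)))
        where
        negate : ∀ p q → p ℚ.+ q ≡ 0ℚ → ℚ.- p ≡ q
        negate p q p+q≡0 = trans (solve 2 (λ p q → :- p := q :- (p :+ q)) refl p q) (trans (cong (λ z → q ℚ.- z) p+q≡0) (ℚ.+-identityʳ q))
        zero-sum : ℤ.- (ℤ.+ t) ℤ.- ℤ.+ 1 ℤ.+ ℤ.+ suc t ≡ ℤ.+ 0
        zero-sum = trans (ℤ.+-assoc (ℤ.- (ℤ.+ t)) (ℤ.- (ℤ.+ 1)) (ℤ.+ suc t)) (ℤ.+-inverseˡ (ℤ.+ t))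

      shifted≡φ : ∀ x y → Qs.shift M c x y ≡ φ (weight x y)
      shifted≡φ x y = trans (cong₂ (λ a e → a ℚ.+ e) (M≡φ x y) (trans (cong₂ (λ a e → a ℚ.* e) -c≡φ (identity≡φ x y))
        (sym (φ-* (suc t) (equal x y))))) (sym (φ-+ (adjacent x y) (suc t * equal x y)))

    weight-positive : λmin[ G ]≥ fromℚ c → Bilinear.Positive weight weight-sym
    weight-positive bound = psd⇒positive (Qs.shift M c) weight shifted≡φ
      (smallestEigenvalue-psd M M-sym adjacencyMatrix matrix≡M c bound) weight-sym

-- Spectral inequalities for stars and cliques.

module CliqueBounds where

  open ListSums
  open AdjacencyForm
  open import Defs using (Graph)
  open import Data.Bool.Base using (true; false)
  open import Data.Empty using (⊥; ⊥-elim)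
  open import Data.Fin.Properties using (_≟_)
  open import Data.List.Base using (List; []; _∷_; _++_; length; filter; concat; take)
  open import Data.List.Properties using (length-take; filter-accept; filter-reject)
  open import Data.List.Membership.Propositional using (_∈_; _∉_)
  open import Data.List.Membership.Propositional.Properties using (∈-filter⁻)
  open import Data.List.Relation.Unary.All as All using (All; []; _∷_)
  import Data.List.Relation.Unary.All.Properties as All
  open import Data.List.Relation.Unary.AllPairs using ([]; _∷_)
  open import Data.List.Relation.Unary.Any using (here; there)
  open import Data.List.Relation.Unary.Unique.Propositional using (Unique)
  import Data.List.Relation.Unary.Unique.Propositional.Properties as Unique
  open import Data.Nat.Base hiding (equal)
  open import Data.Nat.Properties hiding (_≟_)
  open import Data.Nat.Tactic.RingSolver using (solve-∀)
  open import Data.Product.Base using (_×_; _,_; proj₁; proj₂)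
  open import Data.Sum.Base using (_⊎_; inj₁; inj₂)
  open import Function.Base using (_∘_)
  open import Relation.Binary.Definitions using (Decidable)
  open import Relation.Binary.PropositionalEquality
  open import Relation.Nullary.Decidable using (Dec; does; yes; no; ¬?; _⊎-dec_)
  open import Relation.Nullary.Negation using (¬_)
  import Relation.Unary as U

  -- How every spectral inequality below is refuted: up to the terms E k and
  -- e L k it is an identity, and E is smaller than L.
  defeat : ∀ {l r} E L e k → l ≤ r → l + E * k ≡ r + e * L * k → 0 < k → 0 < e → E < L → ⊥
  defeat {l} {r} E L e@(suc e-1) k@(suc _) l≤r balance 0<k 0<e E<L = <-irrefl refl (begin-strict
    l + E * k          ≤⟨ +-monoˡ-≤ (E * k) l≤r ⟩
    r + E * k          <⟨ +-monoʳ-< r (*-monoˡ-< k E<L) ⟩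
    r + L * k          ≤⟨ +-monoʳ-≤ r (*-monoˡ-≤ k (m≤m+n L (e-1 * L))) ⟩
    r + e * L * k      ≡⟨ balance ⟨
    l + E * k          ∎)
    where open ≤-Reasoning

  module _ {A : Set} {P : A → Set} (P? : U.Decidable P) where

    ∑ₗ-filter : ∀ (f : A → ℕ) xs → ∑ₗ f (filter P? xs) ≤ ∑ₗ f xs
    ∑ₗ-filter f []       = z≤n
    ∑ₗ-filter f (x ∷ xs) with does (P? x)
    ... | true  = +-monoʳ-≤ (f x) (∑ₗ-filter f xs)
    ... | false = ≤-trans (∑ₗ-filter f xs) (m≤n+m _ (f x))

    length-filter-∑ : ∀ xs → length (filter P? xs) ≡ ∑ₗ (λ x → indicator (does (P? x))) xs
    length-filter-∑ []       = refl
    length-filter-∑ (x ∷ xs) with does (P? x)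
    ... | true  = cong suc (length-filter-∑ xs)
    ... | false = length-filter-∑ xs

    length-filter-¬ : ∀ xs → length (filter P? xs) + length (filter (¬? ∘ P?) xs) ≡ length xs
    length-filter-¬ []       = refl
    length-filter-¬ (x ∷ xs) with does (P? x)
    ... | true  = cong suc (length-filter-¬ xs)
    ... | false = trans (+-suc _ _) (cong suc (length-filter-¬ xs))

  ∈-take : ∀ {A : Set} {x : A} k xs → x ∈ take k xs → x ∈ xs
  ∈-take k xs x∈ = All.lookup (All.take⁺ k (All.tabulate (λ y∈xs → y∈xs))) x∈

  length-take-≡ : ∀ {A : Set} k (xs : List A) → k ≤ length xs → length (take k xs) ≡ k
  length-take-≡ k xs k≤ = trans (length-take k xs) (m≤n⇒m⊓n≡m k≤)

  module Tests (G : Graph) (t : ℕ) (pos : Bilinear.Positive (weight G t) (weight-sym G t)) where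
    open Graph G using (Vertex; _~_; _~?_; ~-sym; ~-irrefl)
    open Bilinear (weight G t)

    infix 4 _≐_ _≐?_

    -- Closed adjacency: with it the members of a clique need not be distinguished from one another.
    _≐_ : Vertex → Vertex → Set
    x ≐ y = x ≡ y ⊎ x ~ y

    _≐?_ : Decidable _≐_
    x ≐? y = (x ≟ y) ⊎-dec (x ~? y)

    ≐-sym : ∀ {x y} → x ≐ y → y ≐ x
    ≐-sym (inj₁ refl) = inj₁ refl
    ≐-sym (inj₂ x~y)  = inj₂ (~-sym x~y)

    w : Vertex → Vertex → ℕ
    w = weight G t

    near : Vertex → Vertex → ℕ
    near x y = indicator (does (x ≐? y))

    near-yes : ∀ {x y} → x ≐ y → near x y ≡ 1
    near-yes {x} {y} x≐y with x ≟ y | x ~? y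
    ... | yes _   | _       = refl
    ... | no _    | yes _   = refl
    ... | no x≢y  | no x≁y with x≐y
    ...   | inj₁ x≡y = ⊥-elim (x≢y x≡y)
    ...   | inj₂ x~y = ⊥-elim (x≁y x~y)

    near≤1 : ∀ x y → near x y ≤ 1
    near≤1 x y with does (x ≐? y)
    ... | true  = s≤s z≤n
    ... | false = z≤n

    -- The splitting A + (t + 1) I = (A + I) + t I. The second summand contributes only lower order
    -- terms for large cliques.
    w≡near+equal : ∀ x y → w x y ≡ near x y + t * equal G t x y
    w≡near+equal x y with x ≟ y | x ~? y
    ... | yes refl | yes x~x = ⊥-elim (~-irrefl refl x~x)
    ... | yes refl | no _    = refl
    ... | no _     | yes _   = refl
    ... | no _     | no _    = refl

    w-self : ∀ x → w x x ≡ 1 + t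
    w-self x with x ≟ x | x ~? x
    ... | _       | yes x~x = ⊥-elim (~-irrefl refl x~x)
    ... | no x≢x  | no _    = ⊥-elim (x≢x refl)
    ... | yes _   | no _    = cong suc (*-identityʳ t)

    w-far : ∀ {x y} → ¬ x ≐ y → w x y ≡ 0
    w-far {x} {y} x≭y with x ≟ y | x ~? y
    ... | yes x≡y | _       = ⊥-elim (x≭y (inj₁ x≡y))
    ... | no _    | yes x~y = ⊥-elim (x≭y (inj₂ x~y))
    ... | no _    | no _    = *-zeroʳ t

    w-distinct : ∀ {x y} → x ≢ y → w x y ≡ adjacent G t x y
    w-distinct {x} {y} x≢y with x ≟ y
    ... | yes x≡y = ⊥-elim (x≢y x≡y)
    ... | no _    = trans (cong (adjacent G t x y +_) (*-zeroʳ t)) (+-identityʳ _)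

    near≤w : ∀ x y → near x y ≤ w x y
    near≤w x y = subst (near x y ≤_) (sym (w≡near+equal x y)) (m≤m+n _ _)

    equal-∉ : ∀ {x} ys → x ∉ ys → ∑ₗ (equal G t x) ys ≡ 0
    equal-∉ []       x∉ = refl
    equal-∉ {x} (y ∷ ys) x∉ with x ≟ y
    ... | yes x≡y = ⊥-elim (x∉ (here x≡y))
    ... | no _    = equal-∉ ys (x∉ ∘ there)

    equal-unique : ∀ x {ys} → Unique ys → ∑ₗ (equal G t x) ys ≤ 1
    equal-unique x []                   = z≤n
    equal-unique x (_∷_ {y} {ys} y∉ u) with x ≟ y
    ... | yes refl = ≤-reflexive (cong suc (equal-∉ ys λ x∈ → All.lookup y∉ x∈ refl))
    ... | no _     = equal-unique x u

    ∑w : ∀ x ys → ∑ₗ (w x) ys ≡ ∑ₗ (near x) ys + t * ∑ₗ (equal G t x) ys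
    ∑w x ys = trans (∑ₗ-cong ys (λ {y} _ → w≡near+equal x y))
      (trans (∑ₗ-+ (near x) (λ y → t * equal G t x y) ys) (cong (∑ₗ (near x) ys +_) (∑ₗ-* t (equal G t x) ys)))

    ∑w-∉ : ∀ {x} ys → x ∉ ys → ∑ₗ (w x) ys ≡ ∑ₗ (near x) ys
    ∑w-∉ {x} ys x∉ = trans (∑w x ys) (trans (cong (λ e → ∑ₗ (near x) ys + t * e) (equal-∉ ys x∉))
      (trans (cong (∑ₗ (near x) ys +_) (*-zeroʳ t)) (+-identityʳ _)))

    ∑near≤length : ∀ x ys → ∑ₗ (near x) ys ≤ length ys
    ∑near≤length x ys = subst (∑ₗ (near x) ys ≤_) (*-identityʳ (length ys)) (∑ₗ-upper ys (λ {y} _ → near≤1 x y))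

    ∑w-unique : ∀ x {ys} → Unique ys → ∑ₗ (w x) ys ≤ length ys + t
    ∑w-unique x {ys} u = begin
      ∑ₗ (w x) ys                                   ≡⟨ ∑w x ys ⟩
      ∑ₗ (near x) ys + t * ∑ₗ (equal G t x) ys      ≤⟨ +-mono-≤ (∑near≤length x ys) (*-monoʳ-≤ t (equal-unique x u)) ⟩
      length ys + t * 1                             ≡⟨ cong (length ys +_) (*-identityʳ t) ⟩
      length ys + t                                 ∎
      where open ≤-Reasoning

    self-upper : ∀ {ys} → Unique ys → ⟪ ys , ys ⟫ ≤ length ys * (length ys + t)
    self-upper {ys} u = ∑ₗ-upper ys λ {y} _ → ∑w-unique y u

    single-self : ∀ x → ⟪ x ∷ [] , x ∷ [] ⟫ ≤ 1 + t
    single-self x = ≤-reflexive (trans (+-identityʳ _) (trans (+-identityʳ _) (w-self x)))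

    single-upper : ∀ x ys {u} → ∑ₗ (w x) ys ≤ u → ⟪ x ∷ [] , ys ⟫ ≤ u
    single-upper x ys {u} = subst (_≤ u) (sym (single x ys))

    single-lower : ∀ x ys {u} → u ≤ ∑ₗ (w x) ys → u ≤ ⟪ x ∷ [] , ys ⟫
    single-lower x ys {u} = subst (u ≤_) (sym (single x ys))

    flip-lower : ∀ {u} xs ys → u ≤ ⟪ ys , xs ⟫ → u ≤ ⟪ xs , ys ⟫
    flip-lower {u} xs ys = subst (u ≤_) (symmetric (weight-sym G t) ys xs)

    near-lower : ∀ x ys → (∀ {y} → y ∈ ys → x ≐ y) → length ys ≤ ∑ₗ (w x) ys
    near-lower x ys near = subst (_≤ ∑ₗ (w x) ys) (*-identityʳ _)
      (∑ₗ-lower ys λ {y} y∈ → ≤-trans (≤-reflexive (sym (near-yes (near y∈)))) (near≤w x y))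

    far-upper : ∀ x ys → (∀ {y} → y ∈ ys → ¬ x ≐ y) → ∑ₗ (w x) ys ≤ 0
    far-upper x ys far = subst (∑ₗ (w x) ys ≤_) (*-zeroʳ (length ys)) (∑ₗ-upper ys λ y∈ → ≤-reflexive (w-far (far y∈)))

    -- The form at a X + b Y - c Z with estimates in place of the products: lower ones for the
    -- products with a minus sign, upper ones for the others. Each refutation below consists of such
    -- a vector and a polynomial identity.
    test : ∀ a b c X Y Z {p q r s u v} → p ≤ ⟪ X , Z ⟫ → q ≤ ⟪ Y , Z ⟫ →
           ⟪ X , X ⟫ ≤ r → ⟪ X , Y ⟫ ≤ s → ⟪ Y , Y ⟫ ≤ u → ⟪ Z , Z ⟫ ≤ v →
           2 * (a * c * p + b * c * q) ≤ a * a * r + 2 * (a * b * s) + b * b * u + c * c * v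
    test a b c X Y Z p≤ q≤ ≤r ≤s ≤u ≤v = ≤-trans
      (*-monoʳ-≤ 2 (+-mono-≤ (*-monoʳ-≤ (a * c) p≤) (*-monoʳ-≤ (b * c) q≤)))
      (≤-trans (positive₃ (weight-sym G t) pos a b c X Y Z)
        (+-mono-≤ (+-mono-≤ (+-mono-≤ (*-monoʳ-≤ (a * a) ≤r) (*-monoʳ-≤ 2 (*-monoʳ-≤ (a * b) ≤s))) (*-monoʳ-≤ (b * b) ≤u)) (*-monoʳ-≤ (c * c) ≤v)))

    -- A star with s leaves has smallest eigenvalue -√s, so more than (1 + t)² leaves are
    -- impossible. The vector (1 + t) x - I avoids the root: its form is at most (1 + t)((1 + t)² -
    -- s) = -(1 + t).
    star-bound : ∀ x I → Unique I → (∀ {y} → y ∈ I → x ≐ y) → (∀ {y z} → y ∈ I → z ∈ I → y ≐ z → y ≡ z) →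
                 length I ≡ (1 + t) * (1 + t) + 1 → ⊥
    star-bound x I u near independent |I| = defeat ((1 + t) * (1 + t)) ((1 + t) * (1 + t) + 1) 1 (1 + t)
      (test (1 + t) 0 1 (x ∷ []) [] I {q = 0} {s = 0} {u = 0}
        (subst (_≤ ⟪ x ∷ [] , I ⟫) |I| (single-lower x I (near-lower x I near))) z≤n (single-self x)
        (≤-reflexive (+-identityʳ 0)) ≤-refl
        (subst (λ k → ⟪ I , I ⟫ ≤ k * (1 + t)) |I| (∑ₗ-upper I row)))
      (identity t) (s≤s z≤n) (s≤s z≤n) (≤-reflexive (+-comm 1 _))
      where
      row : ∀ {y} → y ∈ I → ∑ₗ (w y) I ≤ 1 + t
      row {y} y∈ = ≤-trans (∑ₗ-mono I entry) (subst (_≤ 1 + t) (sym (∑ₗ-* (1 + t) (equal G t y) I))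
        (subst ((1 + t) * ∑ₗ (equal G t y) I ≤_) (*-identityʳ (1 + t)) (*-monoʳ-≤ (1 + t) (equal-unique y u))))
        where
        entry : ∀ {z} → z ∈ I → w y z ≤ (1 + t) * equal G t y z
        entry {z} z∈ with y ≐? z
        ... | no y≭z  = subst (_≤ (1 + t) * equal G t y z) (sym (w-far y≭z)) z≤n
        ... | yes y≐z with independent y∈ z∈ y≐z
        ...   | refl = subst (λ a → a + (1 + t) * equal G t y y ≤ (1 + t) * equal G t y y) (sym loop) ≤-refl
          where
          loop : adjacent G t y y ≡ 0
          loop with y ~? y
          ... | yes y~y = ⊥-elim (~-irrefl refl y~y)
          ... | no _    = refl
      identity : ∀ t → 2 * ((1 + t) * 1 * ((1 + t) * (1 + t) + 1) + 0 * 1 * 0) + (1 + t) * (1 + t) * (1 + t) ≡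
        (1 + t) * (1 + t) * (1 + t) + 2 * ((1 + t) * 0 * 0) + 0 * 0 * 0 + 1 * 1 * (((1 + t) * (1 + t) + 1) * (1 + t)) + 1 * ((1 + t) * (1 + t) + 1) * (1 + t)
      identity = solve-∀

    module Cliques (m ℓ : ℕ) where

      -- The cliques under consideration have L members; a vertex is inside one
      -- when it misses at most m of them.
      L : ℕ
      L = ℓ + m

      Inside : List Vertex → Vertex → Set
      Inside C x = ℓ ≤ ∑ₗ (near x) C

      inside? : ∀ C → U.Decidable (Inside C)
      inside? C x = ℓ ≤? ∑ₗ (near x) C

      record IsClique (C : List Vertex) : Set where
        field
          unique : Unique C
          clique : ∀ {x y} → x ∈ C → y ∈ C → x ≐ y
          size   : length C ≡ L

      open IsClique

      clique-self : ∀ {C} → IsClique C → ⟪ C , C ⟫ ≤ L * (L + t)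
      clique-self {C} c = subst (λ k → ⟪ C , C ⟫ ≤ k * (k + t)) (size c) (self-upper (unique c))

      clique-inside : ∀ {C x} → IsClique C → x ∈ C → Inside C x
      clique-inside {C} {x} c x∈ = ≤-trans (≤-trans (m≤m+n ℓ m) (≤-reflexive (trans (sym (size c)) (sym (*-identityʳ _)))))
        (∑ₗ-lower C λ y∈ → ≤-reflexive (sym (near-yes (clique c x∈ y∈))))

      inside-lower : ∀ C x → Inside C x → ℓ ≤ ∑ₗ (w x) C
      inside-lower C x i = ≤-trans i (∑ₗ-mono C λ {y} _ → near≤w x y)

      list-lower : ∀ C Y → (∀ {y} → y ∈ Y → Inside C y) → length Y * ℓ ≤ ⟪ Y , C ⟫
      list-lower C Y i = ∑ₗ-lower Y (λ {y} y∈ → inside-lower C y (i y∈))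

      near-part far-part : Vertex → List Vertex → List Vertex
      near-part x = filter (x ≐?_)
      far-part x = filter (λ y → ¬? (x ≐? y))

      near-part-length : ∀ x C → length (near-part x C) ≡ ∑ₗ (near x) C
      near-part-length x C = length-filter-∑ (x ≐?_) C

      parts : ∀ x C → length (near-part x C) + length (far-part x C) ≡ length C
      parts x C = length-filter-¬ (x ≐?_) C

      inside-far : ∀ {C x} → IsClique C → Inside C x → length (far-part x C) ≤ m
      inside-far {C} {x} c i = +-cancelˡ-≤ ℓ _ _ (begin
        ℓ + length (far-part x C)                         ≤⟨ +-monoˡ-≤ _ (subst (ℓ ≤_) (sym (near-part-length x C)) i) ⟩
        length (near-part x C) + length (far-part x C)    ≡⟨ trans (parts x C) (size c) ⟩
        ℓ + m                                             ∎)
        where open ≤-Reasoning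

      outside-far : ∀ {C x} → IsClique C → ¬ Inside C x → m ≤ length (far-part x C)
      outside-far {C} {x} c o = ≮⇒≥ λ far<m → <-irrefl refl (begin-strict
        ℓ + m                                             ≡⟨ trans (parts x C) (size c) ⟨
        length (near-part x C) + length (far-part x C)    <⟨ +-mono-≤-< (subst (_≤ ℓ) (sym (near-part-length x C)) (<⇒≤ (≰⇒> o))) far<m ⟩
        ℓ + m                                             ∎)
        where open ≤-Reasoning

      module Dichotomy (0<t : 0 < t) (m≡ : m ≡ 2 * t * (1 + t) + 1) where

        -- Otherwise C has `m` members far from `x`, listed in `D₁`, and `m` members near it, listed
        -- in `D₂`. In D₁ - D₂ the clique part cancels and only 2 t m remains, so the form at 2t x +
        -- D₁ - D₂ is at most 2t (2t (1 + t) - m). This is the origin of `m`.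
        outside-near : ∀ {C x} → IsClique C → ¬ Inside C x → ∑ₗ (near x) C < m
        outside-near {C} {x} c o = ≰⇒> λ m≤near →
          let D₁ = take m (far-part x C)
              D₂ = take m (near-part x C)
              |D₁| = length-take-≡ m (far-part x C) (outside-far c o)
              |D₂| = length-take-≡ m (near-part x C) (subst (m ≤_) (sym (near-part-length x C)) m≤near)
              ∈D₁ = λ {y} y∈ → ∈-filter⁻ (λ y → ¬? (x ≐? y)) {y} {C} (∈-take m (far-part x C) y∈)
              ∈D₂ = λ {y} y∈ → ∈-filter⁻ (x ≐?_) {y} {C} (∈-take m (near-part x C) y∈)
          in defeat (2 * t * (1 + t)) m 1 (2 * t)
            (test (2 * t) 1 1 (x ∷ []) D₁ D₂
              (subst (_≤ ⟪ x ∷ [] , D₂ ⟫) |D₂| (single-lower x D₂ (near-lower x D₂ λ y∈ → proj₂ (∈D₂ y∈))))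
              (subst₂ (λ j k → j * k ≤ ⟪ D₁ , D₂ ⟫) |D₁| |D₂| (∑ₗ-lower D₁ λ {y} y∈ → near-lower y D₂ λ z∈ → clique c (proj₁ (∈D₁ y∈)) (proj₁ (∈D₂ z∈))))
              (single-self x)
              (single-upper x D₁ (far-upper x D₁ λ y∈ → proj₂ (∈D₁ y∈)))
              (subst (λ k → ⟪ D₁ , D₁ ⟫ ≤ k * (k + t)) |D₁| (self-upper (Unique.take⁺ m (Unique.filter⁺ (λ y → ¬? (x ≐? y)) (unique c)))))
              (subst (λ k → ⟪ D₂ , D₂ ⟫ ≤ k * (k + t)) |D₂| (self-upper (Unique.take⁺ m (Unique.filter⁺ (x ≐?_) (unique c))))))
            (identity t m) (≤-trans 0<t (m≤m+n t _)) (s≤s z≤n) (≤-reflexive (trans (+-comm 1 _) (sym m≡)))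
          where
          identity : ∀ t m → 2 * (2 * t * 1 * m + 1 * 1 * (m * m)) + 2 * t * (1 + t) * (2 * t) ≡
            2 * t * (2 * t) * (1 + t) + 2 * (2 * t * 1 * 0) + 1 * 1 * (m * (m + t)) + 1 * 1 * (m * (m + t)) + 1 * m * (2 * t)
          identity = solve-∀

        outside-upper : ∀ {C x} → IsClique C → ¬ Inside C x → ∑ₗ (w x) C ≤ m
        outside-upper {C} {x} c o = subst (_≤ m) (sym (∑w-∉ C λ x∈ → o (clique-inside c x∈))) (<⇒≤ (outside-near c o))

        -- The vector is t L x + L Y - (t + s) C with s = t² + 1. Its coefficients balance the
        -- nearness of x and Y to C; estimating `Y` as if it were a clique leaves t (t² - s) L² = -t
        -- L² up to terms linear in L.
        plex-bound : ∀ {C x Y} → IsClique C → 2 * (t + (t * t + 1)) * (t + (t * t + 1)) * m + (t + (t * t + 1)) * (t + (t * t + 1)) * t < L →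
          Inside C x → Unique Y → (∀ {y} → y ∈ Y → Inside C y) → (∀ {y} → y ∈ Y → ¬ x ≐ y) → length Y ≡ t * t + 1 → ⊥
        plex-bound {C} {x} {Y} c big ix u iY far |Y| = defeat
          (2 * (t + (t * t + 1)) * (t + (t * t + 1)) * m + (t + (t * t + 1)) * (t + (t * t + 1)) * t) L t L
          (test (t * L) L (t + (t * t + 1)) (x ∷ []) Y C
            (single-lower x C (inside-lower C x ix))
            (subst (λ k → k * ℓ ≤ ⟪ Y , C ⟫) |Y| (list-lower C Y iY))
            (single-self x) (single-upper x Y (far-upper x Y far))
            (subst (λ k → ⟪ Y , Y ⟫ ≤ k * (k + t)) |Y| (self-upper u)) (clique-self c))
          (identity t ℓ m) (≤-trans (s≤s z≤n) big) 0<t big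
          where
          identity : ∀ t ℓ m → 2 * (t * (ℓ + m) * (t + (t * t + 1)) * ℓ + (ℓ + m) * (t + (t * t + 1)) * ((t * t + 1) * ℓ))
              + (2 * (t + (t * t + 1)) * (t + (t * t + 1)) * m + (t + (t * t + 1)) * (t + (t * t + 1)) * t) * (ℓ + m) ≡
            t * (ℓ + m) * (t * (ℓ + m)) * (1 + t) + 2 * (t * (ℓ + m) * (ℓ + m) * 0) + (ℓ + m) * (ℓ + m) * ((t * t + 1) * ((t * t + 1) + t))
              + (t + (t * t + 1)) * (t + (t * t + 1)) * ((ℓ + m) * ((ℓ + m) + t)) + t * (ℓ + m) * (ℓ + m)
          identity = solve-∀

        -- The vector is t L x + m C - L D. Since D is almost completely joined to C, the part m C -
        -- L D has form about t m L² only, whereas `x` sees all of D and little of C. The leading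
        -- term is t (t (1 + t) - m) L², which is -t (t² + t + 1) L² for the given `m`.
        pair-bound : ∀ {C x D} → IsClique C → 3 * t * m * m + 2 * m * m * m < L →
          ¬ Inside C x → Unique D → (∀ {y} → y ∈ D → Inside C y) → (∀ {y} → y ∈ D → x ≐ y) → length D ≡ m → ⊥
        pair-bound {C} {x} {D} c big ox u iD near |D| = defeat (3 * t * m * m + 2 * m * m * m) L (t * (t * t + t + 1)) L
          (test (t * L) m L (x ∷ []) C D
            (subst (_≤ ⟪ x ∷ [] , D ⟫) |D| (single-lower x D (near-lower x D near)))
            (flip-lower C D (subst (λ k → k * ℓ ≤ ⟪ D , C ⟫) |D| (list-lower C D iD)))
            (single-self x) (single-upper x C (outside-upper c ox)) (clique-self c)
            (subst (λ k → ⟪ D , D ⟫ ≤ k * (k + t)) |D| (self-upper u)))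
          (subst (λ m → 2 * (t * (ℓ + m) * (ℓ + m) * m + m * (ℓ + m) * (m * ℓ)) + (3 * t * m * m + 2 * m * m * m) * (ℓ + m) ≡
              t * (ℓ + m) * (t * (ℓ + m)) * (1 + t) + 2 * (t * (ℓ + m) * m * m) + m * m * ((ℓ + m) * ((ℓ + m) + t))
              + (ℓ + m) * (ℓ + m) * (m * (m + t)) + t * (t * t + t + 1) * (ℓ + m) * (ℓ + m)) (sym m≡) (identity t ℓ))
          (≤-trans (s≤s z≤n) big) (*-mono-≤ 0<t (m≤n+m 1 (t * t + t))) big
          where
          identity : ∀ t ℓ → 2 * (t * (ℓ + (2 * t * (1 + t) + 1)) * (ℓ + (2 * t * (1 + t) + 1)) * (2 * t * (1 + t) + 1) + (2 * t * (1 + t) + 1) * (ℓ + (2 * t * (1 + t) + 1)) * ((2 * t * (1 + t) + 1) * ℓ)) + (3 * t * (2 * t * (1 + t) + 1) * (2 * t * (1 + t) + 1) + 2 * (2 * t * (1 + t) + 1) * (2 * t * (1 + t) + 1) * (2 * t * (1 + t) + 1)) * (ℓ + (2 * t * (1 + t) + 1)) ≡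
              t * (ℓ + (2 * t * (1 + t) + 1)) * (t * (ℓ + (2 * t * (1 + t) + 1))) * (1 + t) + 2 * (t * (ℓ + (2 * t * (1 + t) + 1)) * (2 * t * (1 + t) + 1) * (2 * t * (1 + t) + 1)) + (2 * t * (1 + t) + 1) * (2 * t * (1 + t) + 1) * ((ℓ + (2 * t * (1 + t) + 1)) * ((ℓ + (2 * t * (1 + t) + 1)) + t))
              + (ℓ + (2 * t * (1 + t) + 1)) * (ℓ + (2 * t * (1 + t) + 1)) * ((2 * t * (1 + t) + 1) * ((2 * t * (1 + t) + 1) + t)) + t * (t * t + t + 1) * (ℓ + (2 * t * (1 + t) + 1)) * (ℓ + (2 * t * (1 + t) + 1))
          identity = solve-∀

      module Families (κ : ℕ) where

        data Family : List (List Vertex) → Set where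
          []  : Family []
          _∷_ : ∀ {C F} → IsClique C × (∀ {D} → D ∈ F → ⟪ C , D ⟫ ≤ κ * L) → Family F → Family (C ∷ F)

        cross : ∀ C F → (∀ {D} → D ∈ F → ⟪ C , D ⟫ ≤ κ * L) → ⟪ C , concat F ⟫ ≤ length F * (κ * L)
        cross C []      bound = ≤-reflexive (trans (∑ₗ-const 0 C) (*-zeroʳ (length C)))
        cross C (D ∷ F) bound = ≤-trans (≤-reflexive (++-right (weight-sym G t) C D (concat F)))
          (+-mono-≤ (bound (here refl)) (cross C F (bound ∘ there)))

        family-self : ∀ {F} → Family F → ⟪ concat F , concat F ⟫ ≤ length F * (L * (L + t)) + length F * length F * (κ * L)
        family-self [] = z≤n
        family-self (_∷_ {C} {F} (c , bound) fam) = begin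
          ⟪ C ++ S , C ++ S ⟫                                   ≡⟨ ++-left C S (C ++ S) ⟩
          ⟪ C , C ++ S ⟫ + ⟪ S , C ++ S ⟫                       ≡⟨ cong₂ _+_ (++-right (weight-sym G t) C C S) (++-right (weight-sym G t) S C S) ⟩
          (⟪ C , C ⟫ + ⟪ C , S ⟫) + (⟪ S , C ⟫ + ⟪ S , S ⟫)     ≡⟨ cong (λ z → (⟪ C , C ⟫ + ⟪ C , S ⟫) + (z + ⟪ S , S ⟫)) (symmetric (weight-sym G t) S C) ⟩
          (⟪ C , C ⟫ + ⟪ C , S ⟫) + (⟪ C , S ⟫ + ⟪ S , S ⟫)     ≤⟨ +-mono-≤ (+-mono-≤ (clique-self c) (cross C F bound)) (+-mono-≤ (cross C F bound) (family-self fam)) ⟩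
          -- One further `p` completes 2 f + f² to (f + 1)²; counting f² instead of f (f - 1)
          -- ordered pairs keeps the bound free of subtraction.
          (q + f * p) + (f * p + (f * q + f * f * p))           ≤⟨ m≤m+n _ p ⟩
          (q + f * p) + (f * p + (f * q + f * f * p)) + p       ≡⟨ identity f q p ⟩
          suc f * q + suc f * suc f * p                         ∎
          where
          open ≤-Reasoning
          S : List Vertex
          S = concat F
          f p q : ℕ
          f = length F
          p = κ * L
          q = L * (L + t)
          identity : ∀ f q p → (q + f * p) + (f * p + (f * q + f * f * p)) + p ≡ suc f * q + suc f * suc f * p
          identity = solve-∀

        family-lower : ∀ x F → (∀ {C} → C ∈ F → Inside C x) → length F * ℓ ≤ ∑ₗ (w x) (concat F)
        family-lower x []      i = z≤n
        family-lower x (C ∷ F) i = subst (length (C ∷ F) * ℓ ≤_) (sym (∑ₗ-++ (w x) C (concat F)))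
          (+-mono-≤ (inside-lower C x (i (here refl))) (family-lower x F (i ∘ there)))

        family-lower-filter : ∀ x F → length (filter (λ C → inside? C x) F) * ℓ ≤ ∑ₗ (w x) (concat F)
        family-lower-filter x []      = z≤n
        family-lower-filter x (C ∷ F) = subst (length (filter P? (C ∷ F)) * ℓ ≤_) (sym (∑ₗ-++ (w x) C (concat F))) (split (P? C))
          where
          P? : U.Decidable (λ C → Inside C x)
          P? C = inside? C x
          split : Dec (Inside C x) → length (filter P? (C ∷ F)) * ℓ ≤ ∑ₗ (w x) C + ∑ₗ (w x) (concat F)
          split (yes i) = subst (λ G → length G * ℓ ≤ ∑ₗ (w x) C + ∑ₗ (w x) (concat F)) (sym (filter-accept P? i))
            (+-mono-≤ (inside-lower C x i) (family-lower-filter x F))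
          split (no o)  = subst (λ G → length G * ℓ ≤ ∑ₗ (w x) C + ∑ₗ (w x) (concat F)) (sym (filter-reject P? o))
            (≤-trans (family-lower-filter x F) (m≤n+m _ (∑ₗ (w x) C)))

        family-upper : ∀ x F → (∀ {C} → C ∈ F → ∑ₗ (w x) C ≤ m) → ∑ₗ (w x) (concat F) ≤ length F * m
        family-upper x []      o = z≤n
        family-upper x (C ∷ F) o = subst (_≤ length (C ∷ F) * m) (sym (∑ₗ-++ (w x) C (concat F)))
          (+-mono-≤ (o (here refl)) (family-upper x F (o ∘ there)))

        -- At L x minus the sum of k cliques through x, the leading term is (1 + t - 2 k + k) L² =
        -- (1 + t - k) L², which is -L² for k = 2 + t.
        family-size : ∀ {x F} → Family F → 2 * (2 + t) * m + (2 + t) * t + (2 + t) * (2 + t) * κ < L →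
          (∀ {C} → C ∈ F → Inside C x) → length F ≡ 2 + t → ⊥
        family-size {x} {F} fam big i |F| = defeat (2 * (2 + t) * m + (2 + t) * t + (2 + t) * (2 + t) * κ) L 1 L
          (test L 0 1 (x ∷ []) [] (concat F) {q = 0} {s = 0} {u = 0}
            (single-lower x (concat F) (subst (λ k → k * ℓ ≤ ∑ₗ (w x) (concat F)) |F| (family-lower x F i)))
            z≤n (single-self x) (≤-reflexive (+-identityʳ 0)) ≤-refl
            (subst (λ k → ⟪ concat F , concat F ⟫ ≤ k * (L * (L + t)) + k * k * (κ * L)) |F| (family-self fam)))
          (identity t ℓ m κ) (≤-trans (s≤s z≤n) big) (s≤s z≤n) big
          where
          identity : ∀ t ℓ m κ → 2 * ((ℓ + m) * 1 * ((2 + t) * ℓ) + 0 * 1 * 0) + (2 * (2 + t) * m + (2 + t) * t + (2 + t) * (2 + t) * κ) * (ℓ + m) ≡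
            (ℓ + m) * (ℓ + m) * (1 + t) + 2 * ((ℓ + m) * 0 * 0) + 0 * 0 * 0
            + 1 * 1 * ((2 + t) * ((ℓ + m) * ((ℓ + m) + t)) + (2 + t) * (2 + t) * (κ * (ℓ + m))) + 1 * (ℓ + m) * (ℓ + m)
          identity = solve-∀

        -- For 1 + t cliques through x with sum S, the leading terms of the form at L x - S cancel;
        -- κ₁ L collects what is left, namely the members missed by x, the diagonal parts of the
        -- cliques, and their mutual products.
        κ₁ : ℕ
        κ₁ = 2 * (1 + t) * m + (1 + t) * t + (1 + t) * (1 + t) * κ

        -- With S the sum of F, the vector is κ₁ y + S - L x. The part S - L x costs at most κ₁ L,
        -- while an adjacent y that is outside all of F gains 2 κ₁ L from L x. The total is at most
        -- κ₁ ((1 + t) κ₁ + 2 (1 + t) m - L).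
        adjacent-common : ∀ {x y F} → Family F → 0 < m → κ₁ * (1 + t) + 2 * (1 + t) * m < L →
          (∀ {C} → C ∈ F → Inside C x) → (∀ {C} → C ∈ F → ∑ₗ (w y) C ≤ m) → length F ≡ 1 + t → x ≐ y → ⊥
        adjacent-common {x} {y} {F} fam 0<m big ix oy |F| x≐y = defeat (κ₁ * (1 + t) + 2 * (1 + t) * m) L 1 κ₁
          (test κ₁ 1 L (y ∷ []) (concat F) (x ∷ [])
            (single-lower y (x ∷ []) (near-lower y (x ∷ []) λ { (here refl) → ≐-sym x≐y }))
            (flip-lower (concat F) (x ∷ []) (single-lower x (concat F) (subst (λ k → k * ℓ ≤ ∑ₗ (w x) (concat F)) |F| (family-lower x F ix))))
            (single-self y)
            (single-upper y (concat F) (subst (λ k → ∑ₗ (w y) (concat F) ≤ k * m) |F| (family-upper y F oy)))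
            (subst (λ k → ⟪ concat F , concat F ⟫ ≤ k * (L * (L + t)) + k * k * (κ * L)) |F| (family-self fam))
            (single-self x))
          (identity t ℓ m κ) (≤-trans (≤-trans 0<m (m≤n*m m (2 * (1 + t)))) (≤-trans (m≤m+n _ ((1 + t) * t)) (m≤m+n _ ((1 + t) * (1 + t) * κ)))) (s≤s z≤n) big
          where
          -- Adding κ₁ L to both sides, expanded on the left and as k L on the right, allows `k` to
          -- remain a variable for the solver.
          identity′ : ∀ t ℓ m κ k → 2 * (k * (ℓ + m) * 1 + 1 * (ℓ + m) * ((1 + t) * ℓ)) + (k * (1 + t) + 2 * (1 + t) * m) * k
              + (2 * (1 + t) * m + (1 + t) * t + (1 + t) * (1 + t) * κ) * (ℓ + m) ≡
            k * k * (1 + t) + 2 * (k * 1 * ((1 + t) * m)) + 1 * 1 * ((1 + t) * ((ℓ + m) * ((ℓ + m) + t)) + (1 + t) * (1 + t) * (κ * (ℓ + m)))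
              + (ℓ + m) * (ℓ + m) * (1 + t) + 1 * (ℓ + m) * k + k * (ℓ + m)
          identity′ = solve-∀
          identity : ∀ t ℓ m κ → let k = 2 * (1 + t) * m + (1 + t) * t + (1 + t) * (1 + t) * κ in
            2 * (k * (ℓ + m) * 1 + 1 * (ℓ + m) * ((1 + t) * ℓ)) + (k * (1 + t) + 2 * (1 + t) * m) * k ≡
            k * k * (1 + t) + 2 * (k * 1 * ((1 + t) * m)) + 1 * 1 * ((1 + t) * ((ℓ + m) * ((ℓ + m) + t)) + (1 + t) * (1 + t) * (κ * (ℓ + m)))
              + (ℓ + m) * (ℓ + m) * (1 + t) + 1 * (ℓ + m) * k
          identity t ℓ m κ = +-cancelʳ-≡ _ _ _ (identity′ t ℓ m κ (2 * (1 + t) * m + (1 + t) * t + (1 + t) * (1 + t) * κ))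

        -- The nearly isotropic vector with the opposite sign: at κ₁ y + L x - S, the product of y
        -- with L x is A L, but with S it is at least (1 + A) ℓ if y shares more than A cliques. The
        -- total is at most κ₁ ((1 + t) κ₁ + 2 (1 + A) m - L).
        common-bound : ∀ {x y F} → Family F → 0 < m → κ₁ * (1 + t) + 2 * (1 + adjacent G t x y) * m < L →
          (∀ {C} → C ∈ F → Inside C x) → x ≢ y → length F ≡ 1 + t → length (filter (λ C → inside? C y) F) ≤ adjacent G t x y
        common-bound {x} {y} {F} fam 0<m big ix x≢y |F| = ≮⇒≥ λ A<c → defeat (κ₁ * (1 + t) + 2 * (1 + A) * m) L 1 κ₁
          (test κ₁ L 1 (y ∷ []) (x ∷ []) (concat F)
            (single-lower y (concat F) (≤-trans (*-monoˡ-≤ ℓ A<c) (family-lower-filter y F)))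
            (single-lower x (concat F) (subst (λ k → k * ℓ ≤ ∑ₗ (w x) (concat F)) |F| (family-lower x F ix)))
            (single-self y)
            (single-upper y (x ∷ []) (≤-reflexive (trans (+-identityʳ _) (trans (w-distinct (x≢y ∘ sym)) (adjacent-sym G t y x)))))
            (single-self x)
            (subst (λ k → ⟪ concat F , concat F ⟫ ≤ k * (L * (L + t)) + k * k * (κ * L)) |F| (family-self fam)))
          (+-cancelʳ-≡ _ _ _ (identity t ℓ m κ A κ₁)) (≤-trans (≤-trans 0<m (m≤n*m m (2 * (1 + t)))) (≤-trans (m≤m+n _ ((1 + t) * t)) (m≤m+n _ ((1 + t) * (1 + t) * κ)))) (s≤s z≤n) big
          where
          A : ℕ
          A = adjacent G t x y
          identity : ∀ t ℓ m κ A k → 2 * (k * 1 * ((1 + A) * ℓ) + (ℓ + m) * 1 * ((1 + t) * ℓ)) + (k * (1 + t) + 2 * (1 + A) * m) * k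
              + (2 * (1 + t) * m + (1 + t) * t + (1 + t) * (1 + t) * κ) * (ℓ + m) ≡
            k * k * (1 + t) + 2 * (k * (ℓ + m) * A) + (ℓ + m) * (ℓ + m) * (1 + t)
              + 1 * 1 * ((1 + t) * ((ℓ + m) * ((ℓ + m) + t)) + (1 + t) * (1 + t) * (κ * (ℓ + m))) + 1 * (ℓ + m) * k + k * (ℓ + m)
          identity = solve-∀

-- Subsets of a finite set as duplicate-free lists.

module SubsetElements where

  open import Data.Fin.Base using (Fin; zero; suc)
  open import Data.Fin.Properties using (suc-injective)
  open import Data.Fin.Subset
  open import Data.List.Base as List using (List; []; _∷_; length; map)
  open import Data.List.Properties using (length-map)
  import Data.List.Membership.Propositional as List
  open import Data.List.Membership.Propositional.Properties using (∈-map⁻)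
  import Data.List.Relation.Unary.All as All
  import Data.List.Relation.Unary.All.Properties as All
  open import Data.List.Relation.Unary.AllPairs using ([]; _∷_)
  open import Data.List.Relation.Unary.Any using (here; there)
  open import Data.List.Relation.Unary.Unique.Propositional using (Unique)
  import Data.List.Relation.Unary.Unique.Propositional.Properties as Unique
  open import Data.Nat.Base using (ℕ; _+_; _≤_; z≤n; s≤s)
  open import Data.Nat.Properties using (≤-trans; +-suc; +-monoʳ-≤; n≤1+n)
  open import Data.Product.Base using (_,_)
  open import Data.Vec.Base using ([]; _∷_; tabulate; here; there)
  open import Data.Vec.Properties using (lookup∘tabulate; []=⇒lookup; lookup⇒[]=)
  open import Function.Base using (_∘_)
  open import Relation.Binary.PropositionalEquality
  open import Relation.Nullary.Decidable using (does; dec-true; yes; no)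
  import Relation.Unary as U

  elements : ∀ {n} → Subset n → List (Fin n)
  elements []            = []
  elements (inside  ∷ p) = zero ∷ map suc (elements p)
  elements (outside ∷ p) = map suc (elements p)

  length-elements : ∀ {n} (p : Subset n) → length (elements p) ≡ ∣ p ∣
  length-elements []            = refl
  length-elements (inside  ∷ p) = cong ℕ.suc (trans (length-map suc (elements p)) (length-elements p))
  length-elements (outside ∷ p) = trans (length-map suc (elements p)) (length-elements p)

  elements-unique : ∀ {n} (p : Subset n) → Unique (elements p)
  elements-unique []            = []
  elements-unique (inside  ∷ p) = All.map⁺ (All.tabulate λ _ ()) ∷ Unique.map⁺ suc-injective (elements-unique p)
  elements-unique (outside ∷ p) = Unique.map⁺ suc-injective (elements-unique p)

  ∈-elements⁻ : ∀ {n} (p : Subset n) {x} → x List.∈ elements p → x ∈ p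
  ∈-elements⁻ (inside  ∷ p) (here refl) = here
  ∈-elements⁻ (inside  ∷ p) (there x∈) with ∈-map⁻ suc x∈
  ... | y , y∈ , refl = there (∈-elements⁻ p y∈)
  ∈-elements⁻ (outside ∷ p) x∈ with ∈-map⁻ suc x∈
  ... | y , y∈ , refl = there (∈-elements⁻ p y∈)

  x∈p─q⇒x∉q : ∀ {n} (p q : Subset n) {x} → x ∈ p ─ q → x ∉ q
  x∈p─q⇒x∉q (_ ∷ p) (inside  ∷ q) {zero}  () here
  x∈p─q⇒x∉q (_ ∷ p) (inside  ∷ q) {suc x} (there x∈) (there x∈q) = x∈p─q⇒x∉q p q x∈ x∈q
  x∈p─q⇒x∉q (_ ∷ p) (outside ∷ q) {suc x} (there x∈) (there x∈q) = x∈p─q⇒x∉q p q x∈ x∈q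

  ∣p∣≤∣p─q∣+∣q∣ : ∀ {n} (p q : Subset n) → ∣ p ∣ ≤ ∣ p ─ q ∣ + ∣ q ∣
  ∣p∣≤∣p─q∣+∣q∣ []            []            = z≤n
  ∣p∣≤∣p─q∣+∣q∣ (inside  ∷ p) (inside  ∷ q) = subst (ℕ.suc ∣ p ∣ ≤_) (sym (+-suc ∣ p ─ q ∣ ∣ q ∣)) (s≤s (∣p∣≤∣p─q∣+∣q∣ p q))
  ∣p∣≤∣p─q∣+∣q∣ (inside  ∷ p) (outside ∷ q) = s≤s (∣p∣≤∣p─q∣+∣q∣ p q)
  ∣p∣≤∣p─q∣+∣q∣ (outside ∷ p) (inside  ∷ q) = ≤-trans (∣p∣≤∣p─q∣+∣q∣ p q) (+-monoʳ-≤ ∣ p ─ q ∣ (n≤1+n ∣ q ∣))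
  ∣p∣≤∣p─q∣+∣q∣ (outside ∷ p) (outside ∷ q) = ∣p∣≤∣p─q∣+∣q∣ p q

  module _ {n} {P : Fin n → Set} (P? : U.Decidable P) where

    satisfying : Subset n
    satisfying = tabulate (does ∘ P?)

    ∈-satisfying⁻ : ∀ {x} → x ∈ satisfying → P x
    ∈-satisfying⁻ {x} x∈ with P? x | trans (sym (lookup∘tabulate (does ∘ P?) x)) ([]=⇒lookup x∈)
    ... | yes p | _  = p
    ... | no _  | ()

    ∈-satisfying⁺ : ∀ {x} → P x → x ∈ satisfying
    ∈-satisfying⁺ {x} p = lookup⇒[]= x satisfying (trans (lookup∘tabulate (does ∘ P?) x) (dec-true (P? x) p))

-- Fat sets, and the number of them through a vertex.

module FatSets where

  open ListSums
  open AdjacencyForm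
  open CliqueBounds
  open SubsetElements
  open import Defs using (Graph)
  open import Data.Bool.Base using (Bool)
  import Data.Bool.Properties as Bool
  open import Data.Empty using (⊥; ⊥-elim)
  open import Data.Fin.Base using (Fin)
  open import Data.Fin.Properties using (_≟_)
  open import Data.Fin.Subset as Subset using (Subset; ∣_∣; _─_; _-_)
  import Data.Fin.Subset.Properties as Subset
  open import Data.List.Base using (List; []; _∷_; length; filter; take; allFin; cartesianProductWith; deduplicate)
  open import Data.List.Properties using (filter-accept; filter-reject)
  open import Data.List.Membership.Propositional using (_∈_; find; lose)
  open import Data.List.Membership.Propositional.Properties
  open import Data.List.Relation.Unary.All as All using (All; []; _∷_)
  import Data.List.Relation.Unary.All.Properties as All
  open import Data.List.Relation.Unary.AllPairs as AllPairs using (AllPairs; []; _∷_)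
  import Data.List.Relation.Unary.AllPairs.Properties as AllPairs
  open import Data.List.Relation.Unary.Any as Any using (here; there)
  import Data.List.Relation.Unary.Any.Properties as Any
  open import Data.List.Relation.Unary.Unique.Propositional using (Unique)
  import Data.List.Relation.Unary.Unique.Propositional.Properties as Unique
  import Data.List.Relation.Unary.Unique.DecSetoid.Properties as DecUnique
  open import Data.Nat.Base hiding (equal)
  open import Data.Nat.Properties renaming (_≟_ to _≟ℕ_)
  open import Data.Nat.Tactic.RingSolver using (solve-∀)
  open import Data.Product.Base using (∃-syntax; _×_; _,_; proj₁; proj₂)
  open import Data.Sum.Base using (_⊎_; inj₁; inj₂)
  import Data.Vec.Properties as Vec
  open import Function.Base using (_∘_)
  open import Function.Bundles using (mk⇔)
  open import Relation.Binary.PropositionalEquality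
  open import Relation.Nullary.Decidable using (Dec; does; yes; no; ¬?; _×-dec_; map′; does-⇔)
  open import Relation.Nullary.Negation using (¬_)
  import Relation.Unary as U

  module _ {A : Set} {P : A → Set} (P? : U.Decidable P) where

    ∑ₗ-split : ∀ {f : A → ℕ} {a b} xs → (∀ {x} → x ∈ xs → P x → f x ≤ a) → (∀ {x} → x ∈ xs → ¬ P x → f x ≤ b) →
               ∑ₗ f xs ≤ length (filter P? xs) * a + length xs * b
    ∑ₗ-split []       yes≤ no≤ = z≤n
    ∑ₗ-split {f} {a} {b} (x ∷ xs) yes≤ no≤ = split (P? x)
      where
      open ≤-Reasoning
      k l : ℕ
      k = length (filter P? xs)
      l = length xs
      tail≤ : ∑ₗ f xs ≤ k * a + l * b
      tail≤ = ∑ₗ-split xs (yes≤ ∘ there) (no≤ ∘ there)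
      split : Dec (P x) → f x + ∑ₗ f xs ≤ length (filter P? (x ∷ xs)) * a + (b + l * b)
      split (yes p) = begin
        f x + ∑ₗ f xs                                       ≤⟨ +-mono-≤ (yes≤ (here refl) p) tail≤ ⟩
        a + (k * a + l * b)                                 ≤⟨ m≤m+n _ b ⟩
        a + (k * a + l * b) + b                             ≡⟨ identity₁ a (k * a) (l * b) b ⟩
        suc k * a + (b + l * b)                             ≡⟨ cong (λ ys → length ys * a + (b + l * b)) (filter-accept P? p) ⟨
        length (filter P? (x ∷ xs)) * a + (b + l * b)       ∎
        where
        identity₁ : ∀ a p q b → a + (p + q) + b ≡ a + p + (b + q)
        identity₁ = solve-∀
      split (no ¬p) = begin
        f x + ∑ₗ f xs                                       ≤⟨ +-mono-≤ (no≤ (here refl) ¬p) tail≤ ⟩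
        b + (k * a + l * b)                                 ≡⟨ identity₂ (k * a) (l * b) b ⟩
        k * a + (b + l * b)                                 ≡⟨ cong (λ ys → length ys * a + (b + l * b)) (filter-reject P? ¬p) ⟨
        length (filter P? (x ∷ xs)) * a + (b + l * b)       ∎
        where
        identity₂ : ∀ p q b → b + (p + q) ≡ p + (b + q)
        identity₂ = solve-∀

    length-filter-twice : ∀ {Q : A → Set} (Q? : U.Decidable Q) xs → length (filter P? (filter Q? xs)) ≤ length (filter P? xs)
    length-filter-twice Q? xs = subst₂ _≤_ (sym (length-filter-∑ P? (filter Q? xs))) (sym (length-filter-∑ P? xs)) (∑ₗ-filter Q? _ xs)

  tuples : ∀ {n} → ℕ → List (List (Fin n))
  tuples     zero    = [] ∷ []
  tuples {n} (suc k) = cartesianProductWith _∷_ (allFin n) (tuples k)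

  ∈-tuples : ∀ {n} (xs : List (Fin n)) → xs ∈ tuples (length xs)
  ∈-tuples []       = here refl
  ∈-tuples (x ∷ xs) = ∈-cartesianProductWith⁺ _∷_ (∈-allFin x) (∈-tuples xs)

  -- An upper bound for the Ramsey numbers, cliques counted by the first argument and independent
  -- sets by the second: the vertices other than a first one are split into those near it and those
  -- far from it.
  ramsey : ℕ → ℕ → ℕ
  ramsey zero    b       = 0
  ramsey (suc a) zero    = 0
  ramsey (suc a) (suc b) = suc (ramsey a (suc b) + ramsey (suc a) b)

  module Structure (G : Graph) (t : ℕ) (pos : Bilinear.Positive (weight G t) (weight-sym G t)) where
    open Graph G
    open Tests G t pos
    open Bilinear (weight G t)

    Sublist : ℕ → List Vertex → List Vertex → Set
    Sublist k xs ys = Unique ys × length ys ≡ k × (∀ {y} → y ∈ ys → y ∈ xs)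

    ramsey-dichotomy : ∀ a b xs → Unique xs → ramsey a b ≤ length xs →
      (∃[ C ] (Sublist a xs C × (∀ {x y} → x ∈ C → y ∈ C → x ≐ y))) ⊎
      (∃[ I ] (Sublist b xs I × (∀ {x y} → x ∈ I → y ∈ I → x ≐ y → x ≡ y)))
    ramsey-dichotomy zero    b       xs u R≤ = inj₁ ([] , ([] , refl , λ ()) , λ ())
    ramsey-dichotomy (suc a) zero    xs u R≤ = inj₂ ([] , ([] , refl , λ ()) , λ ())
    ramsey-dichotomy (suc a) (suc b) (x ∷ xs) (x∉ ∷ u) (s≤s R≤) with ramsey a (suc b) ≤? length (filter (x ≐?_) xs)
    ... | yes near≥ with ramsey-dichotomy a (suc b) (filter (x ≐?_) xs) (Unique.filter⁺ (x ≐?_) u) near≥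
    ...   | inj₂ (I , (uI , |I| , I⊆) , ind) = inj₂ (I , (uI , |I| , λ y∈ → there (proj₁ (∈-filter⁻ (x ≐?_) {xs = xs} (I⊆ y∈)))) , ind)
    ...   | inj₁ (C , (uC , |C| , C⊆) , cl)  = inj₁ (x ∷ C ,
        (All.tabulate (λ y∈ → All.lookup x∉ (proj₁ (∈-filter⁻ (x ≐?_) {xs = xs} (C⊆ y∈)))) ∷ uC , cong suc |C| ,
          λ { (here refl) → here refl ; (there y∈) → there (proj₁ (∈-filter⁻ (x ≐?_) {xs = xs} (C⊆ y∈))) }) ,
        λ { (here refl) (here refl) → inj₁ refl
          ; (here refl) (there z∈)  → proj₂ (∈-filter⁻ (x ≐?_) {xs = xs} (C⊆ z∈))
          ; (there y∈)  (here refl) → ≐-sym (proj₂ (∈-filter⁻ (x ≐?_) {xs = xs} (C⊆ y∈)))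
          ; (there y∈)  (there z∈)  → cl y∈ z∈ })
    ramsey-dichotomy (suc a) (suc b) (x ∷ xs) (x∉ ∷ u) (s≤s R≤) | no near≱
      with ramsey-dichotomy (suc a) b (filter (λ y → ¬? (x ≐? y)) xs) (Unique.filter⁺ (λ y → ¬? (x ≐? y)) u)
             (+-cancelˡ-≤ (ramsey a (suc b)) _ _ (≤-trans R≤ (subst (_≤ ramsey a (suc b) + length (filter (λ y → ¬? (x ≐? y)) xs))
               (length-filter-¬ (x ≐?_) xs) (+-monoˡ-≤ _ (<⇒≤ (≰⇒> near≱))))))
    ...   | inj₁ (C , (uC , |C| , C⊆) , cl)  = inj₁ (C , (uC , |C| , λ y∈ → there (proj₁ (∈-filter⁻ (λ y → ¬? (x ≐? y)) {xs = xs} (C⊆ y∈)))) , cl)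
    ...   | inj₂ (I , (uI , |I| , I⊆) , ind) = inj₂ (x ∷ I ,
        (All.tabulate (λ y∈ → All.lookup x∉ (proj₁ (far y∈))) ∷ uI , cong suc |I| ,
          λ { (here refl) → here refl ; (there y∈) → there (proj₁ (far y∈)) }) ,
        λ { (here refl) (here refl) _    → refl
          ; (here refl) (there z∈)  x≐z  → ⊥-elim (proj₂ (far z∈) x≐z)
          ; (there y∈)  (here refl) y≐x  → ⊥-elim (proj₂ (far y∈) (≐-sym y≐x))
          ; (there y∈)  (there z∈)  y≐z  → ind y∈ z∈ y≐z })
      where
      far : ∀ {y} → y ∈ I → y ∈ xs × ¬ x ≐ y
      far y∈ = ∈-filter⁻ (λ y → ¬? (x ≐? y)) {xs = xs} (I⊆ y∈)

    module Fats (m ℓ κ : ℕ) (0<t : 0 < t) (m≡ : m ≡ 2 * t * (1 + t) + 1)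
                (κ≡ : κ ≡ (m + m + (t * t + 1)) * (1 + t) + m)
                (plex-big : 2 * (t + (t * t + 1)) * (t + (t * t + 1)) * m + (t + (t * t + 1)) * (t + (t * t + 1)) * t < ℓ + m)
                (pair-big : 3 * t * m * m + 2 * m * m * m < ℓ + m)
                (size-big : 2 * (2 + t) * m + (2 + t) * t + (2 + t) * (2 + t) * κ < ℓ + m)
                (common-big : (2 * (1 + t) * m + (1 + t) * t + (1 + t) * (1 + t) * κ) * (1 + t) + 2 * (1 + t) * m + 4 * m < ℓ + m) where
      open Cliques m ℓ
      open Dichotomy 0<t m≡
      open Families κ
      open IsClique

      0<m : 0 < m
      0<m = subst (0 <_) (sym m≡) (m≤n+m 1 (2 * t * (1 + t)))

      0<L : 0 < L
      0<L = ≤-trans 0<m (m≤n+m m ℓ)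

      fat : List Vertex → Subset order
      fat C = satisfying (inside? C)

      fat-ext : ∀ C D → (∀ x → Inside C x → Inside D x) → (∀ x → Inside D x → Inside C x) → fat C ≡ fat D
      fat-ext C D to from = Vec.tabulate-cong λ x → does-⇔ (mk⇔ (to x) (from x)) (inside? C x) (inside? D x)

      common : List Vertex → List Vertex → List Vertex
      common C D = filter (inside? D) C

      common-∈ : ∀ C D {x} → x ∈ common C D → x ∈ C × Inside D x
      common-∈ C D = ∈-filter⁻ (inside? D) {xs = C}

      module _ {C D} (c : IsClique C) (d : IsClique D) (large : m + m + (t * t + 1) ≤ length (common C D)) where

        -- A vertex inside C misses at most `m` members of C, so it is near at least `m` of those
        -- members of C that are inside D; `pair-bound` for D then forces it inside D.
        common⇒⊆ : ∀ x → Inside C x → Inside D x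
        common⇒⊆ x i with inside? D x
        ... | yes i′ = i′
        ... | no o   = ⊥-elim (pair-bound {D} {x} {take m (near-part x (common C D))} d pair-big o
          (Unique.take⁺ m (Unique.filter⁺ (x ≐?_) (Unique.filter⁺ (inside? D) (unique c))))
          (λ y∈ → proj₂ (common-∈ C D (proj₁ (near∈ y∈)))) (λ y∈ → proj₂ (near∈ y∈))
          (length-take-≡ m (near-part x (common C D)) (+-cancelʳ-≤ m m _ (begin
            m + m                                                                           ≤⟨ m≤m+n (m + m) (t * t + 1) ⟩
            m + m + (t * t + 1)                                                             ≤⟨ large ⟩
            length (common C D)                                                            ≡⟨ parts x (common C D) ⟨
            length (near-part x (common C D)) + length (far-part x (common C D))          ≤⟨ +-monoʳ-≤ (length (near-part x (common C D)))
                                                                                                 (≤-trans (length-filter-twice (λ y → ¬? (x ≐? y)) (inside? D) C) (inside-far c i)) ⟩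
            length (near-part x (common C D)) + m                                          ∎))))
          where
          open ≤-Reasoning
          near∈ : ∀ {y} → y ∈ take m (near-part x (common C D)) → y ∈ common C D × x ≐ y
          near∈ y∈ = ∈-filter⁻ (x ≐?_) {xs = common C D} (∈-take m (near-part x (common C D)) y∈)

        -- `common C D` is not symmetric in C and D, so this direction needs another argument. A
        -- vertex outside C is near fewer than `m` members of C, hence far from t² + 1 of the
        -- members inside D, which `plex-bound` forbids for a vertex inside D.
        common⇒⊇ : ∀ x → Inside D x → Inside C x
        common⇒⊇ x i with inside? C x
        ... | yes i′ = i′
        ... | no o   = ⊥-elim (plex-bound {D} {x} {take (t * t + 1) (far-part x (common C D))} d plex-big i
          (Unique.take⁺ (t * t + 1) (Unique.filter⁺ (λ y → ¬? (x ≐? y)) (Unique.filter⁺ (inside? D) (unique c))))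
          (λ y∈ → proj₂ (common-∈ C D (proj₁ (far∈ y∈)))) (λ y∈ → proj₂ (far∈ y∈))
          (length-take-≡ (t * t + 1) (far-part x (common C D)) (+-cancelˡ-≤ m _ _ (begin
            m + (t * t + 1)                                                                 ≤⟨ m≤n+m _ m ⟩
            m + (m + (t * t + 1))                                                           ≡⟨ +-assoc m m _ ⟨
            m + m + (t * t + 1)                                                             ≤⟨ large ⟩
            length (common C D)                                                            ≡⟨ parts x (common C D) ⟨
            length (near-part x (common C D)) + length (far-part x (common C D))          ≤⟨ +-monoˡ-≤ (length (far-part x (common C D)))
                                                                                                 (≤-trans (length-filter-twice (x ≐?_) (inside? D) C) (subst (_≤ m) (sym (near-part-length x C)) (<⇒≤ (outside-near c o)))) ⟩
            m + length (far-part x (common C D))                                           ∎))))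
          where
          open ≤-Reasoning
          far∈ : ∀ {y} → y ∈ take (t * t + 1) (far-part x (common C D)) → y ∈ common C D × ¬ x ≐ y
          far∈ y∈ = ∈-filter⁻ (λ y → ¬? (x ≐? y)) {xs = common C D} (∈-take (t * t + 1) (far-part x (common C D)) y∈)

      distinct-common : ∀ {C D} → IsClique C → IsClique D → fat C ≢ fat D → length (common C D) < m + m + (t * t + 1)
      distinct-common {C} {D} c d C≢D = ≰⇒> λ large → C≢D (fat-ext C D (common⇒⊆ c d large) (common⇒⊇ c d large))

      -- Fewer than `n₀` members of C are inside D, each contributing at most L + t ≤ (1 + t) L;
      -- every other member contributes at most `m`, and there are at most L of them. This is the
      -- origin of `κ`.
      distinct-cross : ∀ {C D} → IsClique C → IsClique D → fat C ≢ fat D → ⟪ C , D ⟫ ≤ κ * L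
      distinct-cross {C} {D} c d C≢D = begin
        ⟪ C , D ⟫                                       ≤⟨ ∑ₗ-split (inside? D) {f = λ x → ∑ₗ (w x) D} C
                                                             (λ {x} _ _ → subst (λ k → ∑ₗ (w x) D ≤ k + t) (size d) (∑w-unique x (unique d)))
                                                             (λ _ o → outside-upper d o) ⟩
        length (common C D) * (L + t) + length C * m   ≤⟨ +-mono-≤ (*-mono-≤ (<⇒≤ (distinct-common c d C≢D)) (+-monoʳ-≤ L (m≤m*n t L {{>-nonZero 0<L}})))
                                                             (≤-reflexive (cong (_* m) (size c))) ⟩
        n₀ * (L + t * L) + L * m                        ≡⟨ identity n₀ L t m ⟩
        (n₀ * (1 + t) + m) * L                          ≡⟨ cong (_* L) κ≡ ⟨
        κ * L                                           ∎
        where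
        open ≤-Reasoning
        n₀ : ℕ
        n₀ = m + m + (t * t + 1)
        identity : ∀ n L t m → n * (L + t * L) + L * m ≡ (n * (1 + t) + m) * L
        identity = solve-∀

      isClique? : U.Decidable IsClique
      isClique? C = map′ to from (AllPairs.allPairs? (λ x y → ¬? (x ≟ y)) C ×-dec (All.all? (λ x → All.all? (x ≐?_) C) C ×-dec (length C ≟ℕ L)))
        where
        to : Unique C × All (λ x → All (x ≐_) C) C × length C ≡ L → IsClique C
        to (u , cl , s) = record { unique = u ; clique = λ x∈ y∈ → All.lookup (All.lookup cl x∈) y∈ ; size = s }
        from : IsClique C → Unique C × All (λ x → All (x ≐_) C) C × length C ≡ L
        from c = unique c , All.tabulate (λ x∈ → All.tabulate (clique c x∈)) , size c

      fat-≟ : ∀ C D → Dec (fat C ≡ fat D)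
      fat-≟ C D = Vec.≡-dec Bool._≟_ (fat C) (fat D)

      -- A fat set is represented by one of its cliques. The cliques are found by exhaustive search,
      -- and deduplication compares their fat sets, as many cliques have the same one.
      fats : List (List Vertex)
      fats = deduplicate fat-≟ (filter isClique? (tuples L))

      fats-clique : ∀ {C} → C ∈ fats → IsClique C
      fats-clique C∈ = proj₂ (∈-filter⁻ isClique? {xs = tuples L} (∈-deduplicate⁻ fat-≟ _ C∈))

      fats-distinct : AllPairs (λ C D → fat C ≢ fat D) fats
      fats-distinct = DecUnique.deduplicate-! (record
        { Carrier = List Vertex ; _≈_ = λ C D → fat C ≡ fat D
        ; isDecEquivalence = record { isEquivalence = record { refl = refl ; sym = sym ; trans = trans } ; _≟_ = fat-≟ } })
        (filter isClique? (tuples L))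

      fats-complete : ∀ {C} → IsClique C → ∃[ D ] (D ∈ fats × fat C ≡ fat D)
      fats-complete {C} c = find (Any.deduplicate⁺ fat-≟ {P = λ D → fat C ≡ fat D} (λ e f → trans f (sym e))
        (Any.map (λ { refl → refl }) (∈-filter⁺ isClique? (subst (λ k → C ∈ tuples k) (size c) (∈-tuples C)) c)))

      family : ∀ {F} → (∀ {C} → C ∈ F → IsClique C) → AllPairs (λ C D → fat C ≢ fat D) F → Family F
      family c []            = []
      family c (C≢ ∷ distinct) = (c (here refl) , λ D∈ → distinct-cross (c (here refl)) (c (there D∈)) (All.lookup C≢ D∈)) ∷ family (c ∘ there) distinct

      through : Vertex → List (List Vertex)
      through x = filter (λ C → inside? C x) fats

      through-∈ : ∀ {x C} → C ∈ through x → C ∈ fats × Inside C x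
      through-∈ {x} = ∈-filter⁻ (λ C → inside? C x) {xs = fats}

      through-distinct : ∀ x → AllPairs (λ C D → fat C ≢ fat D) (through x)
      through-distinct x = AllPairs.filter⁺ (λ C → inside? C x) fats-distinct

      through-upper : ∀ x → length (through x) ≤ 1 + t
      through-upper x = ≮⇒≥ λ large → family-size {x} {take (2 + t) (through x)}
        (family (λ C∈ → fats-clique (proj₁ (through-∈ (∈-take (2 + t) (through x) C∈)))) (AllPairs.take⁺ (2 + t) (through-distinct x)))
        size-big (λ C∈ → proj₂ (through-∈ (∈-take (2 + t) (through x) C∈))) (length-take-≡ (2 + t) (through x) large)

      fat-plex : ∀ {C} → IsClique C → IsPlex (t ^ 2 + 1) (fat C)
      fat-plex {C} c x x∈ = subst (∣ W ∣ ≤_) (trans (square t) (sym (m+n∸n≡m (t ^ 2) 1))) (≮⇒≥ λ large →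
        plex-bound {C} {x} {take (t * t + 1) (elements W)} c plex-big (∈-satisfying⁻ (inside? C) x∈)
          (Unique.take⁺ (t * t + 1) (elements-unique W)) (proj₁ ∘ facts) (proj₂ ∘ facts)
          (length-take-≡ (t * t + 1) (elements W) (subst₂ _≤_ (+-comm 1 (t * t)) (sym (length-elements W)) large)))
        where
        W : Subset order
        W = (fat C - x) ─ neighbours x
        square : ∀ t → t * t ≡ t ^ 2
        square t = cong (t *_) (sym (*-identityʳ t))
        facts : ∀ {y} → y ∈ take (t * t + 1) (elements W) → Inside C y × ¬ x ≐ y
        facts {y} y∈ = ∈-satisfying⁻ (inside? C) (Subset.p─q⊆p (fat C) Subset.⁅ x ⁆ y∈fat-x) , far
          where
          y∈W : y Subset.∈ W
          y∈W = ∈-elements⁻ W (∈-take (t * t + 1) (elements W) y∈)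
          y∈fat-x : y Subset.∈ fat C - x
          y∈fat-x = Subset.p─q⊆p (fat C - x) (neighbours x) y∈W
          far : ¬ x ≐ y
          far (inj₁ refl) = x∈p─q⇒x∉q (fat C) Subset.⁅ x ⁆ y∈fat-x (Subset.x∈⁅x⁆ x)
          far (inj₂ x~y)  = x∈p─q⇒x∉q (fat C - x) (neighbours x) y∈W (∈-satisfying⁺ (x ~?_) x~y)

      residual : Vertex → List (List Vertex) → Subset order
      residual x []      = neighbours x
      residual x (C ∷ F) = residual x F ─ fat C

      residual-size : ∀ x F → degree x ≤ ∣ residual x F ∣ + ∑ₗ (λ C → ∣ fat C ∣) F
      residual-size x []      = m≤m+n _ 0
      residual-size x (C ∷ F) = begin
        degree x                                                            ≤⟨ residual-size x F ⟩
        ∣ residual x F ∣ + ∑ₗ (λ C → ∣ fat C ∣) F                           ≤⟨ +-monoˡ-≤ _ (∣p∣≤∣p─q∣+∣q∣ (residual x F) (fat C)) ⟩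
        ∣ residual x F ─ fat C ∣ + ∣ fat C ∣ + ∑ₗ (λ C → ∣ fat C ∣) F       ≡⟨ +-assoc ∣ residual x F ─ fat C ∣ _ _ ⟩
        ∣ residual x F ─ fat C ∣ + (∣ fat C ∣ + ∑ₗ (λ C → ∣ fat C ∣) F)     ∎
        where open ≤-Reasoning

      residual⇒near : ∀ {x y} F → y Subset.∈ residual x F → x ≐ y
      residual⇒near {x} []      y∈ = inj₂ (∈-satisfying⁻ (x ~?_) y∈)
      residual⇒near {x} (C ∷ F) y∈ = residual⇒near F (Subset.p─q⊆p (residual x F) (fat C) y∈)

      residual-avoids : ∀ {x y C} F → C ∈ F → y Subset.∈ residual x F → ¬ y Subset.∈ fat C
      residual-avoids {x} (C ∷ F) (here refl) y∈ = x∈p─q⇒x∉q (residual x F) (fat C) y∈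
      residual-avoids {x} (C ∷ F) (there C∈)  y∈ = residual-avoids F C∈ (Subset.p─q⊆p (residual x F) (fat C) y∈)

      module Degrees (degree-large : ∀ x → ramsey L ((1 + t) * (1 + t) + 1) ≤ degree x)
                     (fat-small : ∀ {C x} → IsClique C → Inside C x → t * ∣ fat C ∣ + ramsey L ((1 + t) * (1 + t) + 1) ≤ degree x) where

        R : ℕ
        R = ramsey L ((1 + t) * (1 + t) + 1)

        through-lower : ∀ x → 1 + t ≤ length (through x)
        through-lower x = ≮⇒≥ λ { (s≤s few) → refute (residual-large few) }
          where
          W : Subset order
          W = residual x (through x)

          sizes : ∀ F → (∀ {C} → C ∈ F → IsClique C × Inside C x) → t * ∑ₗ (λ C → ∣ fat C ∣) F ≤ length F * (degree x ∸ R)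
          sizes F p = subst (_≤ length F * (degree x ∸ R)) (∑ₗ-* t (λ C → ∣ fat C ∣) F)
            (∑ₗ-upper F λ C∈ → m+n≤o⇒m≤o∸n _ (fat-small (proj₁ (p C∈)) (proj₂ (p C∈))))

          -- Each fat set C through x satisfies t `∣ fat C ∣` ≤ `degree x ∸ R`, so t or fewer of
          -- them cover at most `degree x ∸ R` neighbours.
          residual-large : length (through x) ≤ t → R ≤ ∣ W ∣
          residual-large few = +-cancelʳ-≤ (degree x ∸ R) R ∣ W ∣ (begin
            R + (degree x ∸ R)                            ≡⟨ m+[n∸m]≡n (degree-large x) ⟩
            degree x                                      ≤⟨ residual-size x (through x) ⟩
            ∣ W ∣ + ∑ₗ (λ C → ∣ fat C ∣) (through x)      ≤⟨ +-monoʳ-≤ ∣ W ∣ (*-cancelˡ-≤ t {{>-nonZero 0<t}} (≤-trans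
                                                               (sizes (through x) λ C∈ → fats-clique (proj₁ (through-∈ C∈)) , proj₂ (through-∈ C∈))
                                                               (*-monoˡ-≤ (degree x ∸ R) few))) ⟩
            ∣ W ∣ + (degree x ∸ R)                        ∎)
            where open ≤-Reasoning

          -- A clique among the neighbours outside every fat set through x
          -- would itself have such a fat set.
          clique-case : ∀ {C} → Sublist L (elements W) C → (∀ {y z} → y ∈ C → z ∈ C → y ≐ z) → ⊥
          clique-case {[]}    (_ , |C| , _) cl = <-irrefl |C| 0<L
          clique-case {c ∷ C} (u , |C| , C⊆) cl = avoid (fats-complete isc)
            where
            isc : IsClique (c ∷ C)
            isc = record { unique = u ; clique = cl ; size = |C| }
            x-inside : Inside (c ∷ C) x
            x-inside = ≤-trans (m≤m+n ℓ m) (≤-trans (≤-reflexive (trans (sym |C|) (sym (*-identityʳ (length (c ∷ C))))))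
              (∑ₗ-lower (c ∷ C) λ y∈ → ≤-reflexive (sym (near-yes (residual⇒near (through x) (∈-elements⁻ W (C⊆ y∈)))))))
            avoid : ∃[ D ] (D ∈ fats × fat (c ∷ C) ≡ fat D) → ⊥
            avoid (D , D∈ , e) = residual-avoids (through x)
              (∈-filter⁺ (λ C → inside? C x) D∈ (∈-satisfying⁻ (inside? D) (subst (x Subset.∈_) e (∈-satisfying⁺ (inside? (c ∷ C)) x-inside))))
              (∈-elements⁻ W (C⊆ (here refl)))
              (subst (c Subset.∈_) e (∈-satisfying⁺ (inside? (c ∷ C)) (clique-inside isc (here refl))))

          refute : R ≤ ∣ W ∣ → ⊥
          refute R≤ with ramsey-dichotomy L ((1 + t) * (1 + t) + 1) (elements W) (elements-unique W) (subst (R ≤_) (sym (length-elements W)) R≤)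
          ... | inj₁ (C , sub , cl)              = clique-case sub cl
          ... | inj₂ (I , (u , |I| , I⊆) , ind) = star-bound x I u (λ y∈ → residual⇒near (through x) (∈-elements⁻ W (I⊆ y∈))) ind |I|

        through-size : ∀ x → length (through x) ≡ 1 + t
        through-size x = ≤-antisym (through-upper x) (through-lower x)

        through-family : ∀ x → Family (through x)
        through-family x = family (λ C∈ → fats-clique (proj₁ (through-∈ C∈))) (through-distinct x)

        shared≤adjacent : ∀ {x y} → x ≢ y → length (filter (λ C → inside? C y) (through x)) ≤ adjacent G t x y
        shared≤adjacent {x} {y} x≢y = common-bound (through-family x) 0<m
          -- An adjacency entry is at most 1, so 2 (1 + A) m ≤ 4 m, which is the last summand in
          -- `common-big`.
          (≤-<-trans (+-mono-≤ (m≤m+n (κ₁ * (1 + t)) (2 * (1 + t) * m)) (*-monoˡ-≤ m {2 * (1 + adjacent G t x y)} {4} (*-monoʳ-≤ 2 (s≤s adjacent≤1)))) common-big)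
          (λ C∈ → proj₂ (through-∈ C∈)) x≢y (through-size x)
          where
          adjacent≤1 : adjacent G t x y ≤ 1
          adjacent≤1 with does (x ~? y)
          ... | Bool.true  = s≤s z≤n
          ... | Bool.false = z≤n

        adjacent⇒shared : ∀ {x y} → x ~ y → ∃[ C ] (C ∈ fats × Inside C x × Inside C y)
        adjacent⇒shared {x} {y} x~y with Any.any? (λ C → inside? C y) (through x)
        ... | yes some = let C , C∈ , i = find some in C , proj₁ (through-∈ C∈) , proj₂ (through-∈ C∈) , i
        ... | no none  = ⊥-elim (adjacent-common {x} {y} (through-family x) 0<m (≤-<-trans (m≤m+n (κ₁ * (1 + t) + 2 * (1 + t) * m) (4 * m)) common-big)
          (λ C∈ → proj₂ (through-∈ C∈))
          (λ C∈ → outside-upper (fats-clique (proj₁ (through-∈ C∈))) (λ i → none (lose C∈ i)))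
          (through-size x) (inj₂ x~y))

-- The hypergraph dual to the incidence of vertices and fat sets.

module DualHypergraph where

  open AdjacencyForm
  open SubsetElements
  open import Defs
  open import Data.Bool.Base using (true; false)
  open import Data.Empty using (⊥-elim)
  open import Data.Fin.Base as Fin using (Fin; zero; suc; cast)
  import Data.Fin.Properties as Fin
  open import Data.Fin.Subset as Subset using (Subset; ∣_∣; _∩_)
  import Data.Fin.Subset.Properties as Subset
  open import Data.List.Base as List using (List; []; _∷_; length; filter; lookup)
  open import Data.List.Properties using (filter-accept; length-tabulate; lookup-tabulate)
  open import Data.List.Membership.Propositional using (_∈_)
  open import Data.List.Membership.Propositional.Properties using (∈-filter⁺; ∈-lookup; ∈-length; ∈-tabulate⁻)
  open import Data.List.Relation.Unary.All using (_∷_)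
  import Data.List.Relation.Unary.All.Properties as All
  open import Data.List.Relation.Unary.AllPairs using ([]; _∷_)
  open import Data.List.Relation.Unary.Any as Any using (here; there)
  open import Data.List.Relation.Unary.Any.Properties using (lookup-index)
  open import Data.List.Relation.Unary.Unique.Propositional using (Unique)
  import Data.List.Relation.Unary.Unique.Propositional.Properties as Unique
  open import Data.Nat.Base hiding (equal)
  open import Data.Nat.Properties hiding (_≟_)
  open import Data.Product.Base using (∃-syntax; _×_; _,_)
  open import Function.Base using (_∘_)
  open import Function.Bundles using (_⇔_; mk⇔; mk↔ₛ′)
  open import Relation.Binary.PropositionalEquality
  open import Relation.Nullary.Decidable using (does; yes; no; _×-dec_)
  import Relation.Unary as U

  module _ {A : Set} where

    length-filter-× : ∀ {P Q : A → Set} (P? : U.Decidable P) (Q? : U.Decidable Q) xs →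
      length (filter Q? (filter P? xs)) ≡ length (filter (λ x → P? x ×-dec Q? x) xs)
    length-filter-× P? Q? []       = refl
    length-filter-× P? Q? (x ∷ xs) with does (P? x)
    ... | false = length-filter-× P? Q? xs
    ... | true with does (Q? x)
    ...   | true  = cong suc (length-filter-× P? Q? xs)
    ...   | false = length-filter-× P? Q? xs

    module _ {P : A → Set} (P? : U.Decidable P) where

      ∣satisfying∣ : ∀ xs → ∣ satisfying (λ i → P? (lookup xs i)) ∣ ≡ length (filter P? xs)
      ∣satisfying∣ []       = refl
      ∣satisfying∣ (x ∷ xs) with does (P? x)
      ... | true  = cong suc (∣satisfying∣ xs)
      ... | false = ∣satisfying∣ xs

      one-position : ∀ xs i → P (lookup xs i) → 1 ≤ length (filter P? xs)
      one-position xs i p = ∈-length (∈-filter⁺ P? (∈-lookup {xs = xs} i) p)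

      two-positions : ∀ xs i j → i ≢ j → P (lookup xs i) → P (lookup xs j) → 2 ≤ length (filter P? xs)
      two-positions (x ∷ xs) zero    zero    i≢j p q = ⊥-elim (i≢j refl)
      two-positions (x ∷ xs) zero    (suc j) i≢j p q = subst (2 ≤_) (cong length (sym (filter-accept P? p))) (s≤s (one-position xs j q))
      two-positions (x ∷ xs) (suc i) zero    i≢j p q = subst (2 ≤_) (cong length (sym (filter-accept P? q))) (s≤s (one-position xs i p))
      two-positions (x ∷ xs) (suc i) (suc j) i≢j p q = ≤-trans (two-positions xs i j (i≢j ∘ cong suc) p q) grow
        where
        grow : length (filter P? xs) ≤ length (filter P? (x ∷ xs))
        grow with does (P? x)
        ... | true  = n≤1+n _
        ... | false = ≤-refl

  module Dual (G : Graph) (t : ℕ) (0<t : 0 < t) {Block : Set} (blocks : List Block)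
              {On : Block → Graph.Vertex G → Set} (on? : ∀ b → U.Decidable (On b))
              (through-size : ∀ x → length (filter (λ b → on? b x) blocks) ≡ 1 + t)
              (shared≤adjacent : ∀ {x y} → x ≢ y → length (filter (λ b → on? b y) (filter (λ b → on? b x) blocks)) ≤ adjacent G t x y)
              (adjacent⇒shared : ∀ {x y} → Graph._~_ G x y → ∃[ b ] (b ∈ blocks × On b x × On b y)) where
    open Graph G hiding (order)
    open Graph G using () renaming (order to n)

    k : ℕ
    k = length blocks

    edge : Vertex → Subset k
    edge x = satisfying (λ i → on? (lookup blocks i) x)

    edge-on : ∀ {x i} → i Subset.∈ edge x → On (lookup blocks i) x
    edge-on {x} = ∈-satisfying⁻ (λ i → on? (lookup blocks i) x)

    edge-size : ∀ x → ∣ edge x ∣ ≡ 1 + t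
    edge-size x = trans (∣satisfying∣ (λ b → on? b x) blocks) (through-size x)

    shared : ∀ x y → length (filter (λ b → on? b y) (filter (λ b → on? b x) blocks)) ≡ length (filter (λ b → on? b x ×-dec on? b y) blocks)
    shared x y = length-filter-× (λ b → on? b x) (λ b → on? b y) blocks

    adjacent≤1 : ∀ x y → adjacent G t x y ≤ 1
    adjacent≤1 x y with does (x ~? y)
    ... | true  = s≤s z≤n
    ... | false = z≤n

    0<adjacent⇒~ : ∀ x y → 0 < adjacent G t x y → x ~ y
    0<adjacent⇒~ x y 0<a with x ~? y
    ... | yes x~y = x~y
    ... | no _    with () ← 0<a

    -- Two vertices in two common blocks, read from the side of the blocks, violate linearity; read
    -- from the side of the vertices, they violate the bound of one shared block.
    linear : ∀ {x y i j} → i ≢ j → i Subset.∈ edge x → j Subset.∈ edge x → i Subset.∈ edge y → j Subset.∈ edge y → x ≡ y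
    linear {x} {y} {i} {j} i≢j i∈x j∈x i∈y j∈y with x Fin.≟ y
    ... | yes x≡y = x≡y
    ... | no x≢y  = ⊥-elim (<⇒≱ (s≤s (adjacent≤1 x y)) (≤-trans
      (subst (2 ≤_) (sym (shared x y)) (two-positions (λ b → on? b x ×-dec on? b y) blocks i j i≢j (edge-on i∈x , edge-on i∈y) (edge-on j∈x , edge-on j∈y)))
      (shared≤adjacent x≢y)))

    two-blocks : ∀ x → ∃[ i ] ∃[ j ] (i ≢ j × i Subset.∈ edge x × j Subset.∈ edge x)
    two-blocks x with elements (edge x) | elements-unique (edge x) | length-elements (edge x) | ∈-elements⁻ (edge x)
    ... | []        | _                | e | _  = ⊥-elim (0≢1+n (trans e (edge-size x)))
    ... | i ∷ []    | _                | e | _  = ⊥-elim (<-irrefl (suc-injective (trans e (edge-size x))) 0<t)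
    ... | i ∷ j ∷ _ | (i≢j ∷ _) ∷ _    | _ | ∈⁻ = i , j , i≢j , ∈⁻ (here refl) , ∈⁻ (there (here refl))

    -- An edge contains 1 + t ≥ 2 blocks, and two blocks determine a vertex by `linear`. Here
    -- `0 < t` ensures that distinct vertices of the graph give distinct edges.
    edge-injective : ∀ {x y} → edge x ≡ edge y → x ≡ y
    edge-injective {x} {y} e with two-blocks x
    ... | i , j , i≢j , i∈ , j∈ = linear i≢j i∈ j∈ (subst (i Subset.∈_) e i∈) (subst (j Subset.∈_) e j∈)

    hypergraph : Hypergraph
    hypergraph = record
      { order    = k
      ; edges    = List.tabulate edge
      ; distinct = Unique.tabulate⁺ edge-injective
      ; nonempty = All.tabulate⁺ λ x → let i , _ , _ , i∈ , _ = two-blocks x in i , i∈ }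

    open Hypergraph hypergraph using (edges; IsLinear; IsUniform)

    isUniform : IsUniform (t + 1)
    isUniform = All.tabulate⁺ λ x → trans (edge-size x) (+-comm 1 t)

    isLinear : IsLinear
    isLinear i j i≢j e e′ e∈ e′∈ i∈e j∈e i∈e′ j∈e′ with ∈-tabulate⁻ {f = edge} e∈ | ∈-tabulate⁻ {f = edge} e′∈
    ... | x , refl | y , refl = cong edge (linear i≢j i∈e j∈e i∈e′ j∈e′)

    adjacent⇔meet : ∀ x y → x ~ y ⇔ (edge x ≢ edge y × Subset.Nonempty (edge x ∩ edge y))
    adjacent⇔meet x y = mk⇔ to from
      where
      to : x ~ y → edge x ≢ edge y × Subset.Nonempty (edge x ∩ edge y)
      to x~y with adjacent⇒shared x~y
      ... | b , b∈ , on-x , on-y = (λ e → ~-irrefl (edge-injective e) x~y) , Any.index b∈ ,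
        Subset.x∈p∩q⁺ (∈-satisfying⁺ (λ i → on? (lookup blocks i) x) (subst (λ b → On b x) (lookup-index b∈) on-x)
                     , ∈-satisfying⁺ (λ i → on? (lookup blocks i) y) (subst (λ b → On b y) (lookup-index b∈) on-y))
      from : edge x ≢ edge y × Subset.Nonempty (edge x ∩ edge y) → x ~ y
      from (ex≢ey , i , i∈) = let i∈x , i∈y = Subset.x∈p∩q⁻ (edge x) (edge y) i∈ in
        0<adjacent⇒~ x y (≤-trans
          (subst (1 ≤_) (sym (shared x y)) (one-position (λ b → on? b x ×-dec on? b y) blocks i (edge-on i∈x , edge-on i∈y)))
          (shared≤adjacent (ex≢ey ∘ cong edge)))

    isomorphic : G ≅ intersectionGraph hypergraph
    isomorphic = mk↔ₛ′ to from (Fin.cast-involutive (sym e) e) (Fin.cast-involutive e (sym e)) , λ x y →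
      subst₂ (λ p q → x ~ y ⇔ (p ≢ q × Subset.Nonempty (p ∩ q))) (sym (lookup-tabulate edge x)) (sym (lookup-tabulate edge y)) (adjacent⇔meet x y)
      where
      e : length edges ≡ n
      e = length-tabulate edge
      to : Fin n → Fin (length edges)
      to = cast (sym e)
      from : Fin (length edges) → Fin n
      from = cast e

-- Choice of constants and conclusion.

open import Defs
open import Data.Nat using (ℕ; _+_; _^_; _<_; NonZero)
open import Data.Integer using (+_; -_) renaming (_-_ to _-ℤ_)
open import Data.Rational using (_/_) renaming (_≤_ to _≤ℚ_)
open import Data.Fin.Subset using (Subset; _∈_; ∣_∣)
open import Data.Product using (Σ-syntax; ∃-syntax; _×_)
open AdjacencyForm
open CliqueBounds
open SubsetElements
open FatSets
open DualHypergraph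
open import Data.Empty using (⊥-elim)
open import Data.Product using (_,_)
open import Data.Nat using (>-nonZero⁻¹; zero; suc; _*_; _∸_; _≤_; s≤s; z≤n)
import Data.Nat.Properties as ℕ
import Data.Integer as ℤ
import Data.Integer.Properties as ℤ
import Data.Rational.Properties as ℚ
import Data.Rational.Unnormalised as ℚᵘ
import Data.Rational.Unnormalised.Properties as ℚᵘ
open import Relation.Binary.PropositionalEquality using (_≡_; refl; sym; trans; subst; subst₂)

-- Brings the rational plex hypothesis into `ℕ`. The assumption k ≤ d makes the integer difference a
-- natural number, so that truncated subtraction agrees with it.
clear-denominators : ∀ s d k t′ → k ≤ d → (+ s) / 1 ≤ℚ (+ d -ℤ + k) / suc t′ → suc t′ * s + k ≤ d
clear-denominators s d k t′ k≤d s≤ = subst (suc t′ * s + k ≤_) (ℕ.m∸n+n≡m k≤d)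
  (ℕ.+-monoˡ-≤ k (subst₂ _≤_ (ℕ.*-comm s (suc t′)) (ℕ.*-identityʳ (d ∸ k)) cleared))
  where
  difference : + d -ℤ + k ≡ + (d ∸ k)
  difference = trans (ℤ.m-n≡m⊖n d k) (ℤ.⊖-≥ k≤d)
  unnormalised : ℚᵘ.mkℚᵘ (+ s) 0 ℚᵘ.≤ ℚᵘ.mkℚᵘ (+ (d ∸ k)) t′
  unnormalised = ℚᵘ.≤-respˡ-≃ (ℚ.toℚᵘ-fromℚᵘ (ℚᵘ.mkℚᵘ (+ s) 0)) (ℚᵘ.≤-respʳ-≃ (ℚ.toℚᵘ-fromℚᵘ (ℚᵘ.mkℚᵘ (+ (d ∸ k)) t′))
    (ℚ.toℚᵘ-mono-≤ (subst (λ z → (+ s) / 1 ≤ℚ z / suc t′) difference s≤)))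
  cleared : s * suc t′ ≤ (d ∸ k) * 1
  cleared = ℤ.drop‿+≤+ (subst₂ ℤ._≤_ (sym (ℤ.pos-* s (suc t′))) (sym (ℤ.pos-* (d ∸ k) 1)) (ℚᵘ.drop-*≤* unnormalised))

module Constants (t : ℕ) where

  -- The numbers `plex`, `pair`, `size` and `common` are the error terms that L = ℓ + m has to
  -- exceed; `ℓ` is the successor of their sum. `K` is the successor of the Ramsey number for a
  -- clique of size L or a star with (1 + t)² + 1 leaves, so that it is positive.
  m κ plex pair size common ℓ K : ℕ
  m = 2 * t * (1 + t) + 1
  κ = (m + m + (t * t + 1)) * (1 + t) + m
  plex = 2 * (t + (t * t + 1)) * (t + (t * t + 1)) * m + (t + (t * t + 1)) * (t + (t * t + 1)) * t
  pair = 3 * t * m * m + 2 * m * m * m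
  size = 2 * (2 + t) * m + (2 + t) * t + (2 + t) * (2 + t) * κ
  common = (2 * (1 + t) * m + (1 + t) * t + (1 + t) * (1 + t) * κ) * (1 + t) + 2 * (1 + t) * m + 4 * m
  ℓ = suc (plex + pair + size + common)
  K = suc (ramsey (ℓ + m) ((1 + t) * (1 + t) + 1))

  private
    exceeds : ∀ {a b} m → a ≤ b → a < suc b + m
    exceeds m a≤b = s≤s (ℕ.≤-trans a≤b (ℕ.m≤m+n _ m))

    first : ∀ a b c d → a ≤ a + b + c + d
    first a b c d = ℕ.≤-trans (ℕ.m≤m+n a b) (ℕ.≤-trans (ℕ.m≤m+n (a + b) c) (ℕ.m≤m+n (a + b + c) d))

    second : ∀ a b c d → b ≤ a + b + c + d
    second a b c d = ℕ.≤-trans (ℕ.m≤n+m b a) (ℕ.≤-trans (ℕ.m≤m+n (a + b) c) (ℕ.m≤m+n (a + b + c) d))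

    third : ∀ a b c d → c ≤ a + b + c + d
    third a b c d = ℕ.≤-trans (ℕ.m≤n+m c (a + b)) (ℕ.m≤m+n (a + b + c) d)

  plex< : plex < ℓ + m
  plex< = exceeds m (first plex pair size common)

  pair< : pair < ℓ + m
  pair< = exceeds m (second plex pair size common)

  size< : size < ℓ + m
  size< = exceeds m (third plex pair size common)

  common< : common < ℓ + m
  common< = exceeds m (ℕ.m≤n+m common (plex + pair + size))

theorem1p2 : (t : ℕ) .{{_ : NonZero t}} →
    ∃[ K ] (0 < K × ((G : Graph) → let open Graph G in
      (∀ x → K < degree x) →
      (∀ x (S : Subset order) → IsPlex (t ^ 2 + 1) S → x ∈ S →
        (+ ∣ S ∣) / 1 ≤ℚ (+ degree x -ℤ + K) / t) →
      (λmin[ G ]≥ fromℚ ((- (+ t) -ℤ + 1) / 1)) →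
      Σ[ H ∈ Hypergraph ]
        (Hypergraph.IsLinear H × Hypergraph.IsUniform H (t + 1) × (G ≅ intersectionGraph H))))
theorem1p2 zero {{t≢0}} = ⊥-elim (ℕ.<-irrefl refl (>-nonZero⁻¹ 0 {{t≢0}}))
theorem1p2 t@(suc t′) = K , s≤s z≤n , λ G K<degree plex-small λmin≥ →
  let open Structure G t (weight-positive G t λmin≥)
      open Tests.Cliques G t (weight-positive G t λmin≥) m ℓ using (inside?)
      open Fats m ℓ κ (s≤s z≤n) refl refl plex< pair< size< common<
      open Degrees
        (λ x → ℕ.<⇒≤ (ℕ.<⇒≤ (K<degree x)))
        (λ {C} {x} c i → ℕ.≤-trans (ℕ.+-monoʳ-≤ (t * ∣ fat C ∣) (ℕ.n≤1+n _))
          (clear-denominators ∣ fat C ∣ (Graph.degree G x) K t′ (ℕ.<⇒≤ (K<degree x))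
            (plex-small x (fat C) (fat-plex c) (∈-satisfying⁺ (inside? C) i))))
      open Dual G t (s≤s z≤n) fats inside? through-size shared≤adjacent adjacent⇒shared
  in hypergraph , isLinear , isUniform , isomorphic
  where open Constants t
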